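{- There is a deterministic algorithm that, given any positive integer $n$ and any $n\times n$ matrix $A$ with entries from a totally ordered set (the entries need not be distinct), identifies the strict saddlepoint of $A$ if it exists, or correctly reports that $A$ has no strict saddlepoint, in $O(n)$ worst-case time.
   Context: An entry $A_{i,j}$ of a matrix $A$ is a strict saddlepoint if $A_{i,j}>A_{i,j'}$ for all columns $j'\neq j$ and $A_{i,j}<A_{i',j}$ for all rows $i'\neq i$; that is, it is strictly larger than every other entry in its row and strictly smaller than every other entry in its column. A matrix has at most one strict saddlepoint. Model of computation: a unit-cost RAM with access to the matrix by queries; any entry $A_{i,j}$ can be queried in constant time, and any pair of matrix entries can be compared in constant time. The algorithm is comparison-based: it accesses the values of entries only through such comparisons. The constant hidden in $O(n)$ is absolute. In particular, the algorithm does not read the whole matrix. -}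

module Defs where

open import Level using (Level)
open import Data.Bool.Base using (Bool; if_then_else_)
open import Data.Fin.Base using (Fin; fromℕ<; toℕ)
open import Data.List.Base using (List; head; drop)
open import Data.Maybe.Base using (Maybe; just; nothing)
open import Data.Nat.Base using (ℕ; suc; _+_; _∸_)
open import Data.Nat.Properties using (_≟_; _<?_)
open import Data.Product.Base using (_×_; _,_; ∃₂)
open import Relation.Binary.Bundles using (StrictTotalOrder)
open import Relation.Binary.PropositionalEquality.Core using (_≡_; _≢_)
open import Relation.Nullary using (¬_; does; yes; no)

private variable
  a ℓ₁ ℓ₂ : Level

-- The model of computation is a random access machine in the style of Cook and
-- Reckhow: infinitely many registers holding natural numbers, indirect
-- addressing, and one time unit per instruction.  A program is a finite list
-- of instructions and jump targets are absolute positions in that list.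

Reg Label : Set
Reg   = ℕ
Label = ℕ

-- With x[k] for the content of register k:
--   const d k             x[d] := k
--   add d r s             x[d] := x[r] + x[s]
--   sub d r s             x[d] := x[r] ∸ x[s]
--   load d r              x[d] := x[x[r]]
--   store r s             x[x[r]] := x[s]
--   jpos r l              go to l if x[r] > 0
--   jless r s r' s' l     go to l if A x[r] x[s] < A x[r'] x[s']
--   answer r s            halt, reporting a strict saddlepoint at (x[r] , x[s])
--   none                  halt, reporting that there is no strict saddlepoint
-- `jless` is the only instruction that depends on the input matrix A.  Registers
-- hold indices, never entries, so entries are accessed only by comparisons.
data Instr : Set where
  const : Reg → ℕ → Instr
  add   : Reg → Reg → Reg → Instr
  sub   : Reg → Reg → Reg → Instr
  load  : Reg → Reg → Instr
  store : Reg → Reg → Instr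
  jpos  : Reg → Label → Instr
  jless : Reg → Reg → Reg → Reg → Label → Instr
  answer : Reg → Reg → Instr
  none  : Instr

Program : Set
Program = List Instr

Store : Set
Store = Reg → ℕ

infixl 6 _[_≔_]

_[_≔_] : Store → Reg → ℕ → Store
(x [ d ≔ v ]) k = if does (k ≟ d) then v else x k

-- The dimension n is placed in register 0; all other registers are 0.
initial : ℕ → Store
initial n = (λ _ → 0) [ 0 ≔ n ]

record Config : Set where
  constructor ⟨_,_⟩
  field
    pc   : Label
    regs : Store

-- `just (i , j)` reports position (i , j), counting rows and columns from 0;
-- `nothing` reports that there is no strict saddlepoint.
Report : Set
Report = Maybe (ℕ × ℕ)

-- A machine gets stuck when the program counter leaves the program, or when a
-- comparison refers to a position outside the matrix.
data Outcome : Set where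
  running : Config → Outcome
  halted  : Report → Outcome
  stuck   : Outcome

module _ (O : StrictTotalOrder a ℓ₁ ℓ₂) where

  private module O = StrictTotalOrder O

  Matrix : ℕ → Set a
  Matrix n = Fin n → Fin n → O.Carrier

  module _ {n : ℕ} (A : Matrix n) where

    StrictSaddlepoint : Fin n → Fin n → Set ℓ₂
    StrictSaddlepoint i j =
      (∀ j′ → j′ ≢ j → A i j′ O.< A i j) ×
      (∀ i′ → i′ ≢ i → A i j O.< A i′ j)

    Correct : Report → Set ℓ₂
    Correct (just (p , q)) =
      ∃₂ λ i j → toℕ i ≡ p × toℕ j ≡ q × StrictSaddlepoint i j
    Correct nothing = ∀ i j → ¬ StrictSaddlepoint i j

    entry : ℕ → ℕ → Maybe O.Carrier
    entry p q with p <? n | q <? n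
    ... | yes p<n | yes q<n = just (A (fromℕ< p<n) (fromℕ< q<n))
    ... | yes _   | no _    = nothing
    ... | no _    | _       = nothing

    less : Maybe O.Carrier → Maybe O.Carrier → Maybe Bool
    less (just u) (just v) = just (does (u O.<? v))
    less (just _) nothing  = nothing
    less nothing  _        = nothing

    branch : Maybe Bool → Label → Config → Outcome
    branch (just b) l ⟨ pc , x ⟩ = running ⟨ if b then l else suc pc , x ⟩
    branch nothing  l _          = stuck

    execute : Instr → Config → Outcome
    execute (const d k) ⟨ pc , x ⟩ = running ⟨ suc pc , x [ d ≔ k ] ⟩
    execute (add d r s) ⟨ pc , x ⟩ = running ⟨ suc pc , x [ d ≔ x r + x s ] ⟩
    execute (sub d r s) ⟨ pc , x ⟩ = running ⟨ suc pc , x [ d ≔ x r ∸ x s ] ⟩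
    execute (load d r)  ⟨ pc , x ⟩ = running ⟨ suc pc , x [ d ≔ x (x r) ] ⟩
    execute (store r s) ⟨ pc , x ⟩ = running ⟨ suc pc , x [ x r ≔ x s ] ⟩
    execute (jpos r l)  ⟨ pc , x ⟩ =
      branch (just (does (0 <? x r))) l ⟨ pc , x ⟩
    execute (jless r s r′ s′ l) ⟨ pc , x ⟩ =
      branch (less (entry (x r) (x s)) (entry (x r′) (x s′))) l ⟨ pc , x ⟩
    execute (answer r s) ⟨ pc , x ⟩ = halted (just (x r , x s))
    execute none         _          = halted nothing

    step : Program → Config → Outcome
    step P c with head (drop (Config.pc c) P)
    ... | just instr = execute instr c
    ... | nothing    = stuck

    -- `HaltsFrom P c t r`: started in configuration c, the program P halts with
    -- report r after executing exactly t instructions.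
    data HaltsFrom (P : Program) : Config → ℕ → Report → Set where
      halt : ∀ {c r} → step P c ≡ halted r → HaltsFrom P c 1 r
      next : ∀ {c c′ t r} → step P c ≡ running c′ →
             HaltsFrom P c′ t r → HaltsFrom P c (suc t) r

    Halts : Program → ℕ → Report → Set
    Halts P = HaltsFrom P ⟨ 0 , initial n ⟩

-- Transposing the matrix and reversing the order if necessary, let there be at least as
-- many rows as columns.  A column j keeps the smallest entry u j queried in it and the
-- row g j of that entry.  A strict saddlepoint z in row i and column j satisfies
-- z ≤ u j, and is at least every entry of row i.  Hence, for a threshold m:
--   * if u ≤ m for all columns, a row with a known entry ≥ m is dropped, unless it is
--     g j for some j (then it may be the saddlepoint's row, with u j = m = z);
--   * if all rows have a known entry ≥ m in certain columns, the columns with u ≤ m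
--     outside of them are dropped.
-- If the numbers of rows and columns differ by a factor of at most 4, let m be the
-- median of u.  Every comparison of m with an entry of a column with u ≥ m settles the
-- row or the column, so in linear time one of the two cases occurs, and a constant
-- fraction of the rows or of the columns is dropped.
-- If there are many more rows, then `drain` lowers u below m on a set S of columns: it
-- queries rows until as many rows as S has columns are known to reach m, and from then
-- on repeatedly halves S at the median m₁ of u, drains the upper half below m₁, which
-- definitely discards the rows set aside there, and returns to S the columns that are
-- still above m.  The rows set aside for S pay for the halvings.  When the rows are
-- exhausted, those set aside by the nested calls number O(|S|), as the sets shrink
-- geometrically.  In this way r rows are reduced to at most three times the number of
-- columns in time O(r).

module Submission where

open import Defs
open import Data.Nat.Base using (ℕ; NonZero; _*_; _≤_)
open import Data.Product.Base using (_×_; ∃-syntax)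
open import Relation.Binary.Bundles using (StrictTotalOrder)

open import Level using (Level; _⊔_)
import Algebra.Solver.CommutativeMonoid as CommutativeMonoidSolver
open import Data.Bool.Base using (Bool; true; false; if_then_else_; not; _∧_; T)
open import Data.Bool.Properties using (T-∧)
open import Data.Empty using (⊥; ⊥-elim)
open import Data.Fin.Base as Fin using (Fin; zero; suc; toℕ; fromℕ<)
open import Data.Fin.Properties using (toℕ<n; fromℕ<-toℕ; toℕ-fromℕ<; toℕ-injective) renaming (_≟_ to _≟ᶠ_)
open import Data.List.Base using (List; []; _∷_; [_]; _++_; _ʳ++_; drop; length; map; tabulate)
open import Data.List.Properties using (length-++; length-ʳ++; length-map; map-++; ++-assoc; ++-identityʳ)
import Data.List.Membership.DecPropositional as DecMembership
open import Data.List.Membership.Propositional using (_∈_; _∉_)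
open import Data.List.Membership.Propositional.Properties using (∈-map⁻; ∈-map⁺; ∈-++⁺ˡ; ∈-++⁺ʳ; ∈-++⁻)
import Data.List.Relation.Binary.Permutation.Propositional as Permutation
open Permutation using (_↭_; ↭-refl; ↭-reflexive; ↭-sym; ↭-trans; ↭-prep; ↭-swap)
open import Data.List.Relation.Binary.Permutation.Propositional.Properties
  using (shift; ++⁺; ++⁺ˡ; ++⁺ʳ; ++-comm; map⁺; All-resp-↭; ∈-resp-↭; ↭-length; ++-commutativeMonoid)
open import Data.List.Relation.Unary.All as All using (All; []; _∷_)
import Data.List.Relation.Unary.All.Properties as Allₚ
open import Data.List.Relation.Unary.AllPairs using (AllPairs; []; _∷_)
open import Data.List.Relation.Unary.Any using (here; there)
open import Data.Maybe.Base using (Maybe; just; nothing; _>>=_)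
open import Data.Nat.Base hiding (less; compare; _⊔_)
open import Data.Nat.Properties
open import Data.Nat.Solver using (module +-*-Solver)
open import Data.Product.Base using (∃₂; _,_; proj₁; proj₂)
open import Data.Sum.Base using (_⊎_; inj₁; inj₂)
open import Data.Vec.Base as Vec using (Vec; []; _∷_)
open import Data.Vec.N-ary using (N-ary; _$ⁿ_)
open import Function.Base using (case_of_)
open import Function.Bundles using (Equivalence)
open import Relation.Binary.Definitions using (tri<; tri≈; tri>)
open import Relation.Binary.PropositionalEquality hiding ([_])
open import Relation.Nullary using (Dec; yes; no; does; ¬_)
open import Relation.Nullary.Decidable using (dec-true; dec-false; dec-yes)

-- The program has to be a concrete instruction list, while the algorithm is a nest of recursive
-- list functions. An abstract machine mediates: its values are immutable binary trees, its programs
-- tables of function bodies with an explicit call stack. Heap cells are never overwritten or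
-- reclaimed, so a represented value stays represented. The table is fixed, hence one abstract step
-- costs boundedly many instructions, and time can be counted in function calls. The obstacle to
-- correctness is that a nested computation drops rows without knowing all columns. `Sound`
-- therefore lets the row of a saddlepoint disappear if its column is not among those held, and the
-- caller has to show that it still has this row or that the column is foreign to it too. Ties are
-- settled by strictness: a key that is not above a saddlepoint of its column is the saddlepoint.
-- The time constants come from the inside out: selection costs 500 steps per item, so a halving
-- costs at most 1508 per item of the upper half, and 1520 per row leaves room for the remaining
-- work of a round.

private variable
  a ℓ₁ ℓ₂ : Level
  k n     : ℕ

-- Linear inequalities over ℕ

module Linear where

  infixl 6 _:+_
  infixl 7 _:*_
  infix 4 _:≤_
  infixr 3 _⊠_⊢_

  data Expr (n : ℕ) : Set where
    var  : Fin n → Expr n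
    con  : ℕ → Expr n
    _:+_ : Expr n → Expr n → Expr n
    _:*_ : Expr n → ℕ → Expr n

  data Ineq (n : ℕ) : Set where
    _:≤_ : Expr n → Expr n → Ineq n

  -- A hypothesis is given together with its Farkas multiplier.
  data Problem (n : ℕ) : Set where
    goal  : Ineq n → Problem n
    _⊠_⊢_ : ℕ → Ineq n → Problem n → Problem n

  ⟦_⟧ : Expr n → Vec ℕ n → ℕ
  ⟦ var i ⟧ ρ = Vec.lookup ρ i
  ⟦ con k ⟧ ρ = k
  ⟦ d :+ e ⟧ ρ = ⟦ d ⟧ ρ + ⟦ e ⟧ ρ
  ⟦ e :* k ⟧ ρ = ⟦ e ⟧ ρ * k

  ⟦_⟧≤ : Ineq n → Vec ℕ n → Set
  ⟦ d :≤ e ⟧≤ ρ = ⟦ d ⟧ ρ ≤ ⟦ e ⟧ ρ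

  ⟦_⟧⊢ : Problem n → Vec ℕ n → Set
  ⟦ goal g ⟧⊢ ρ = ⟦ g ⟧≤ ρ
  ⟦ _ ⊠ h ⊢ p ⟧⊢ ρ = ⟦ h ⟧≤ ρ → ⟦ p ⟧⊢ ρ

  Form : ℕ → Set
  Form n = ℕ × Vec ℕ n

  eval : Form n → Vec ℕ n → ℕ
  eval (k , [])     []      = k
  eval (k , c ∷ cs) (x ∷ ρ) = x * c + eval (k , cs) ρ

  constant : ℕ → Form n
  constant k = k , Vec.replicate _ 0

  atom : Fin n → Form n
  atom zero    = 0 , 1 ∷ Vec.replicate _ 0
  atom (suc i) = 0 , 0 ∷ proj₂ (atom i)

  _⊕_ : Form n → Form n → Form n
  (k , cs) ⊕ (l , ds) = k + l , Vec.zipWith _+_ cs ds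

  _⊛_ : Form n → ℕ → Form n
  (k , cs) ⊛ l = k * l , Vec.map (_* l) cs

  form : Expr n → Form n
  form (var i)  = atom i
  form (con k)  = constant k
  form (d :+ e) = form d ⊕ form e
  form (e :* k) = form e ⊛ k

  _≤?ᶠ_ : Form n → Form n → Bool
  (k , [])     ≤?ᶠ (l , [])     = k ≤ᵇ l
  (k , c ∷ cs) ≤?ᶠ (l , d ∷ ds) = (c ≤ᵇ d) ∧ ((k , cs) ≤?ᶠ (l , ds))

  -- The scaled left and right sides of the hypotheses are collected in `a` and `b`. Comparing
  -- `d + b` with `e + a` avoids subtraction, and comparing coefficient by coefficient suffices
  -- because the variables are natural numbers.
  check : Problem n → Form n → Form n → Bool
  check (goal (d :≤ e))      a b = (form d ⊕ b) ≤?ᶠ (form e ⊕ a)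
  check (k ⊠ (d :≤ e) ⊢ p) a b = check p (a ⊕ (form d ⊛ k)) (b ⊕ (form e ⊛ k))

  open +-*-Solver using (solve; _:=_) renaming (_:+_ to _⊞_; _:*_ to _⊡_)

  eval-constant : ∀ k (ρ : Vec ℕ n) → eval (constant k) ρ ≡ k
  eval-constant k []      = refl
  eval-constant k (x ∷ ρ) = cong₂ _+_ (*-zeroʳ x) (eval-constant k ρ)

  eval-atom : ∀ (i : Fin n) ρ → eval (atom i) ρ ≡ Vec.lookup ρ i
  eval-atom zero    (x ∷ ρ) = trans (cong₂ _+_ (*-identityʳ x) (eval-constant 0 ρ)) (+-identityʳ x)
  eval-atom (suc i) (x ∷ ρ) = cong₂ _+_ (*-zeroʳ x) (trans (cong (λ f →
      eval f ρ) (zero-const i)) (eval-atom i ρ))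
    where
    zero-const : ∀ {n} (i : Fin n) → (0 , proj₂ (atom i)) ≡ atom i
    zero-const zero    = refl
    zero-const (suc i) = refl

  eval-⊕ : ∀ (f g : Form n) ρ → eval (f ⊕ g) ρ ≡ eval f ρ + eval g ρ
  eval-⊕ (k , [])     (l , [])     []      = refl
  eval-⊕ (k , c ∷ cs) (l , d ∷ ds) (x ∷ ρ) = trans
    (cong (x * (c + d) +_) (eval-⊕ (k , cs) (l , ds) ρ))
    (solve 5 (λ x c d p q → x ⊡ (c ⊞ d) ⊞ (p ⊞ q) := x ⊡ c ⊞ p ⊞ (x ⊡ d ⊞ q)) refl
      x c d (eval (k , cs) ρ) (eval (l , ds) ρ))

  eval-⊛ : ∀ (f : Form n) l ρ → eval (f ⊛ l) ρ ≡ eval f ρ * l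
  eval-⊛ (k , [])     l []      = refl
  eval-⊛ (k , c ∷ cs) l (x ∷ ρ) = trans
    (cong (x * (c * l) +_) (eval-⊛ (k , cs) l ρ))
    (solve 4 (λ x c l p → x ⊡ (c ⊡ l) ⊞ p ⊡ l := (x ⊡ c ⊞ p) ⊡ l) refl x c l (eval (k , cs) ρ))

  eval-form : ∀ (e : Expr n) ρ → eval (form e) ρ ≡ ⟦ e ⟧ ρ
  eval-form (var i)  ρ = eval-atom i ρ
  eval-form (con k)  ρ = eval-constant k ρ
  eval-form (d :+ e) ρ = trans (eval-⊕ (form d) (form e) ρ) (cong₂ _+_ (eval-form d ρ) (eval-form e ρ))
  eval-form (e :* k) ρ = trans (eval-⊛ (form e) k ρ) (cong (_* k) (eval-form e ρ))

  eval-mono : ∀ (f g : Form n) ρ → T (f ≤?ᶠ g) → eval f ρ ≤ eval g ρ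
  eval-mono (k , [])     (l , [])     []      p = ≤ᵇ⇒≤ k l p
  eval-mono (k , c ∷ cs) (l , d ∷ ds) (x ∷ ρ) p with Equivalence.to T-∧ p
  ... | q , r = +-mono-≤ (*-monoʳ-≤ x (≤ᵇ⇒≤ c d q)) (eval-mono (k , cs) (l , ds) ρ r)

  sound : ∀ (p : Problem n) a b ρ → T (check p a b) → eval a ρ ≤ eval b ρ → ⟦ p ⟧⊢ ρ
  sound (goal (d :≤ e)) a b ρ c a≤b =
    +-cancelʳ-≤ (eval a ρ) (⟦ d ⟧ ρ) (⟦ e ⟧ ρ) (begin
      ⟦ d ⟧ ρ + eval a ρ        ≤⟨ +-monoʳ-≤ (⟦ d ⟧ ρ) a≤b ⟩
      ⟦ d ⟧ ρ + eval b ρ        ≡⟨ cong (_+ eval b ρ) (eval-form d ρ) ⟨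
      eval (form d) ρ + eval b ρ ≡⟨ eval-⊕ (form d) b ρ ⟨
      eval (form d ⊕ b) ρ       ≤⟨ eval-mono (form d ⊕ b) (form e ⊕ a) ρ c ⟩
      eval (form e ⊕ a) ρ       ≡⟨ eval-⊕ (form e) a ρ ⟩
      eval (form e) ρ + eval a ρ ≡⟨ cong (_+ eval a ρ) (eval-form e ρ) ⟩
      ⟦ e ⟧ ρ + eval a ρ        ∎)
    where open ≤-Reasoning
  sound (k ⊠ (d :≤ e) ⊢ p) a b ρ c a≤b h =
    sound p (a ⊕ (form d ⊛ k)) (b ⊕ (form e ⊛ k)) ρ c (begin
      eval (a ⊕ (form d ⊛ k)) ρ        ≡⟨ scaled a d ⟩
      eval a ρ + ⟦ d ⟧ ρ * k           ≤⟨ +-mono-≤ a≤b (*-monoˡ-≤ k h) ⟩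
      eval b ρ + ⟦ e ⟧ ρ * k           ≡⟨ scaled b e ⟨
      eval (b ⊕ (form e ⊛ k)) ρ        ∎)
    where
    open ≤-Reasoning
    scaled : ∀ f e → eval (f ⊕ (form e ⊛ k)) ρ ≡ eval f ρ + ⟦ e ⟧ ρ * k
    scaled f e = trans (eval-⊕ f (form e ⊛ k) ρ)
      (cong (eval f ρ +_) (trans (eval-⊛ (form e) k ρ) (cong (_* k) (eval-form e ρ))))

  vars : ∀ n → Vec (Expr n) n
  vars n = Vec.map var (Vec.allFin n)

  abstract
    -- The check runs on closed data, so the hidden argument is of the unit type and gets inferred.
    -- Being abstract, the resulting proofs are never unfolded.
    lin : ∀ n (f : N-ary n (Expr n) (Problem n)) {_ : T (check (f $ⁿ vars n) (constant 0) (constant 0))}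
          (ρ : Vec ℕ n) → ⟦ f $ⁿ vars n ⟧⊢ ρ
    lin n f {c} ρ = sound (f $ⁿ vars n) (constant 0) (constant 0) ρ c ≤-refl

open Linear using (lin; con; goal; _:+_; _:*_; _:≤_; _⊠_⊢_)

-- An abstract machine over binary trees

infixr 6 _∙_

data Val : Set where
  nat : ℕ → Val
  _∙_ : Val → Val → Val

-- The index bounds the number of temporary registers used for evaluation.
data Term : ℕ → Set where
  self           : ∀ {k} → Term (suc k)
  lit            : ∀ {k} → ℕ → Term (suc k)
  fst snd        : ∀ {k} → Term (suc k) → Term (suc k)
  _⟨∙⟩_ _⟨+⟩_ _⟨∸⟩_ : ∀ {k} → Term (suc k) → Term k → Term (suc k)

infixr 6 _⟨∙⟩_
infixl 7 _⟨+⟩_ _⟨∸⟩_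

first second : Val → Maybe Val
first  (nat _) = nothing
first  (v ∙ _) = just v
second (nat _) = nothing
second (_ ∙ v) = just v

arith : (ℕ → ℕ → ℕ) → Val → Val → Maybe Val
arith f (nat k) (nat l) = just (nat (f k l))
arith f _       _       = nothing

eval-term : ∀ {k} → Term k → Val → Maybe Val
eval-term self      v = just v
eval-term (lit l)   v = just (nat l)
eval-term (fst t)   v = eval-term t v >>= first
eval-term (snd t)   v = eval-term t v >>= second
eval-term (t ⟨∙⟩ u) v = eval-term t v >>= λ p → eval-term u v >>= λ q → just (p ∙ q)
eval-term (t ⟨+⟩ u) v = eval-term t v >>= λ p → eval-term u v >>= arith _+_ p
eval-term (t ⟨∸⟩ u) v = eval-term t v >>= λ p → eval-term u v >>= arith _∸_ p

Tm : Set
Tm = Term 16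

-- A body is a decision tree all of whose leaves leave the function, so compiled branches never have
-- to rejoin.
data Code : Set where
  goto   : Tm → Tm → Code
  ifpos  : Tm → Code → Code → Code
  ifless : Tm → Tm → Tm → Tm → Code → Code → Code
  report : Tm → Tm → Code
  reject : Code

data Action : Set where
  enter : ℕ → Val → Action
  halt  : Report → Action

to-nat : Val → Maybe ℕ
to-nat (nat k) = just k
to-nat (_ ∙ _) = nothing

-- Pairs are compiled to heap addresses, which are positive. A sign test thus separates the empty
-- list, the number 0, from a nonempty one.
positive : Val → Bool
positive (nat zero)    = false
positive (nat (suc _)) = true
positive (_ ∙ _)       = true

eval-nat : ∀ {k} → Term k → Val → Maybe ℕ
eval-nat t v = eval-term t v >>= to-nat

choose : Maybe Bool → Maybe Action → Maybe Action → Maybe Action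
choose (just true)  p q = p
choose (just false) p q = q
choose nothing      p q = nothing

nth : List Code → ℕ → Maybe Code
nth []       _       = nothing
nth (c ∷ cs) zero    = just c
nth (c ∷ cs) (suc k) = nth cs k

module Act (O : StrictTotalOrder a ℓ₁ ℓ₂) (A : Matrix O n) where

  entry-less : ℕ → ℕ → ℕ → ℕ → Maybe Bool
  entry-less p q p′ q′ = less O A (entry O A p q) (entry O A p′ q′)

  act : Code → Val → Maybe Action
  act (goto l t)    v = eval-nat l v >>= λ k → eval-term t v >>= λ w → just (enter k w)
  act (ifpos t c d) v = choose (eval-term t v >>= λ w → just (positive w)) (act c v) (act d v)
  act (ifless t u t′ u′ c d) v =
    choose (eval-nat t v >>= λ p → eval-nat u v >>= λ q →
            eval-nat t′ v >>= λ p′ → eval-nat u′ v >>= λ q′ → entry-less p q p′ q′)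
           (act c v) (act d v)
  act (report t u) v = eval-nat t v >>= λ p → eval-nat u v >>= λ q → just (halt (just (p , q)))
  act reject       v = just (halt nothing)

  data Runs (cs : List Code) : ℕ → Val → ℕ → Report → Set where
    stop : ∀ {f c v r} → nth cs f ≡ just c → act c v ≡ just (halt r) → Runs cs f v 1 r
    move : ∀ {f c v g w t r} → nth cs f ≡ just c → act c v ≡ just (enter g w) →
           Runs cs g w t r → Runs cs f v (suc t) r

-- Compilation to the random access machine

-- Registers: 1 holds the constant one, 2 the current value, 3 the number of the
-- current function, 4 the first free heap address, 5 the constant zero, 6 is
-- scratch, and 7 + d are temporaries.  A pair occupies two consecutive heap cells.
heap-base : ℕ
heap-base = 32

loop-start : Label
loop-start = 4

cons-code : ℕ → List Instr → List Instr
cons-code d is =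
  add 6 4 5 ∷ store 4 (7 + d) ∷ add 4 4 1 ∷ store 4 (8 + d) ∷ add 4 4 1 ∷ add (7 + d) 6 5 ∷ is

compile-term : ∀ {k} → ℕ → Term k → List Instr → List Instr
compile-term d self      is = add (7 + d) 2 5 ∷ is
compile-term d (lit k)   is = const (7 + d) k ∷ is
compile-term d (fst t)   is = compile-term d t (load (7 + d) (7 + d) ∷ is)
compile-term d (snd t)   is = compile-term d t (add (7 + d) (7 + d) 1 ∷ load (7 + d) (7 + d) ∷ is)
compile-term d (t ⟨∙⟩ u) is = compile-term d t (compile-term (suc d) u (cons-code d is))
compile-term d (t ⟨+⟩ u) is =
  compile-term d t (compile-term (suc d) u (add (7 + d) (7 + d) (8 + d) ∷ is))
compile-term d (t ⟨∸⟩ u) is =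
  compile-term d t (compile-term (suc d) u (sub (7 + d) (7 + d) (8 + d) ∷ is))

after-term : ∀ {k} → Term k → Label → Label
after-term self      l = suc l
after-term (lit _)   l = suc l
after-term (fst t)   l = suc (after-term t l)
after-term (snd t)   l = 2 + after-term t l
after-term (t ⟨∙⟩ u) l = 6 + after-term u (after-term t l)
after-term (t ⟨+⟩ u) l = suc (after-term u (after-term t l))
after-term (t ⟨∸⟩ u) l = suc (after-term u (after-term t l))

term-time : ∀ {k} → Term k → ℕ
term-time self      = 1
term-time (lit _)   = 1
term-time (fst t)   = term-time t + 1
term-time (snd t)   = term-time t + 2
term-time (t ⟨∙⟩ u) = term-time t + (term-time u + 6)
term-time (t ⟨+⟩ u) = term-time t + (term-time u + 1)
term-time (t ⟨∸⟩ u) = term-time t + (term-time u + 1)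

compile : Label → Code → List Instr → List Instr
after   : Code → Label → Label

compile l (goto t u) is =
  compile-term 0 t (compile-term 1 u (add 3 7 5 ∷ add 2 8 5 ∷ jpos 1 loop-start ∷ is))
compile l (ifpos t c d) is =
  let m = suc (after-term t l) in
  compile-term 0 t (jpos 7 (after d m) ∷ compile m d (compile (after d m) c is))
compile l (ifless t u t′ u′ c d) is =
  let m = suc (after-term u′ (after-term t′ (after-term u (after-term t l)))) in
  compile-term 0 t (compile-term 1 u (compile-term 2 t′ (compile-term 3 u′
    (jless 7 8 9 10 (after d m) ∷ compile m d (compile (after d m) c is)))))
compile l (report t u) is = compile-term 0 t (compile-term 1 u (answer 7 8 ∷ is))
compile l reject       is = none ∷ is

after (goto t u)    l = 3 + after-term u (after-term t l)
after (ifpos t c d) l = after c (after d (suc (after-term t l)))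
after (ifless t u t′ u′ c d) l =
  after c (after d (suc (after-term u′ (after-term t′ (after-term u (after-term t l))))))
after (report t u)  l = suc (after-term u (after-term t l))
after reject        l = suc l

-- Jump targets are fixed labels, so the body to be run is found by counting register 3 down to zero
-- along the table.
dispatch : Label → List Code → List Instr
dispatch l []       = []
dispatch l (c ∷ cs) =
  jpos 3 (after c (suc l)) ∷ compile (suc l) c (sub 3 3 1 ∷ dispatch (suc (after c (suc l))) cs)

program : ℕ → List Code → Program
program f cs =
  const 1 1 ∷ const 4 heap-base ∷ add 2 0 5 ∷ const 3 f ∷ dispatch loop-start cs

code-time : Code → ℕ
code-time (goto t u)    = term-time t + (term-time u + 3)
code-time (ifpos t c d) = term-time t + suc (code-time c + code-time d)
code-time (ifless t u t′ u′ c d) =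
  term-time t + (term-time u + (term-time t′ + (term-time u′ + suc (code-time c + code-time d))))
code-time (report t u)  = term-time t + (term-time u + 1)
code-time reject        = 1

-- Every step of the abstract machine scans the dispatch table and runs one entry.
step-time : List Code → ℕ
step-time []       = 0
step-time (c ∷ cs) = 2 + (code-time c + step-time cs)

-- Correctness of the compilation

update-same : ∀ (x : Store) d v → (x [ d ≔ v ]) d ≡ v
update-same x d v rewrite dec-true (d ≟ d) refl = refl

update-other : ∀ (x : Store) {d k} v → k ≢ d → (x [ d ≔ v ]) k ≡ x k
update-other x {d} {k} v k≢d rewrite dec-false (k ≟ d) k≢d = refl

-- Numbers stand for themselves and carry no tag: only the code knows whether a word is a number or
-- an address. A pair lies below the heap pointer, out of reach of later allocations.
data Rep (x : Store) : ℕ → Val → Set where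
  nat  : ∀ {k} → Rep x k (nat k)
  pair : ∀ {p v w} → heap-base ≤ p → suc p < x 4 →
         Rep x (x p) v → Rep x (x (suc p)) w → Rep x p (v ∙ w)

record Ready (x : Store) : Set where
  field
    one-reg  : x 1 ≡ 1
    zero-reg : x 5 ≡ 0
    heap-reg : heap-base ≤ x 4

-- This is what evaluating a term into the temporary `7 + d` leaves intact. Exempt are the heap
-- pointer in register 4, which may only grow, the scratch register 6 and the higher temporaries.
record Preserves (d : ℕ) (x y : Store) : Set where
  field
    grow : x 4 ≤ y 4
    regs : ∀ k → k < 7 + d → k ≢ 4 → k ≢ 6 → y k ≡ x k
    heap : ∀ k → heap-base ≤ k → k < x 4 → y k ≡ x k

open Ready
open Preserves

rep-heap : ∀ {x y p v} → x 4 ≤ y 4 → (∀ k → heap-base ≤ k → k < x 4 → y k ≡ x k) → Rep x p v → Rep y p v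
rep-heap g h nat = nat
rep-heap {y = y} g h (pair {p} {v} {w} b l r s) =
  pair b (<-≤-trans l g)
    (subst (λ q → Rep y q v) (sym (h p b (<-trans (n<1+n p) l))) (rep-heap g h r))
    (subst (λ q → Rep y q w) (sym (h (suc p) (m≤n⇒m≤1+n b) l)) (rep-heap g h s))

rep-preserved : ∀ {d x y p v} → Preserves d x y → Rep x p v → Rep y p v
rep-preserved P = rep-heap (grow P) (heap P)

preserves-trans : ∀ {d e x y z} → d ≤ e → Preserves d x y → Preserves e y z → Preserves d x z
preserves-trans d≤e P Q = record
  { grow = ≤-trans (grow P) (grow Q)
  ; regs = λ k k< p q → trans (regs Q k (<-≤-trans k< (+-monoʳ-≤ 7 d≤e)) p q) (regs P k k< p q)
  ; heap = λ k b l → trans (heap Q k b (<-≤-trans l (grow P))) (heap P k b l)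
  }

ready-preserved : ∀ {d x y} → Preserves d x y → Ready x → Ready y
ready-preserved P R = record
  { one-reg  = trans (regs P 1 (s≤s (s≤s z≤n)) (λ ()) (λ ())) (one-reg R)
  ; zero-reg = trans (regs P 5 (s≤s (s≤s (s≤s (s≤s (s≤s (s≤s z≤n)))))) (λ ()) (λ ())) (zero-reg R)
  ; heap-reg = ≤-trans (heap-reg R) (grow P)
  }

value-preserved : ∀ {d x y v} → Preserves d x y → Rep x (x 2) v → Rep y (y 2) v
value-preserved {x = x} {y} {v} P r =
  subst (λ q → Rep y q v) (sym (regs P 2 (s≤s (s≤s (s≤s z≤n))) (λ ()) (λ ()))) (rep-preserved P r)

drop-suc : ∀ {X : Set} l (P : List X) {i is} → drop l P ≡ i ∷ is → drop (suc l) P ≡ is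
drop-suc zero    (_ ∷ P) refl = refl
drop-suc (suc l) (_ ∷ P) e    = drop-suc l P e

set-temp : ∀ d x v → 7 + d < heap-base → Preserves d x (x [ 7 + d ≔ v ])
set-temp d x v bound = record
  { grow = ≤-reflexive (sym (update-other x {7 + d} v λ ()))
  ; regs = λ k k< _ _ → update-other x {7 + d} v (<⇒≢ k<)
  ; heap = λ k b _ → update-other x {7 + d} v (λ e → <⇒≢ (<-≤-trans bound b) (sym e))
  }

module Cons (y₀ : Store) (d : ℕ) (R : Ready y₀) (bound : 8 + d < heap-base) where

  h : ℕ
  h = y₀ 4

  y₁ y₂ y₃ y₄ y₅ y₆ : Store
  y₁ = y₀ [ 6 ≔ h + y₀ 5 ]
  y₂ = y₁ [ h ≔ y₁ (7 + d) ]
  y₃ = y₂ [ 4 ≔ y₂ 4 + y₂ 1 ]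
  y₄ = y₃ [ y₃ 4 ≔ y₃ (8 + d) ]
  y₅ = y₄ [ 4 ≔ y₄ 4 + y₄ 1 ]
  y₆ = y₅ [ 7 + d ≔ y₅ 6 + y₅ 5 ]

  small : ∀ {k} → k < heap-base → k ≢ h
  small k< refl = <⇒≱ k< (heap-reg R)

  below : ∀ k {_ : T (k <ᵇ heap-base)} → k < heap-base
  below k {p} = <ᵇ⇒< k heap-base p

  y₂-other : ∀ k → k ≢ 6 → k ≢ h → y₂ k ≡ y₀ k
  y₂-other k p q = trans (update-other y₁ _ q) (update-other y₀ _ p)

  y₃-4 : y₃ 4 ≡ suc h
  y₃-4 = trans (cong₂ _+_ (y₂-other 4 (λ ()) (small (below 4)))
                          (trans (y₂-other 1 (λ ()) (small (below 1))) (one-reg R))) (+-comm h 1)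

  small′ : ∀ {k} → k < heap-base → k ≢ y₃ 4
  small′ k< e = <⇒≱ k< (subst (heap-base ≤_) (sym (trans e y₃-4)) (m≤n⇒m≤1+n (heap-reg R)))

  y₄-other : ∀ k → k ≢ 4 → k ≢ 6 → k ≢ h → k ≢ y₃ 4 → y₄ k ≡ y₀ k
  y₄-other k p q r s = trans (update-other y₃ _ s) (trans (update-other y₂ _ p) (y₂-other k q r))

  y₆-other : ∀ k → k ≢ 4 → k ≢ 6 → k ≢ 7 + d → k ≢ h → k ≢ y₃ 4 → y₆ k ≡ y₀ k
  y₆-other k p q t r s = trans (update-other y₅ _ t) (trans (update-other y₄ _ p) (y₄-other k p q r s))

  y₆-4 : y₆ 4 ≡ 2 + h
  y₆-4 = trans (cong₂ _+_ (trans (update-other y₃ _ (small′ (below 4))) y₃-4)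
                 (trans (y₄-other 1 (λ ()) (λ ()) (small (below 1)) (small′ (below 1))) (one-reg R)))
               (+-comm (suc h) 1)

  y₀⇒y₆ : Preserves d y₀ y₆
  y₀⇒y₆ = record
    { grow = subst (h ≤_) (sym y₆-4) (m≤n+m h 2)
    ; regs = λ k k< p q → let k<b = <-trans (<-trans k< (n<1+n (7 + d))) bound in
        y₆-other k p q (<⇒≢ k<) (small k<b) (small′ k<b)
    ; heap = λ k b k<h → y₆-other k (above b (below 4)) (above b (below 6)) (above b (<-trans (n<1+n
        (7 + d)) bound))
        (<⇒≢ k<h) (λ e → <⇒≢ (<-trans k<h (n<1+n h)) (trans e y₃-4))
    }
    where
    above : ∀ {k l} → heap-base ≤ k → l < heap-base → k ≢ l
    above b l< refl = <⇒≱ l< b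

  top : y₆ (7 + d) ≡ h
  top = trans (update-same y₅ (7 + d) _)
    (trans (cong₂ _+_
       (trans (update-other y₃ _ (small′ (below 6))) (trans (update-other y₁ _ (small (below 6))) (cong (h +_)
           (zero-reg R))))
       (trans (y₄-other 5 (λ ()) (λ ()) (small (below 5)) (small′ (below 5))) (zero-reg R)))
     (trans (+-identityʳ (h + 0)) (+-identityʳ h)))

  h<top : suc h < y₆ 4
  h<top = ≤-reflexive (sym y₆-4)

  7+d< : 7 + d < heap-base
  7+d< = <-trans (n<1+n (7 + d)) bound

  left : y₆ h ≡ y₀ (7 + d)
  left = trans (update-other y₅ _ (λ e → small 7+d< (sym e))) (trans (update-other y₄ _ (λ e →
      small (below 4) (sym e)))
    (trans (update-other y₃ _ (λ e → <⇒≢ (n<1+n h) (trans e y₃-4))) (trans (update-other y₂ _ (λ e →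
        small (below 4) (sym e)))
    (trans (update-same y₁ h _) (update-other y₀ {6} {7 + d} (h + y₀ 5) λ ())))))

  right : y₆ (suc h) ≡ y₀ (8 + d)
  right = trans (cong y₆ (sym y₃-4)) (trans (update-other y₅ _ (λ e → small′ 7+d< (sym e)))
    (trans (update-other y₄ _ (λ e → small′ (below 4) (sym e))) (trans (update-same y₃ (y₃ 4) _)
    (trans (update-other y₂ {4} {8 + d} (y₂ 4 + y₂ 1) λ ()) (y₂-other (8 + d) (λ ()) (small bound))))))

-- Simulation of abstract steps by instruction sequences

module Simulation (O : StrictTotalOrder a ℓ₁ ℓ₂) (A : Matrix O n) (P : Program) where
  open Act O A

  infix 4 _⟶[_]_

  -- A stretch of a run is expressed by what it adds in front of any halting run, so that stretches
  -- compose as functions.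
  _⟶[_]_ : Config → ℕ → Config → Set
  c ⟶[ t ] d = ∀ {s r} → HaltsFrom O A P d s r → HaltsFrom O A P c (t + s) r

  record At (l : Label) (is : List Instr) : Set where
    constructor at
    field code : drop l P ≡ is

  skip : ∀ {l i is} → At l (i ∷ is) → At (suc l) is
  skip {l} (at e) = at (drop-suc l P e)

  fetch : ∀ {l x i is} → At l (i ∷ is) → step O A P ⟨ l , x ⟩ ≡ execute O A i ⟨ l , x ⟩
  fetch (at e) rewrite e = refl

  one : ∀ {l x i is c} → At l (i ∷ is) → execute O A i ⟨ l , x ⟩ ≡ running c → ⟨ l , x ⟩ ⟶[ 1 ] c
  one e f h = next (trans (fetch e) f) h

  infixr 5 _▸_

  _▸_ : ∀ {c d e s t} → c ⟶[ s ] d → d ⟶[ t ] e → c ⟶[ s + t ] e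
  _▸_ {c = c} {s = s} {t} f g {u} {r} h =
    subst (λ m → HaltsFrom O A P c m r) (sym (+-assoc s t u)) (f (g h))

  record Computed {k} (t : Term k) (d : ℕ) (l : Label) (x : Store) (is : List Instr) (v : Val) : Set where
    constructor computed
    field
      final    : Store
      steps    : ⟨ l , x ⟩ ⟶[ term-time t ] ⟨ after-term t l , final ⟩
      rest     : At (after-term t l) is
      preserve : Preserves d x final
      result   : Rep final (final (7 + d)) v

  bound-left : ∀ {d k} → d + suc k ≤ 20 → 7 + d < heap-base
  bound-left {d} {k} b = lin 2 (λ d k → 1 ⊠ d :+ (con 1 :+ k) :≤ con 20 ⊢
      goal (con 8 :+ d :≤ con 32)) (d ∷ k ∷ []) b

  bound-next : ∀ {d k} → d + suc k ≤ 20 → 8 + d < heap-base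
  bound-next {d} {k} b = lin 2 (λ d k → 1 ⊠ d :+ (con 1 :+ k) :≤ con 20 ⊢
      goal (con 9 :+ d :≤ con 32)) (d ∷ k ∷ []) b

  bound-right : ∀ {d k} → d + suc k ≤ 20 → suc d + k ≤ 20
  bound-right {d} {k} b = subst (_≤ 20) (+-suc d k) b

  rep-nat : ∀ {x p k} → Rep x p (nat k) → p ≡ k
  rep-nat nat = refl

  rep-temp : ∀ d x v {w} → 7 + d < heap-base → Rep x v w →
             Rep (x [ 7 + d ≔ v ]) ((x [ 7 + d ≔ v ]) (7 + d)) w
  rep-temp d x v b r = subst (λ z → Rep (x [ 7 + d ≔ v ]) z _) (sym (update-same x (7 + d) v))
    (rep-preserved (set-temp d x v b) r)

  compute-term : ∀ {k} (t : Term k) d {is l x v w} → d + k ≤ 20 → At l (compile-term d t is) →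
                 Ready x → Rep x (x 2) v → eval-term t v ≡ just w → Computed t d l x is w

  compute-arith : ∀ {k} (f : ℕ → ℕ → ℕ) (i : Instr) (t : Term (suc k)) (u : Term k) d {is l x v w} →
      d + suc k ≤ 20 →
                  (∀ {l x} → execute O A i ⟨ l , x ⟩ ≡ running ⟨ suc l , x [ 7 + d ≔ f (x (7 + d)) (x
                      (8 + d)) ] ⟩) →
                  At l (compile-term d t (compile-term (suc d) u (i ∷ is))) →
                  Ready x → Rep x (x 2) v →
                  (eval-term t v >>= λ p → eval-term u v >>= arith f p) ≡ just w →
                  ∃[ y ] (⟨ l , x ⟩ ⟶[ term-time t + (term-time u + 1) ] ⟨ suc (after-term u
                      (after-term t l)) , y ⟩ ×
                          At (suc (after-term u (after-term t l))) is × Preserves d x y × Rep y (y (7 + d)) w)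
  compute-arith f i t u d {is} {v = v} b ex e R r q
    with eval-term t v in et
  ... | just p with eval-term u v in eu
  ... | just p′ with compute-term t d {compile-term (suc d) u (i ∷ is)} b e R r et
  ... | T@(computed x₁ s₁ e₁ P₁ r₁) with compute-term u (suc d) {i ∷ is} (bound-right {d} b) e₁
      (ready-preserved P₁ R)
                 (value-preserved P₁ r) eu
  compute-arith f i t u d b ex e R r refl | just (nat k₁) | just
      (nat k₂) | computed x₁ s₁ e₁ P₁ r₁ | computed x₂ s₂ e₂ P₂ r₂ = _
    , (s₁ ▸ s₂ ▸ one e₂ ex)
    , skip e₂
    , preserves-trans ≤-refl (preserves-trans (n≤1+n d) P₁ P₂) (set-temp d x₂ _ (bound-left {d} b))
    , rep-temp d x₂ _ (bound-left {d} b) (subst (λ z → Rep x₂ z (nat (f k₁ k₂)))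
        (sym (cong₂ f (trans (regs P₂ (7 + d) (n<1+n (7 + d)) (λ ()) (λ ())) (rep-nat r₁)) (rep-nat r₂))) nat)

  compute-term self d {x = x} b e R r refl = record
    { steps = one e refl
    ; rest = skip e
    ; preserve = set-temp d x _ (bound-left {d} b)
    ; result = rep-temp d x _ (bound-left {d} b)
        (subst (λ z → Rep x z _) (sym (trans (cong (x 2 +_) (zero-reg R)) (+-identityʳ (x 2)))) r)
    }
  compute-term (lit k) d {x = x} b e R r refl = record
    { steps = one e refl
    ; rest = skip e
    ; preserve = set-temp d x _ (bound-left {d} b)
    ; result = rep-temp d x k (bound-left {d} b) nat
    }
  compute-term (fst t) d {is} {v = v} b e R r q with eval-term t v in et
  ... | just (p₁ ∙ p₂) with compute-term t d {load (7 + d) (7 + d) ∷ is} b e R r et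
  compute-term (fst t) d b e R r refl | just (p₁ ∙ p₂) | computed x₁ s₁ e₁ P₁ (pair _ _ r₁ _) = record
    { steps = s₁ ▸ one e₁ refl
    ; rest = skip e₁
    ; preserve = preserves-trans ≤-refl P₁ (set-temp d x₁ _ (bound-left {d} b))
    ; result = rep-temp d x₁ _ (bound-left {d} b) r₁
    }
  compute-term (snd t) d {is} {v = v} b e R r q with eval-term t v in et
  ... | just (p₁ ∙ p₂) with compute-term t d {add (7 + d) (7 + d) 1 ∷ load (7 + d) (7 + d) ∷ is} b e R r et
  compute-term (snd t) d b e R r refl | just (p₁ ∙ p₂) | computed y s₁ e₁ P₁ (pair base _ _ r₂) = record
    { steps = s₁ ▸ one e₁ refl ▸ one (skip e₁) refl
    ; rest = skip (skip e₁)
    ; preserve = preserves-trans ≤-refl P₁ (preserves-trans ≤-refl y⇒y₁ (set-temp d y₁ (y₁ (y₁ (7 + d))) bl))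
    ; result = rep-temp d y₁ (y₁ (y₁ (7 + d))) bl (subst (λ w →
        Rep y₁ w _) (sym target) (rep-preserved y⇒y₁ r₂))
    }
    where
    bl = bound-left {d} b
    p = y (7 + d)
    y₁ = y [ 7 + d ≔ p + y 1 ]
    y⇒y₁ = set-temp d y (p + y 1) bl
    address : y₁ (7 + d) ≡ suc p
    address = trans (update-same y (7 + d) _)
      (trans (cong (p +_) (one-reg (ready-preserved P₁ R))) (+-comm p 1))
    target : y₁ (y₁ (7 + d)) ≡ y (suc p)
    target = trans (cong y₁ address)
      (update-other y {7 + d} _ (λ eq → <⇒≢ (<-≤-trans bl (m≤n⇒m≤1+n base)) (sym eq)))
  compute-term (t ⟨∙⟩ u) d {is} {v = v} b e R r q with eval-term t v in et
  ... | just p with eval-term u v in eu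
  ... | just p′ with compute-term t d {compile-term (suc d) u (cons-code d is)} b e R r et
  ... | T@(computed x₁ s₁ e₁ P₁ r₁) with compute-term u (suc d) {cons-code d is} (bound-right {d} b) e₁
      (ready-preserved P₁ R)
                 (value-preserved P₁ r) eu
  compute-term (t ⟨∙⟩ u) d b e R r refl | just p | just p′ | computed x₁ s₁ e₁ P₁ r₁ | computed y₀ s₂ f₀ P₂ r₂
      = record
    { final = y₆
    ; steps = s₁ ▸ s₂ ▸ one f₀ refl ▸ one f₁ refl ▸ one f₂ refl ▸ one f₃ refl ▸ one f₄ refl ▸ one f₅ refl
    ; rest = skip f₅
    ; preserve = preserves-trans ≤-refl (preserves-trans (n≤1+n d) P₁ P₂) y₀⇒y₆
    ; result = subst (λ w → Rep y₆ w _) (sym top)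
        (pair (heap-reg R₀) h<top
          (subst (λ w → Rep y₆ w _) (sym left) (rep-preserved y₀⇒y₆ r₁′))
          (subst (λ w → Rep y₆ w _) (sym right) (rep-preserved y₀⇒y₆ r₂)))
    }
    where
    R₀ = ready-preserved P₂ (ready-preserved P₁ R)
    f₁ = skip f₀
    f₂ = skip f₁
    f₃ = skip f₂
    f₄ = skip f₃
    f₅ = skip f₄
    open Cons y₀ d R₀ (bound-next {d} b)
    r₁′ : Rep y₀ (y₀ (7 + d)) p
    r₁′ = subst (λ w → Rep y₀ w p) (sym (regs P₂ (7 + d) (n<1+n (7 + d)) (λ ()) (λ ())))
           (rep-preserved P₂ r₁)
  compute-term (t ⟨+⟩ u) d {is} b e R r q with compute-arith _+_ (add (7 + d) (7 + d)
      (8 + d)) t u d {is} b refl e R r q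
  ... | _ , s , n , p , w = record { steps = s ; rest = n ; preserve = p ; result = w }
  compute-term (t ⟨∸⟩ u) d {is} b e R r q with compute-arith _∸_ (sub (7 + d) (7 + d)
      (8 + d)) t u d {is} b refl e R r q
  ... | _ , s , n , p , w = record { steps = s ; rest = n ; preserve = p ; result = w }

  skip-term : ∀ {k} (t : Term k) d {l is} → At l (compile-term d t is) → At (after-term t l) is
  skip-term self      d e = skip e
  skip-term (lit _)   d e = skip e
  skip-term (fst t)   d e = skip (skip-term t d e)
  skip-term (snd t)   d e = skip (skip (skip-term t d e))
  skip-term (t ⟨∙⟩ u) d e = skip (skip (skip (skip (skip (skip (skip-term u (suc d) (skip-term t d e)))))))
  skip-term (t ⟨+⟩ u) d e = skip (skip-term u (suc d) (skip-term t d e))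
  skip-term (t ⟨∸⟩ u) d e = skip (skip-term u (suc d) (skip-term t d e))

  skip-code : ∀ c {l is} → At l (compile l c is) → At (after c l) is
  skip-code (goto t u)    e = skip (skip (skip (skip-term u 1 (skip-term t 0 e))))
  skip-code (ifpos t c d) e = skip-code c (skip-code d (skip (skip-term t 0 e)))
  skip-code (ifless t u t′ u′ c d) e =
    skip-code c (skip-code d (skip (skip-term u′ 3 (skip-term t′ 2 (skip-term u 1 (skip-term t 0 e))))))
  skip-code (report t u)  e = skip (skip-term u 1 (skip-term t 0 e))
  skip-code reject        e = skip e

  record Entering (f : ℕ) (v : Val) (x : Store) : Set where
    constructor entering
    field
      ready    : Ready x
      function : x 3 ≡ f
      value    : Rep x (x 2) v

  -- The time is a bound and not exact, since the branches of a body differ in length.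
  Performs : Action → Config → ℕ → Set
  Performs (enter f v) c t = ∃[ s ] ∃[ y ] (c ⟶[ s ] ⟨ loop-start , y ⟩ × s ≤ t × Entering f v y)
  Performs (halt r)    c t = ∃[ s ] (HaltsFrom O A P c s r × s ≤ t)

  prepend : ∀ α {c d s t} → c ⟶[ s ] d → Performs α d t → Performs α c (s + t)
  prepend (enter f v) {s = s} g (u , y , h , b , E) = s + u , y , (λ {m} {r} → (g ▸ h) {m} {r}) , +-monoʳ-≤ s b , E
  prepend (halt r)    {s = s} g (u , h , b) = s + u , g h , +-monoʳ-≤ s b

  weaken : ∀ α {c s t} → s ≤ t → Performs α c s → Performs α c t
  weaken (enter f v) b (u , y , h , b′ , E) = u , y , (λ {m} {r} → h {m} {r}) , ≤-trans b′ b , E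
  weaken (halt r)    b (u , h , b′) = u , h , ≤-trans b′ b

  eval-nat⇒ : ∀ {k} (t : Term k) v {m} → eval-nat t v ≡ just m → eval-term t v ≡ just (nat m)
  eval-nat⇒ t v e with eval-term t v
  eval-nat⇒ t v refl | just (nat k) = refl

  positive-sound : ∀ {x p} v → Rep x p v → does (0 <? p) ≡ positive v
  positive-sound (nat zero)    nat = refl
  positive-sound (nat (suc k)) nat = refl
  positive-sound (v ∙ w) (pair {p} b _ _ _) = dec-true (0 <? p) (≤-trans (s≤s z≤n) b)

  perform : ∀ c {l is x v α} → At l (compile l c is) → Ready x → Rep x (x 2) v → act c v ≡ just α →
            Performs α ⟨ l , x ⟩ (code-time c)
  perform-choice : ∀ c d b {l is x v α} → At l (compile l d (compile (after d l) c is)) → Ready x →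
      Rep x (x 2) v →
                   choose (just b) (act c v) (act d v) ≡ just α →
                   Performs α ⟨ (if b then after d l else l) , x ⟩ (code-time c + code-time d)
  perform-choice c d true  {α = α} e R r q = weaken α (m≤m+n _ _) (perform c (skip-code d e) R r q)
  perform-choice c d false {α = α} e R r q = weaken α (m≤n+m _ (code-time c)) (perform d e R r q)

  perform (goto t u) {v = v} e R r q with eval-nat t v in et
  ... | just k with eval-term u v in eu
  perform (goto t u) {l} {v = v} e R r refl | just k | just w
    with compute-term t 0 (≤ᵇ⇒≤ 16 20 _) e R r (eval-nat⇒ t v et)
  ... | computed x₁ s₁ e₁ P₁ r₁ with compute-term u 1 (≤ᵇ⇒≤ 17 20 _) e₁ (ready-preserved P₁ R)
      (value-preserved P₁ r) eu
  ... | computed x₂ s₂ e₂ P₂ r₂ =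
    prepend (enter k w) s₁ (prepend (enter k w) s₂ (3 , x₄ ,
      (λ {m} {r} → (one e₂ refl ▸ one (skip e₂) refl ▸ one (skip (skip e₂)) jump) {m} {r}) , ≤-refl , record
        { ready = record
          { one-reg = one-reg R₂ ; zero-reg = zero-reg R₂ ; heap-reg = heap-reg R₂ }
        ; function = trans (cong₂ _+_ (trans (regs P₂ 7 (n<1+n 7) (λ ()) (λ ())) (rep-nat r₁)) (zero-reg R₂))
            (+-identityʳ k)
        ; value = rep-heap ≤-refl 2⇒4 (subst (λ z →
            Rep x₂ z w) (sym (trans (cong (x₂ 8 +_) (zero-reg R₂)) (+-identityʳ (x₂ 8)))) r₂)
        }))
    where
    R₂ = ready-preserved P₂ (ready-preserved P₁ R)
    x₃ = x₂ [ 3 ≔ x₂ 7 + x₂ 5 ]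
    x₄ = x₃ [ 2 ≔ x₃ 8 + x₃ 5 ]
    jump : execute O A (jpos 1 loop-start) ⟨ 2 + after-term u
        (after-term t l) , x₄ ⟩ ≡ running ⟨ loop-start , x₄ ⟩
    jump rewrite one-reg R₂ = refl
    2⇒4 : ∀ k → heap-base ≤ k → k < x₂ 4 → x₄ k ≡ x₂ k
    2⇒4 k b _ = trans (update-other x₃ {2} _ (λ { refl → <⇒≱ (≤ᵇ⇒≤ 3 32 _) b }))
                      (update-other x₂ {3} _ (λ { refl → <⇒≱ (≤ᵇ⇒≤ 4 32 _) b }))
  perform (ifpos t c d) {l} {v = v} {α} e R r q with eval-term t v in et
  ... | just w with compute-term t 0 (≤ᵇ⇒≤ 16 20 _) e R r et
  ... | computed x₁ s₁ e₁ P₁ r₁ =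
    prepend α s₁ (prepend α (one e₁ (cong (λ b →
        running ⟨ (if b then after d m else m) , x₁ ⟩) (positive-sound w r₁)))
      (perform-choice c d (positive w) (skip e₁) (ready-preserved P₁ R) (value-preserved P₁ r) q))
    where
    m = suc (after-term t l)
  perform (ifless t u t′ u′ c d) {l} {v = v} {α} e R r q
    with eval-nat t v in et
  ... | just p with eval-nat u v in eu
  ... | just p₂ with eval-nat t′ v in et′
  ... | just p₃ with eval-nat u′ v in eu′
  ... | just p₄ with entry-less p p₂ p₃ p₄ in el
  ... | just b
    with compute-term t 0 (≤ᵇ⇒≤ 16 20 _) e R r (eval-nat⇒ t v et)
  ... | computed x₁ s₁ e₁ P₁ r₁
    with compute-term u 1 (≤ᵇ⇒≤ 17 20 _) e₁ (ready-preserved P₁ R) (value-preserved P₁ r) (eval-nat⇒ u v eu)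
  ... | computed x₂ s₂ e₂ P₂ r₂
    with compute-term t′ 2 (≤ᵇ⇒≤ 18 20 _) e₂ (ready-preserved P₂ (ready-preserved P₁ R))
           (value-preserved P₂ (value-preserved P₁ r)) (eval-nat⇒ t′ v et′)
  ... | computed x₃ s₃ e₃ P₃ r₃
    with compute-term u′ 3 (≤ᵇ⇒≤ 19 20 _) e₃ (ready-preserved P₃ (ready-preserved P₂ (ready-preserved P₁ R)))
           (value-preserved P₃ (value-preserved P₂ (value-preserved P₁ r))) (eval-nat⇒ u′ v eu′)
  ... | computed x₄ s₄ e₄ P₄ r₄ =
    prepend α s₁ (prepend α s₂ (prepend α s₃ (prepend α s₄
      (prepend α (one e₄ verdict)
        (perform-choice c d b (skip e₄) (ready-preserved P₄ (ready-preserved P₃ (ready-preserved P₂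
            (ready-preserved P₁ R))))
          (value-preserved P₄ (value-preserved P₃ (value-preserved P₂ (value-preserved P₁ r)))) q)))))
    where
    m = suc (after-term u′ (after-term t′ (after-term u (after-term t l))))
    verdict : ∀ {l} → execute O A (jless 7 8 9 10 (after d m)) ⟨ l , x₄ ⟩ ≡
                      running ⟨ (if b then after d m else suc l) , x₄ ⟩
    verdict rewrite
        trans (regs P₄ 7 (≤ᵇ⇒≤ 8 10 _) (λ ()) (λ ())) (trans (regs P₃ 7 (≤ᵇ⇒≤ 8 9 _) (λ ()) (λ ()))
          (trans (regs P₂ 7 (≤ᵇ⇒≤ 8 8 _) (λ ()) (λ ())) (rep-nat r₁)))
      | trans (regs P₄ 8 (≤ᵇ⇒≤ 9 10 _) (λ ()) (λ ())) (trans (regs P₃ 8 (≤ᵇ⇒≤ 9 9 _) (λ ()) (λ ()))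
          (rep-nat r₂))
      | trans (regs P₄ 9 (≤ᵇ⇒≤ 10 10 _) (λ ()) (λ ())) (rep-nat r₃)
      | rep-nat r₄
      | el = refl
  perform (report t u) {v = v} e R r q with eval-nat t v in et
  ... | just k with eval-nat u v in eu
  perform (report t u) {v = v} e R r refl | just k | just m
    with compute-term t 0 (≤ᵇ⇒≤ 16 20 _) e R r (eval-nat⇒ t v et)
  ... | computed x₁ s₁ e₁ P₁ r₁ with compute-term u 1 (≤ᵇ⇒≤ 17 20 _) e₁ (ready-preserved P₁ R)
      (value-preserved P₁ r) (eval-nat⇒ u v eu)
  ... | computed x₂ s₂ e₂ P₂ r₂ = prepend (halt (just (k , m))) s₁ (prepend (halt (just (k , m))) s₂
    (1 , halt (trans (fetch e₂) (cong₂ (λ p q → halted (just (p , q)))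
      (trans (regs P₂ 7 (n<1+n 7) (λ ()) (λ ())) (rep-nat r₁)) (rep-nat r₂))) , ≤-refl))
  perform reject e R r refl = 1 , halt (fetch e) , ≤-refl

  scan : ∀ cs f {l c v x α} → At l (dispatch l cs) → nth cs f ≡ just c → Entering f v x → act c v ≡ just α →
         Performs α ⟨ l , x ⟩ (step-time cs)
  scan (c ∷ cs) zero {x = x} {α = α} e refl (entering R f r) q =
    weaken α (lin 2 (λ c t → goal (con 1 :+ c :≤ con 2 :+ (c :+ t))) (code-time c ∷ step-time cs ∷ []))
      (prepend α (one e stay) (perform c (skip e) R r q))
    where
    stay : ∀ {m l} → execute O A (jpos 3 m) ⟨ l , x ⟩ ≡ running ⟨ suc l , x ⟩
    stay rewrite f = refl
  scan (c ∷ cs) (suc g) {l} {x = x} {α = α} e n (entering R f r) q =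
    weaken α (lin 2 (λ c t → goal (con 2 :+ t :≤ con 2 :+ (c :+ t))) (code-time c ∷ step-time cs ∷ []))
      (prepend α (one e leave) (prepend α (one e′ refl)
        (scan cs g (skip e′) n (entering R′ g-reg (rep-heap ≤-refl far r)) q)))
    where
    e′ = skip-code c (skip e)
    x′ = x [ 3 ≔ x 3 ∸ x 1 ]
    leave : execute O A (jpos 3 (after c (suc l))) ⟨ l , x ⟩ ≡ running ⟨ after c (suc l) , x ⟩
    leave rewrite f = refl
    g-reg : x 3 ∸ x 1 ≡ g
    g-reg = cong₂ _∸_ f (one-reg R)
    R′ : Ready x′
    R′ = record { one-reg = one-reg R ; zero-reg = zero-reg R ; heap-reg = heap-reg R }
    far : ∀ k → heap-base ≤ k → k < x 4 → x′ k ≡ x k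
    far k b _ = update-other x {3} _ (λ { refl → <⇒≱ (≤ᵇ⇒≤ 4 32 _) b })

  simulate : ∀ {cs f v t r x} → At loop-start (dispatch loop-start cs) → Entering f v x → Runs cs f v t r →
             ∃[ s ] (HaltsFrom O A P ⟨ loop-start , x ⟩ s r × s ≤ t * step-time cs)
  simulate {cs} e E (stop n q) with scan cs _ e n E q
  ... | s , h , b = s , h , ≤-trans b (≤-reflexive (sym (+-identityʳ _)))
  simulate {cs} e E (move n q R) with scan cs _ e n E q
  ... | s , y , g , b , E′ with simulate e E′ R
  ... | s′ , h , b′ = s + s′ , g h , +-mono-≤ b b′

halts : ∀ (O : StrictTotalOrder a ℓ₁ ℓ₂) (A : Matrix O n) cs f {t r} → Act.Runs O A cs f (nat n) t r →
        ∃[ s ] (Halts O A (program f cs) s r × s ≤ 4 + t * step-time cs)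
halts {n = n} O A cs f R = extend (Simulation.simulate O A (program f cs) (Simulation.at refl) start R)
  where
  x₀ : Store
  x₀ = initial n [ 1 ≔ 1 ] [ 4 ≔ heap-base ] [ 2 ≔ n + 0 ] [ 3 ≔ f ]
  start : Simulation.Entering O A (program f cs) f (nat n) x₀
  start = Simulation.entering (record { one-reg = refl ; zero-reg = refl ; heap-reg = ≤-refl }) refl
    (subst (λ z → Rep x₀ z (nat n)) (sym (+-identityʳ n)) nat)
  extend : ∀ {b r} → ∃[ s ] (HaltsFrom O A (program f cs) ⟨ loop-start , x₀ ⟩ s r × s ≤ b) →
           ∃[ s ] (Halts O A (program f cs) s r × s ≤ 4 + b)
  extend (s , h , b) = 4 + s , next refl (next refl (next refl (next refl h))) , +-monoʳ-≤ 4 b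

-- The program

-- Every function exists in two versions: `true` works on the matrix, `false` on
-- the transposed matrix with the reversed order.
pattern rev-append = Fin.zero
pattern return-arg = Fin.suc rev-append
pattern partition = Fin.suc return-arg
pattern insert = Fin.suc partition
pattern sort = Fin.suc insert
pattern group = Fin.suc sort
pattern group′ = Fin.suc group
pattern count = Fin.suc group′
pattern half = Fin.suc count
pattern halve = Fin.suc half
pattern select = Fin.suc halve
pattern select₁ = Fin.suc select
pattern select₂ = Fin.suc select₁
pattern select₃ = Fin.suc select₂
pattern select₄ = Fin.suc select₃
pattern select₅ = Fin.suc select₄
pattern select₆ = Fin.suc select₅
pattern select₇ = Fin.suc select₆
pattern splice = Fin.suc select₇
pattern swap = Fin.suc splice
pattern cut = Fin.suc swap
pattern take = Fin.suc cut
pattern lower = Fin.suc take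
pattern upper = Fin.suc lower
pattern drain = Fin.suc upper
pattern single = Fin.suc drain
pattern sweep = Fin.suc single
pattern failed = Fin.suc sweep
pattern refine = Fin.suc failed
pattern refine₁ = Fin.suc refine
pattern refine₂ = Fin.suc refine₁
pattern refine₃ = Fin.suc refine₂
pattern refine₄ = Fin.suc refine₃
pattern refine₅ = Fin.suc refine₄
pattern thin = Fin.suc refine₅
pattern thin₁ = Fin.suc thin
pattern thin₂ = Fin.suc thin₁
pattern thin₃ = Fin.suc thin₂
pattern rows = Fin.suc thin₃
pattern cols = Fin.suc rows
pattern test = Fin.suc cols
pattern test₁ = Fin.suc test
pattern stair = Fin.suc test₁
pattern zip = Fin.suc stair
pattern outer = Fin.suc zip
pattern outer₁ = Fin.suc outer
pattern outer₂ = Fin.suc outer₁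
pattern outer₃ = Fin.suc outer₂
pattern outer₄ = Fin.suc outer₃
pattern outer₅ = Fin.suc outer₄
pattern argmin = Fin.suc outer₅
pattern verify-row = Fin.suc argmin
pattern verify-col = Fin.suc verify-row
pattern range = Fin.suc verify-col
pattern finish = Fin.suc range
pattern start = Fin.suc finish

size : ℕ
size = 56

Name : Set
Name = Fin size

label : Bool → Name → ℕ
label true  f = toℕ f
label false f = size + toℕ f

-- The value of the abstract machine is an argument paired with a call stack, whose
-- frames consist of a return label and a saved value.  A function resumed by a
-- return receives the saved value paired with the result.
ret : Term 15 → Code
ret t = goto (fst (fst (snd self))) ((snd (fst (snd self)) ⟨∙⟩ t) ⟨∙⟩ snd (snd self))

tail : Bool → Name → Tm → Code
tail o f t = goto (lit (label o f)) (t ⟨∙⟩ snd self)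

call : Bool → Name → Tm → Name → Term 14 → Code
call o f t g s = goto (lit (label o f)) (t ⟨∙⟩ (lit (label o g) ⟨∙⟩ s) ⟨∙⟩ snd self)

-- For `false` both the coordinates and the operands are exchanged: transposition swaps rows with
-- columns, and reversing the order turns column minima back into row maxima. Neither requires a
-- copy of the matrix.
compare : Bool → Tm → Tm → Code → Code → Code
compare true  t u c d = ifless (fst t) (snd t) (fst u) (snd u) c d
compare false t u c d = ifless (snd u) (fst u) (snd t) (fst t) c d

arg : Term (suc k)
arg = fst self

tl hd : ℕ → Term (suc k) → Term (suc k)
tl zero    t = t
tl (suc i) t = snd (tl i t)
hd i t = fst (tl i t)

-- Component i of the argument, and the tuple of its components from i on; σ and τ
-- do the same for the saved value.
π ρ σ τ : ℕ → Term (suc k)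
π i = hd i arg
ρ i = tl i arg
σ i = hd i (fst arg)
τ i = tl i (fst arg)

nil : Term (suc k)
nil = lit 0

member : ℕ → Term (suc k)
member i = hd i (snd (hd 0 (π 1)))

-- Code for lists, sorting and selection

body : Bool → Name → Code

body o rev-append =
  ifpos (π 0)
    (tail o rev-append (tl 1 (π 0) ⟨∙⟩ hd 0 (π 0) ⟨∙⟩ ρ 1))
    (ret (ρ 1))

-- A resumed function receives its saved value paired with the result. Returning this pair conses a
-- saved head onto a list, or puts the tag 0 in front of a result.
body o return-arg = ret arg

body o partition =
  ifpos (π 1)
    (compare o (hd 0 (hd 0 (π 1))) (π 0)
      (tail o partition (π 0 ⟨∙⟩ tl 1 (π 1) ⟨∙⟩ (hd 0 (π 1) ⟨∙⟩ π 2) ⟨∙⟩ ρ 3))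
      (tail o partition (π 0 ⟨∙⟩ tl 1 (π 1) ⟨∙⟩ π 2 ⟨∙⟩ hd 0 (π 1) ⟨∙⟩ ρ 3)))
    (ret (ρ 2))

body o insert =
  ifpos (ρ 1)
    (compare o (hd 0 (hd 0 (ρ 1))) (hd 0 (π 0))
      (call o insert (π 0 ⟨∙⟩ tl 1 (ρ 1)) return-arg (hd 0 (ρ 1)))
      (ret arg))
    (ret arg)

body o sort =
  ifpos (π 0)
    (call o insert (hd 0 (π 0) ⟨∙⟩ ρ 1) sort (tl 1 (π 0)))
    (ret (ρ 1))

body o group =
  ifpos (tl 0 (π 0)) (ifpos (tl 1 (π 0)) (ifpos (tl 2 (π 0)) (ifpos (tl 3 (π 0)) (ifpos (tl 4 (π 0))
    (call o sort ((hd 0 (π 0) ⟨∙⟩ hd 1 (π 0) ⟨∙⟩ hd 2 (π 0) ⟨∙⟩ hd 3 (π 0) ⟨∙⟩ hd 4 (π 0) ⟨∙⟩ nil) ⟨∙⟩ nil)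
      group′ (tl 5 (π 0) ⟨∙⟩ ρ 1))
    (ret arg)) (ret arg)) (ret arg)) (ret arg)) (ret arg)
-- The key of a group is its median, its payload the sorted group.
body o group′ = tail o group (σ 0 ⟨∙⟩ (hd 0 (hd 2 (ρ 1)) ⟨∙⟩ ρ 1) ⟨∙⟩ τ 1)

body o count =
  ifpos (π 0)
    (tail o count (tl 1 (π 0) ⟨∙⟩ ρ 1 ⟨+⟩ lit 1))
    (ret (ρ 1))

-- The machine has no division; one unit for every two elements gives half the length, rounded up.
body o half =
  ifpos (π 0)
    (ifpos (tl 1 (π 0))
      (tail o half (tl 2 (π 0) ⟨∙⟩ ρ 1 ⟨+⟩ lit 1))
      (ret (ρ 1 ⟨+⟩ lit 1)))
    (ret (ρ 1))

-- The saved list paired with the returned number is the argument format of `select`, which thus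
-- serves as the return point itself.
body o halve = call o half (arg ⟨∙⟩ nil) select arg

body o select = call o count (π 0 ⟨∙⟩ nil) select₁ arg
body o select₁ =
  ifpos (lit 20 ⟨∸⟩ ρ 1)
    (call o sort (σ 0 ⟨∙⟩ nil) cut (τ 1))
    (call o group (σ 0 ⟨∙⟩ nil) select₂ (τ 1))
body o select₂ = call o halve (tl 1 (ρ 1)) select₃ (fst arg ⟨∙⟩ hd 0 (ρ 1))
body o select₃ =
  call o lower (tl 2 (ρ 1) ⟨∙⟩ hd 0 (ρ 1) ⟨∙⟩ hd 1 (ρ 1) ⟨∙⟩ τ 1 ⟨∙⟩ nil ⟨∙⟩ nil)
    select₄ (σ 0 ⟨∙⟩ tl 2 (ρ 1))
body o select₄ = call o count (hd 0 (ρ 1) ⟨∙⟩ nil) select₅ (σ 0 ⟨∙⟩ τ 1 ⟨∙⟩ ρ 1)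
body o select₅ =
  ifpos (ρ 1 ⟨∸⟩ σ 0)
    (call o select (σ 2 ⟨∙⟩ σ 0) select₆ (τ 3))
    (ifpos (σ 0 ⟨∸⟩ ρ 1)
      (call o select (τ 3 ⟨∙⟩ σ 0 ⟨∸⟩ ρ 1) select₇ (σ 2))
      (ret (σ 2 ⟨∙⟩ τ 3 ⟨∙⟩ σ 1)))
body o select₆ = call o rev-append (hd 1 (ρ 1) ⟨∙⟩ fst arg) splice (hd 0 (ρ 1) ⟨∙⟩ tl 2 (ρ 1))
body o select₇ = call o rev-append (fst arg ⟨∙⟩ hd 0 (ρ 1)) swap (tl 1 (ρ 1))
body o splice = ret (σ 0 ⟨∙⟩ ρ 1 ⟨∙⟩ τ 1)
body o swap = ret (ρ 1 ⟨∙⟩ fst arg)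

body o cut = tail o take (π 0 ⟨∙⟩ ρ 1 ⟨∙⟩ nil)
body o take =
  ifpos (π 0)
    (tail o take (π 0 ⟨∸⟩ lit 1 ⟨∙⟩ tl 1 (π 1) ⟨∙⟩ hd 0 (π 1) ⟨∙⟩ ρ 2))
    (ret (ρ 2 ⟨∙⟩ π 1 ⟨∙⟩ hd 0 (hd 0 (π 1))))

body o lower =
  ifpos (π 1)
    (tail o lower (π 0 ⟨∙⟩ tl 1 (π 1) ⟨∙⟩ π 2 ⟨∙⟩ (member 3 ⟨∙⟩ member 4 ⟨∙⟩ π 3) ⟨∙⟩
      (member 0 ⟨∙⟩ member 1 ⟨∙⟩ member 2 ⟨∙⟩ π 4) ⟨∙⟩ ρ 5))
    (tail o upper (π 0 ⟨∙⟩ ρ 2))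
body o upper =
  ifpos (π 1)
    (tail o upper (π 0 ⟨∙⟩ tl 1 (π 1) ⟨∙⟩ (member 0 ⟨∙⟩ member 1 ⟨∙⟩ π 2) ⟨∙⟩ π 3 ⟨∙⟩
      member 2 ⟨∙⟩ member 3 ⟨∙⟩ member 4 ⟨∙⟩ ρ 4))
    (tail o partition (π 0 ⟨∙⟩ ρ 2))

-- Code for draining

body o drain =
  ifpos (tl 1 (ρ 2))
    -- The column list is passed twice: its first copy is a unary counter of the rows that may still
    -- be set aside without lowering a column.
    (tail o sweep (π 0 ⟨∙⟩ ρ 2 ⟨∙⟩ π 1 ⟨∙⟩ ρ 2 ⟨∙⟩ nil ⟨∙⟩ nil))
    (tail o single (π 0 ⟨∙⟩ π 1 ⟨∙⟩ hd 0 (ρ 2)))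

body o single =
  ifpos (π 1)
    (compare o (hd 0 (π 1) ⟨∙⟩ snd (fst (ρ 2))) (π 0)
      (ret (lit 1 ⟨∙⟩ (((hd 0 (π 1) ⟨∙⟩ snd (fst (ρ 2))) ⟨∙⟩ nil) ⟨∙⟩ nil) ⟨∙⟩ tl 1 (π 1)))
      (compare o (hd 0 (π 1) ⟨∙⟩ snd (fst (ρ 2))) (fst (ρ 2))
        (tail o single (π 0 ⟨∙⟩ tl 1 (π 1) ⟨∙⟩ (hd 0 (π 1) ⟨∙⟩ snd (fst (ρ 2))) ⟨∙⟩ nil))
        (tail o single (π 0 ⟨∙⟩ tl 1 (π 1) ⟨∙⟩ ρ 2))))
    (ret (nil ⟨∙⟩ nil ⟨∙⟩ ρ 2 ⟨∙⟩ nil))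

body o sweep =
  ifpos (π 3)
    (ifpos (π 1)
      (ifpos (π 2)
        (compare o (hd 0 (π 2) ⟨∙⟩ snd (fst (hd 0 (π 3)))) (π 0)
          (tail o sweep (π 0 ⟨∙⟩ π 1 ⟨∙⟩ tl 1 (π 2) ⟨∙⟩ tl 1 (π 3) ⟨∙⟩
            (((hd 0 (π 2) ⟨∙⟩ snd (fst (hd 0 (π 3)))) ⟨∙⟩ nil) ⟨∙⟩ π 4) ⟨∙⟩
            fst (fst (hd 0 (π 3))) ⟨∙⟩ ρ 5))
          (tail o sweep (π 0 ⟨∙⟩ tl 1 (π 1) ⟨∙⟩ tl 1 (π 2) ⟨∙⟩ π 3 ⟨∙⟩ π 4 ⟨∙⟩ hd 0 (π 2) ⟨∙⟩ ρ 5)))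
        (call o rev-append (π 3 ⟨∙⟩ π 4) failed (ρ 5)))
      (tail o refine (π 0 ⟨∙⟩ ρ 2)))
    (ret (lit 1 ⟨∙⟩ π 4 ⟨∙⟩ π 2))
body o failed = ret (nil ⟨∙⟩ arg)

body o refine =
  ifpos (π 2)
    (ifpos (tl 1 (π 2))
      (call o halve (π 2) refine₁ (π 0 ⟨∙⟩ π 1 ⟨∙⟩ ρ 3))
      -- Halving a single column would leave the upper half empty, so it is drained directly at `m`,
      -- with an empty lower half in the frame.
      (call o drain (π 0 ⟨∙⟩ π 1 ⟨∙⟩ π 2) refine₂ (π 0 ⟨∙⟩ nil ⟨∙⟩ ρ 3)))
    (ret (lit 1 ⟨∙⟩ π 3 ⟨∙⟩ π 1))
body o refine₁ =
  call o drain (tl 2 (ρ 1) ⟨∙⟩ σ 1 ⟨∙⟩ hd 1 (ρ 1)) refine₂ (σ 0 ⟨∙⟩ hd 0 (ρ 1) ⟨∙⟩ τ 2)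
body o refine₂ =
  ifpos (hd 0 (ρ 1))
    (call o partition (σ 0 ⟨∙⟩ hd 1 (ρ 1) ⟨∙⟩ σ 2 ⟨∙⟩ σ 1) refine₃ (σ 0 ⟨∙⟩ tl 2 (ρ 1) ⟨∙⟩ τ 3))
    (call o rev-append (τ 3 ⟨∙⟩ hd 1 (ρ 1)) refine₄ (tl 2 (ρ 1) ⟨∙⟩ σ 1 ⟨∙⟩ σ 2))
body o refine₃ = tail o refine (σ 0 ⟨∙⟩ σ 1 ⟨∙⟩ tl 1 (ρ 1) ⟨∙⟩ hd 0 (ρ 1) ⟨∙⟩ τ 2)
body o refine₄ = call o rev-append (σ 0 ⟨∙⟩ σ 1) refine₅ (ρ 1 ⟨∙⟩ τ 2)
body o refine₅ = call o rev-append (τ 1 ⟨∙⟩ ρ 1) failed (σ 0)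

-- Code for thinning and for the staircase test

body o thin = call o halve (ρ 1) thin₁ (π 0)
body o thin₁ = call o drain (tl 2 (ρ 1) ⟨∙⟩ fst arg ⟨∙⟩ hd 1 (ρ 1)) thin₂ (hd 0 (ρ 1))
body o thin₂ =
  ifpos (hd 0 (ρ 1))
    (call o rev-append (hd 1 (ρ 1) ⟨∙⟩ fst arg) thin (tl 2 (ρ 1)))
    (call o rev-append (tl 2 (ρ 1) ⟨∙⟩ fst arg) thin₃ (hd 1 (ρ 1)))
body o thin₃ = tail o rows (ρ 1 ⟨∙⟩ π 0)

body o rows =
  ifpos (π 0)
    (tail o rows (tl 1 (π 0) ⟨∙⟩ fst (fst (hd 0 (π 0))) ⟨∙⟩ ρ 1))
    (ret (ρ 1))
body o cols =
  ifpos (π 0)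
    (tail o cols (tl 1 (π 0) ⟨∙⟩ snd (fst (hd 0 (π 0))) ⟨∙⟩ ρ 1))
    (ret (ρ 1))

body o test = call o halve (ρ 1) test₁ (π 0)
body o test₁ = call o rows (hd 0 (ρ 1) ⟨∙⟩ fst arg) stair (tl 2 (ρ 1) ⟨∙⟩ hd 1 (ρ 1))
body o stair =
  ifpos (τ 1)
    (ifpos (ρ 1)
      (compare o (hd 0 (ρ 1) ⟨∙⟩ snd (fst (hd 0 (τ 1)))) (σ 0)
        (tail o stair ((σ 0 ⟨∙⟩ tl 1 (τ 1)) ⟨∙⟩ ρ 1))
        (tail o stair (fst arg ⟨∙⟩ tl 1 (ρ 1))))
      (call o cols (τ 1 ⟨∙⟩ nil) return-arg nil))
    (ret (lit 1 ⟨∙⟩ ρ 1))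

-- Code for the outer recursion and for verification

body o zip =
  ifpos (π 0)
    (tail o zip (tl 1 (π 0) ⟨∙⟩ tl 1 (π 1) ⟨∙⟩ ((hd 0 (π 1) ⟨∙⟩ hd 0 (π 0)) ⟨∙⟩ nil) ⟨∙⟩ ρ 2))
    (ret (ρ 1))

body o outer = call o count (π 1 ⟨∙⟩ nil) outer₁ arg
body o outer₁ = call o count (τ 2 ⟨∙⟩ nil) outer₂ (ρ 1 ⟨∙⟩ fst arg)
body o outer₂ =
  ifpos (ρ 1 ⟨∸⟩ σ 0)
    (tail (not o) outer (σ 1 ⟨∙⟩ τ 3 ⟨∙⟩ σ 2))
    (ifpos (ρ 1 ⟨∸⟩ lit 1)
      (call o zip (τ 3 ⟨∙⟩ σ 2 ⟨∙⟩ nil) outer₃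
        -- This flag is positive exactly if there are more than four times as many rows as columns.
        ((σ 0 ⟨∸⟩ (ρ 1 ⟨+⟩ (ρ 1 ⟨+⟩ (ρ 1 ⟨+⟩ ρ 1)))) ⟨∙⟩ τ 1))
      (tail o argmin (σ 1 ⟨∙⟩ (hd 0 (σ 2) ⟨∙⟩ hd 0 (τ 3)) ⟨∙⟩ tl 1 (σ 2))))
body o outer₃ =
  ifpos (σ 0)
    (call o thin (ρ 1) outer₄ (σ 1 ⟨∙⟩ τ 3))
    (call o test (ρ 1) outer₅ (τ 1))
body o outer₄ = tail o outer (σ 0 ⟨∙⟩ ρ 1 ⟨∙⟩ τ 1)
body o outer₅ =
  ifpos (hd 0 (ρ 1))
    (tail o outer (σ 0 ⟨∙⟩ tl 1 (ρ 1) ⟨∙⟩ τ 2))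
    (tail o outer (σ 0 ⟨∙⟩ σ 1 ⟨∙⟩ tl 1 (ρ 1)))

body o argmin =
  ifpos (ρ 2)
    (compare o (hd 0 (ρ 2) ⟨∙⟩ snd (π 1)) (π 1)
      (tail o argmin (π 0 ⟨∙⟩ (hd 0 (ρ 2) ⟨∙⟩ snd (π 1)) ⟨∙⟩ tl 1 (ρ 2)))
      (tail o argmin (π 0 ⟨∙⟩ π 1 ⟨∙⟩ tl 1 (ρ 2))))
    (tail o verify-row (π 0 ⟨∙⟩ π 0 ⟨∙⟩ π 1))

body o verify-row =
  ifpos (π 0)
    -- The sum of the two truncated differences vanishes exactly if the indices agree.
    (ifpos ((hd 0 (π 0) ⟨∸⟩ snd (ρ 2)) ⟨+⟩ (snd (ρ 2) ⟨∸⟩ hd 0 (π 0)))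
      (compare o (fst (ρ 2) ⟨∙⟩ hd 0 (π 0)) (ρ 2)
        (tail o verify-row (tl 1 (π 0) ⟨∙⟩ ρ 1))
        (ret (nil ⟨∙⟩ nil)))
      (tail o verify-row (tl 1 (π 0) ⟨∙⟩ ρ 1)))
    (tail o verify-col (ρ 1))
body o verify-col =
  ifpos (π 0)
    (ifpos ((hd 0 (π 0) ⟨∸⟩ fst (ρ 1)) ⟨+⟩ (fst (ρ 1) ⟨∸⟩ hd 0 (π 0)))
      (compare o (ρ 1) (hd 0 (π 0) ⟨∙⟩ snd (ρ 1))
        (tail o verify-col (tl 1 (π 0) ⟨∙⟩ ρ 1))
        (ret (nil ⟨∙⟩ nil)))
      (tail o verify-col (tl 1 (π 0) ⟨∙⟩ ρ 1)))
    (ret (lit 1 ⟨∙⟩ (if o then ρ 1 else snd (ρ 1) ⟨∙⟩ fst (ρ 1))))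

body o range =
  ifpos (π 0)
    (tail o range (π 0 ⟨∸⟩ lit 1 ⟨∙⟩ π 0 ⟨∸⟩ lit 1 ⟨∙⟩ ρ 1))
    (tail o outer (ρ 1 ⟨∙⟩ ρ 1 ⟨∙⟩ ρ 1))
body o finish = ifpos (hd 0 (ρ 1)) (report (hd 1 (ρ 1)) (tl 2 (ρ 1))) reject
body o start =
  goto (lit (label o range)) ((self ⟨∙⟩ nil) ⟨∙⟩ (lit (label o finish) ⟨∙⟩ nil) ⟨∙⟩ nil)

table : List Code
table = tabulate (body true) ++ tabulate (body false)

nth-tabulate : ∀ {m} (f : Fin m → Code) cs i → nth (tabulate f ++ cs) (toℕ i) ≡ just (f i)
nth-tabulate f cs Fin.zero    = refl
nth-tabulate f cs (Fin.suc i) = nth-tabulate (λ j → f (Fin.suc j)) cs i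

nth-++ : ∀ {m} (f : Fin m → Code) cs i → nth (tabulate f ++ cs) (m + i) ≡ nth cs i
nth-++ {zero}  f cs i = refl
nth-++ {suc m} f cs i = nth-++ (λ j → f (Fin.suc j)) cs i

nth-table : ∀ o f → nth table (label o f) ≡ just (body o f)
nth-table true  f = nth-tabulate (body true) (tabulate (body false)) f
nth-table false f = trans (nth-++ (body true) (tabulate (body false)) (toℕ f))
  (trans (cong (λ cs → nth cs (toℕ f)) (sym (++-identityʳ (tabulate (body false))))) (nth-tabulate
      (body false) [] f))

-- Evaluation of calls

module Evaluation (O : StrictTotalOrder a ℓ₁ ℓ₂) (A : Matrix O n) where
  open Act O A
  private module O = StrictTotalOrder O

  Key : Set
  Key = Fin n × Fin n

  lt : Bool → Key → Key → Bool
  lt true  (i , j) (i′ , j′) = does (A i j O.<? A i′ j′)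
  lt false (i , j) (i′ , j′) = does (A j′ i′ O.<? A j i)

  index : Fin n → Val
  index i = nat (toℕ i)

  key : Key → Val
  key (i , j) = index i ∙ index j

  entry-toℕ : ∀ i j → entry O A (toℕ i) (toℕ j) ≡ just (A i j)
  entry-toℕ i j
    with toℕ i <? n | dec-yes (toℕ i <? n) (toℕ<n i) | toℕ j <? n | dec-yes (toℕ j <? n) (toℕ<n j)
  ... | _ | p , refl | _ | q , refl = cong₂ (λ i j → just (A i j)) (fromℕ<-toℕ i p) (fromℕ<-toℕ j q)

  compare-act : ∀ o t u c d v {x y} → eval-term t v ≡ just (key x) → eval-term u v ≡ just (key y) →
                act (compare o t u c d) v ≡ choose (just (lt o x y)) (act c v) (act d v)
  compare-act true t u c d v {i , j} {i′ , j′} p q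
    rewrite p | q | entry-toℕ i j | entry-toℕ i′ j′ = refl
  compare-act false t u c d v {i , j} {i′ , j′} p q
    rewrite p | q | entry-toℕ j i | entry-toℕ j′ i′ = refl

  -- t counts function calls: each takes a bounded number of machine instructions.
  record Eval (o : Bool) (f : Name) (v : Val) (t : ℕ) (w : Val) : Set where
    constructor evaluates
    field
      run : ∀ {g s κ u r} → Runs table g ((s ∙ w) ∙ κ) u r →
            Runs table (label o f) (v ∙ (nat g ∙ s) ∙ κ) (t + u) r

  returns : ∀ {o f v w} →
            (∀ g s κ → act (body o f) (v ∙ (nat g ∙ s) ∙ κ) ≡ just (enter g ((s ∙ w) ∙ κ))) →
            Eval o f v 1 w
  returns {o} {f} e = evaluates (move (nth-table o f) (e _ _ _))

  tails : ∀ {o f v p g v′ t w} →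
          (∀ κ → act (body o f) (v ∙ κ) ≡ just (enter (label p g) (v′ ∙ κ))) →
          Eval p g v′ t w → Eval o f v (suc t) w
  tails {o} {f} e (evaluates run) = evaluates (λ R → move (nth-table o f) (e _) (run R))

  calls : ∀ {o f v g v′ h s t t′ w w′} →
          (∀ κ → act (body o f) (v ∙ κ) ≡ just (enter (label o g) (v′ ∙ (nat (label o h) ∙ s) ∙ κ))) →
          Eval o g v′ t w → Eval o h (s ∙ w) t′ w′ → Eval o f v (suc (t + t′)) w′
  calls {o} {f} {v} {g} {v′} {h} {s} {t} {t′} e (evaluates run) (evaluates run′) =
    evaluates λ {g′} {s′} {κ} {u} {r} R →
      move (nth-table o f) (e _)
        (subst (λ m → Runs table (label o g) (v′ ∙ (nat (label o h) ∙ s) ∙ (nat g′ ∙ s′) ∙ κ) m r)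
          (sym (+-assoc t t′ u)) (run (run′ R)))

  list : ∀ {X : Set} → (X → Val) → List X → Val
  list f []       = nat 0
  list f (x ∷ xs) = f x ∙ list f xs

  eval-rev-append : ∀ o {X : Set} (f : X → Val) xs ys →
                    Eval o rev-append (list f xs ∙ list f ys) (suc (length xs)) (list f (xs ʳ++ ys))
  eval-rev-append o f []       ys = returns (λ _ _ _ → refl)
  eval-rev-append o f (x ∷ xs) ys = tails (λ _ → refl) (eval-rev-append o f xs (x ∷ ys))

  eval-count : ∀ o {X : Set} (f : X → Val) xs m →
      Eval o count (list f xs ∙ nat m) (suc (length xs)) (nat (m + length xs))
  eval-count o f []       m rewrite +-identityʳ m = returns (λ _ _ _ → refl)
  eval-count o f (x ∷ xs) m = tails (λ _ → refl)
    (subst (λ l → Eval o count (list f xs ∙ nat (m + 1)) (suc (length xs)) (nat l)) (+-assoc m 1 (length xs))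
        (eval-count o f xs (m + 1)))

-- The algorithm in one orientation

⌈n/2⌉≤1+⌊n/2⌋ : ∀ n → ⌈ n /2⌉ ≤ 1 + ⌊ n /2⌋
⌈n/2⌉≤1+⌊n/2⌋ zero          = z≤n
⌈n/2⌉≤1+⌊n/2⌋ (suc zero)    = s≤s z≤n
⌈n/2⌉≤1+⌊n/2⌋ (suc (suc n)) = s≤s (⌈n/2⌉≤1+⌊n/2⌋ n)

n≤1+pred[n] : ∀ n → n ≤ suc (pred n)
n≤1+pred[n] zero    = z≤n
n≤1+pred[n] (suc n) = ≤-refl

does-yes : ∀ {p} {P : Set p} (P? : Dec P) → does P? ≡ true → P
does-yes (yes p) _ = p

module Oriented (O : StrictTotalOrder a ℓ₁ ℓ₂) (A : Matrix O n) (o : Bool) where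
  open Act O A
  open Evaluation O A
  private module O = StrictTotalOrder O

  infix 4 _≺_ _≼_

  record _≺_ (x y : Key) : Set where
    constructor ≺-intro
    field is-less : lt o x y ≡ true

  record _≼_ (x y : Key) : Set where
    constructor ≼-intro
    field not-less : lt o y x ≡ false

  open _≺_
  open _≼_

  private
    irrefl : ∀ u → does (u O.<? u) ≡ false
    irrefl u = dec-false (u O.<? u) (O.irrefl O.Eq.refl)

    asym : ∀ u v → does (u O.<? v) ≡ true → does (v O.<? u) ≡ false
    asym u v p = dec-false (v O.<? u) (O.asym (does-yes (u O.<? v) p))

    ≮-trans : ∀ u v w → does (v O.<? u) ≡ false → does (w O.<? v) ≡ false → does (w O.<? u) ≡ false
    ≮-trans u v w p q with v O.<? u | w O.<? v | w O.<? u
    ... | no _ | no _ | no _ = refl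
    ... | no v≮u | no w≮v | yes w<u with O.compare u v
    ... | tri< u<v _ _ = ⊥-elim (w≮v (O.trans w<u u<v))
    ... | tri≈ _ u≈v _ = ⊥-elim (w≮v (O.<-respʳ-≈ u≈v w<u))
    ... | tri> _ _ v<u = ⊥-elim (v≮u v<u)

    lt-irrefl : ∀ p x → lt p x x ≡ false
    lt-irrefl true  _ = irrefl _
    lt-irrefl false _ = irrefl _

    lt-asym : ∀ p x y → lt p x y ≡ true → lt p y x ≡ false
    lt-asym true  _ _ = asym _ _
    lt-asym false _ _ = asym _ _

    lt-≮-trans : ∀ p x y z → lt p y x ≡ false → lt p z y ≡ false → lt p z x ≡ false
    lt-≮-trans true  _ _ _ q r = ≮-trans _ _ _ q r
    lt-≮-trans false _ _ _ q r = ≮-trans _ _ _ r q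

  ≼-refl : ∀ {x} → x ≼ x
  ≼-refl {x} = ≼-intro (lt-irrefl o x)

  ≺⇒≼ : ∀ {x y} → x ≺ y → x ≼ y
  ≺⇒≼ {x} {y} (≺-intro p) = ≼-intro (lt-asym o x y p)

  ≼-trans : ∀ {x y z} → x ≼ y → y ≼ z → x ≼ z
  ≼-trans {x} {y} {z} (≼-intro p) (≼-intro q) = ≼-intro (lt-≮-trans o x y z p q)

  ≺⋠ : ∀ {x y} → x ≺ y → ¬ (y ≼ x)
  ≺⋠ (≺-intro p) (≼-intro q) = case trans (sym p) q of λ ()

  ≺-or-≽ : ∀ x y → x ≺ y ⊎ y ≼ x
  ≺-or-≽ x y with lt o x y in e
  ... | true  = inj₁ (≺-intro e)
  ... | false = inj₂ (≼-intro e)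

  when-≺ : ∀ {t u c d v x y α} → x ≺ y → eval-term t v ≡ just (key x) → eval-term u v ≡ just (key y) →
           act c v ≡ α → act (compare o t u c d) v ≡ α
  when-≺ {t} {u} {c} {d} {v} (≺-intro b) p q e =
    trans (compare-act o t u c d v p q) (trans (cong (λ b → choose (just b) (act c v) (act d v)) b) e)

  when-≽ : ∀ {t u c d v x y α} → y ≼ x → eval-term t v ≡ just (key x) → eval-term u v ≡ just (key y) →
           act d v ≡ α → act (compare o t u c d) v ≡ α
  when-≽ {t} {u} {c} {d} {v} (≼-intro b) p q e =
    trans (compare-act o t u c d v p q) (trans (cong (λ b → choose (just b) (act c v) (act d v)) b) e)

  -- Partitioning and sorting of keyed lists

  module Items {X : Set} (k : X → Key) (payload : X → Val) where

    item : X → Val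
    item x = key (k x) ∙ payload x

    items : List X → Val
    items = list item

    -- The predicates are left open because selection keeps weak bounds on both sides, while
    -- draining needs the strict one below. The length bounds preserve what was placed on either
    -- side beforehand.
    eval-partition : ∀ {P Q : X → Set} m → (∀ {x} → k x ≺ m → P x) → (∀ {x} → m ≼ k x → Q x) →
      ∀ xs {ys zs} → All P ys → All Q zs →
      ∃₂ λ ys′ zs′ → Eval o partition (key m ∙ items xs ∙ items ys ∙ items zs) (suc (length xs))
          (items ys′ ∙ items zs′) ×
        All P ys′ × All Q zs′ × ys′ ++ zs′ ↭ xs ++ (ys ++ zs) × length ys ≤ length ys′ × length zs ≤ length zs′
    eval-partition m f g [] {ys} {zs} p q =
      ys , zs , returns (λ _ _ _ → refl) , p , q , ↭-refl , ≤-refl , ≤-refl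
    eval-partition m f g (x ∷ xs) {ys} {zs} p q with ≺-or-≽ (k x) m
    ... | inj₁ x≺m with eval-partition m f g xs (f x≺m ∷ p) q
    ... | ys′ , zs′ , E , p′ , q′ , s , b , c =
      ys′ , zs′ , tails (λ κ → when-≺ x≺m refl refl refl) E , p′ , q′
      , ↭-trans s (shift x xs (ys ++ zs)) , ≤-trans (n≤1+n _) b , c
    eval-partition m f g (x ∷ xs) {ys} {zs} p q | inj₂ m≼x with eval-partition m f g xs p (g m≼x ∷ q)
    ... | ys′ , zs′ , E , p′ , q′ , s , b , c =
      ys′ , zs′ , tails (λ κ → when-≽ m≼x refl refl refl) E , p′ , q′
      , ↭-trans s (↭-trans (++⁺ˡ xs (shift x ys zs)) (shift x xs (ys ++ zs))) , b , ≤-trans (n≤1+n _) c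

    Sorted : List X → Set
    Sorted = AllPairs (λ x y → k x ≼ k y)

    eval-insert : ∀ x xs → Sorted xs →
      ∃₂ λ xs′ t → Eval o insert (item x ∙ items xs) t
          (items xs′) × Sorted xs′ × xs′ ↭ x ∷ xs × t ≤ 1 + length xs * 2
    eval-insert x [] _ = [ x ] , 1 , returns (λ _ _ _ → refl) , [] ∷ [] , ↭-refl , ≤-refl
    eval-insert x (y ∷ xs) (y≼xs ∷ s) with ≺-or-≽ (k y) (k x)
    ... | inj₂ x≼y = x ∷ y ∷ xs , 1 , returns (λ _ _ _ → when-≽ x≼y refl refl refl)
      , (x≼y ∷ All.map (≼-trans x≼y) y≼xs) ∷ y≼xs ∷ s , ↭-refl , s≤s z≤n
    ... | inj₁ y≺x with eval-insert x xs s
    ... | xs′ , t , E , s′ , p , b =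
      y ∷ xs′ , suc (t + 1)
      , calls {w′ = item y ∙ items xs′} (λ κ → when-≺ y≺x refl refl refl) E (returns (λ _ _ _ → refl))
      , All-resp-↭ (↭-sym p) (≺⇒≼ y≺x ∷ y≼xs) ∷ s′
      , ↭-trans (↭-prep y p) (↭-swap y x ↭-refl)
      , lin 2 (λ t l → 1 ⊠ t :≤ con 1 :+ l :* 2 ⊢
          goal (con 1 :+ (t :+ con 1) :≤ con 1 :+ (con 1 :+ l) :* 2)) (t ∷ length xs ∷ []) b

    -- Abstract, since normalising the sort of an explicit list is expensive.
    abstract
      eval-sort : ∀ b xs {ys} → Sorted ys → length xs + length ys ≤ b →
        ∃₂ λ zs t → Eval o sort (items xs ∙ items ys) t (items zs) × Sorted zs × zs ↭ xs ++ ys ×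
          t ≤ 1 + length xs * (2 + b * 2)
      eval-sort b [] {ys} s l = ys , 1 , returns (λ _ _ _ → refl) , s , ↭-refl , ≤-refl
      eval-sort b (x ∷ xs) {ys} s l with eval-insert x ys s
      ... | ys′ , t , E , s′ , p , c
        with eval-sort b xs s′ (subst (_≤ b) (trans (sym (+-suc (length xs) (length ys))) (cong (length xs +_)
            (sym (↭-length p)))) l)
      ... | zs , t′ , E′ , s″ , p′ , c′ = zs , suc (t + t′) , calls (λ _ → refl) E E′ , s″
        , ↭-trans p′ (↭-trans (++⁺ˡ xs p) (shift x xs ys))
        , lin 5 (λ t y b t′ m → 1 ⊠ t :≤ con 1 :+ y :* 2 ⊢ 2 ⊠ y :≤ b ⊢ 1 ⊠ t′ :≤ con 1 :+ m ⊢
            goal (con 1 :+ (t :+ t′) :≤ con 1 :+ (con 2 :+ b :* 2 :+ m)))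
            (t ∷ length ys ∷ b ∷ t′ ∷ length xs * (2 + b * 2) ∷ [])
            c (m+n≤o⇒n≤o (suc (length xs)) l) c′

    eval-half : ∀ xs m → ∃[ t ] (Eval o half (items xs ∙ nat m) t (nat
        (m + ⌈ length xs /2⌉)) × t ≤ 1 + length xs)
    eval-half [] m rewrite +-identityʳ m = 1 , returns (λ _ _ _ → refl) , s≤s z≤n
    eval-half (x ∷ []) m = 1 , returns (λ _ _ _ → refl) , s≤s z≤n
    eval-half (x ∷ y ∷ xs) m with eval-half xs (m + 1)
    ... | t , E , b = suc t , tails (λ _ → refl)
      (subst (λ l → Eval o half (items xs ∙ nat (m + 1)) t (nat l)) (+-assoc m 1 _) E) , s≤s (≤-trans b
          (n≤1+n _))

    eval-take : ∀ l xs ys {x zs} → length xs ≡ l →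
      Eval o take (nat l ∙ items (xs ++ x ∷ zs) ∙ items ys) (suc l) (items (xs ʳ++ ys) ∙ items (x ∷ zs) ∙ key
          (k x))
    eval-take zero    []       ys refl = returns (λ _ _ _ → refl)
    eval-take (suc l) (y ∷ xs) ys refl = tails (λ _ → refl) (eval-take l xs (y ∷ ys) refl)

  -- Selection by medians of groups of five

  module _ {X : Set} where
    open CommutativeMonoidSolver (++-commutativeMonoid {A = X}) public using (solve; _⊜_; _⊕_)

  permute-group : ∀ {X : Set} (u v w : List X) → u ++ (v ++ w) ↭ v ++ (u ++ w)
  permute-group = solve 3 (λ u v w → u ⊕ (v ⊕ w) ⊜ v ⊕ (u ⊕ w)) ↭-refl

  permute-upper : ∀ {X : Set} (f a x y e z : List X) →
    f ++ ((a ++ x) ++ (y ++ (e ++ z))) ↭ ((a ++ e) ++ f) ++ (x ++ (y ++ z))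
  permute-upper = solve 6 (λ f a x y e z → f ⊕ ((a ⊕ x) ⊕ (y ⊕ (e ⊕ z))) ⊜ ((a ⊕ e) ⊕ f) ⊕ (x ⊕ (y ⊕ z))) ↭-refl

  permute-lower : ∀ {X : Set} (f g a x e y z : List X) →
    f ++ (g ++ ((a ++ x) ++ ((e ++ y) ++ z))) ↭ ((e ++ a) ++ f) ++ (g ++ (x ++ (y ++ z)))
  permute-lower = solve 7 (λ f g a x e y z →
    f ⊕ (g ⊕ ((a ⊕ x) ⊕ ((e ⊕ y) ⊕ z))) ⊜ ((e ⊕ a) ⊕ f) ⊕ (g ⊕ (x ⊕ (y ⊕ z)))) ↭-refl

  gather : ∀ {X : Set} (u v w : List X) → u ++ (v ++ (w ++ [])) ↭ (u ++ v) ++ w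
  gather u v w = ↭-reflexive (trans (cong (λ w → u ++ (v ++ w)) (++-identityʳ w)) (sym (++-assoc u v w)))

  ʳ++-↭ : ∀ {X : Set} (xs ys : List X) → xs ʳ++ ys ↭ xs ++ ys
  ʳ++-↭ []       ys = ↭-refl
  ʳ++-↭ (x ∷ xs) ys = ↭-trans (ʳ++-↭ xs (x ∷ ys)) (shift x xs ys)

  module Groups {X : Set} (k : X → Key) (payload : X → Val) where
    open Items k payload

    -- Of the sorting only the position of the median among the five is remembered: it alone puts
    -- three members on a known side of the pivot.
    record Group : Set where
      field
        x₁ x₂ x₃ x₄ x₅ : X
        x₁≼x₃ : k x₁ ≼ k x₃
        x₂≼x₃ : k x₂ ≼ k x₃
        x₃≼x₄ : k x₃ ≼ k x₄
        x₃≼x₅ : k x₃ ≼ k x₅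

      members : List X
      members = x₁ ∷ x₂ ∷ x₃ ∷ x₄ ∷ x₅ ∷ []

    open Group

    group-key : Group → Key
    group-key g = k (x₃ g)

    group-payload : Group → Val
    group-payload g = items (members g)

    open Items group-key group-payload using () renaming (items to groups)

    flatten : List Group → List X
    flatten []       = []
    flatten (g ∷ gs) = members g ++ flatten gs

    flatten-++ : ∀ fs gs → flatten (fs ++ gs) ≡ flatten fs ++ flatten gs
    flatten-++ []       gs = refl
    flatten-++ (f ∷ fs) gs = cong (members f ++_) (flatten-++ fs gs)

    flatten-↭ : ∀ {fs gs} → fs ↭ gs → flatten fs ↭ flatten gs
    flatten-↭ Permutation.refl         = ↭-refl
    flatten-↭ (Permutation.prep f p)   = ++⁺ˡ (members f) (flatten-↭ p)
    flatten-↭ (Permutation.swap f g p) =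
      ↭-trans (permute-group (members f) (members g) _) (++⁺ˡ (members g) (++⁺ˡ (members f) (flatten-↭ p)))
    flatten-↭ (Permutation.trans p q)  = ↭-trans (flatten-↭ p) (flatten-↭ q)

    to-group : ∀ xs → Sorted xs → length xs ≡ 5 → ∃[ g ] members g ≡ xs
    to-group (x₁ ∷ x₂ ∷ x₃ ∷ x₄ ∷ x₅ ∷ []) ((_ ∷ p₁ ∷ _) ∷ (p₂ ∷ _) ∷ (p₄ ∷ p₅ ∷ []) ∷ _) refl =
      record { x₁≼x₃ = p₁ ; x₂≼x₃ = p₂ ; x₃≼x₄ = p₄ ; x₃≼x₅ = p₅ } , refl

    -- The 64 steps per group cover at most 61 for sorting five items and the two calls around it.
    eval-group : ∀ xs gs → ∃₂ λ xs′ gs′ → ∃[ t ]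
      (Eval o group (items xs ∙ groups gs) t (items xs′ ∙ groups gs′) ×
       flatten gs′ ++ xs′ ↭ xs ++ flatten gs × length xs′ ≤ 4 ×
       length gs′ * 5 + length xs′ ≡ length gs * 5 + length xs × t + length gs * 64 ≤ 1 + length gs′ * 64)
    eval-group [] gs = [] , gs , 1 , returns (λ _ _ _ → refl)
      , ++-comm (flatten gs) _ , z≤n , refl , ≤-refl
    eval-group xs@(_ ∷ []) gs = xs , gs , 1 , returns (λ _ _ _ → refl)
      , ++-comm (flatten gs) _ , s≤s z≤n , refl , ≤-refl
    eval-group xs@(_ ∷ _ ∷ []) gs = xs , gs , 1 , returns (λ _ _ _ → refl)
      , ++-comm (flatten gs) _ , s≤s (s≤s z≤n) , refl , ≤-refl
    eval-group xs@(_ ∷ _ ∷ _ ∷ []) gs = xs , gs , 1 , returns (λ _ _ _ → refl)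
      , ++-comm (flatten gs) _ , s≤s (s≤s (s≤s z≤n)) , refl , ≤-refl
    eval-group xs@(_ ∷ _ ∷ _ ∷ _ ∷ []) gs = xs , gs , 1 , returns (λ _ _ _ → refl)
      , ++-comm (flatten gs) _ , s≤s (s≤s (s≤s (s≤s z≤n))) , refl , ≤-refl
    eval-group (y₁ ∷ y₂ ∷ y₃ ∷ y₄ ∷ y₅ ∷ xs) gs
      with eval-sort 5 (y₁ ∷ y₂ ∷ y₃ ∷ y₄ ∷ y₅ ∷ []) [] ≤-refl
    ... | zs , t , E , s , p , b with to-group zs s (↭-length p)
    ... | g , refl with eval-group xs (g ∷ gs)
    ... | xs′ , gs′ , t′ , E′ , p′ , r , e , b′ =
      xs′ , gs′ , suc (t + suc t′) , calls (λ _ → refl) E (tails (λ _ → refl) E′)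
      , ↭-trans p′ (↭-trans (++⁺ˡ xs (++⁺ʳ (flatten gs) p))
          (permute-group xs (y₁ ∷ y₂ ∷ y₃ ∷ y₄ ∷ y₅ ∷ []) (flatten gs)))
      , r
      , trans e (trans (+-comm (5 + length gs * 5) (length xs)) (trans (+-comm (length xs) (5 + length gs * 5))
          (trans (cong (_+ length xs) (+-comm 5 (length gs * 5))) (+-assoc (length gs * 5) 5 (length xs)))))
      , lin 4 (λ t t′ u v → 1 ⊠ t :≤ con 61 ⊢ 1 ⊠ t′ :+ (con 1 :+ u) :* 64 :≤ con 1 :+ v :* 64 ⊢
          goal (con 1 :+ (t :+ (con 1 :+ t′)) :+ u :* 64 :≤ con 1 :+ v :* 64))
          (t ∷ t′ ∷ length gs ∷ length gs′ ∷ []) b b′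

    Sifted : Name → Key → Val → List X → ℕ → ℕ → ℕ → Set
    Sifted f m v xs p q b = ∃₂ λ ys zs → ∃[ t ]
      (Eval o f (key m ∙ v) t (items ys ∙ items zs) × All (λ x → k x ≼ m) ys × All (λ x → m ≼ k x) zs ×
       ys ++ zs ↭ xs × p ≤ length ys × q ≤ length zs × t ≤ b)

    -- Members settled by the median of their group are placed without a comparison, even if they
    -- equal the pivot. Each group therefore contributes three members to its side; comparing all
    -- members with the pivot would not ensure this when keys coincide.
    eval-upper : ∀ m gs xs {ys zs} → All (λ g → m ≼ group-key g) gs → All (λ x → k x ≼ m) ys → All (λ x →
        m ≼ k x) zs →
      Sifted upper m (groups gs ∙ items xs ∙ items ys ∙ items zs) (flatten gs ++ (xs ++ (ys ++ zs)))
        (length ys) (length gs * 3 + length zs) (2 + length gs * 3 + length xs)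
    eval-upper m [] xs {ys} {zs} [] p q with eval-partition m ≺⇒≼ (λ r → r) xs p q
    ... | ys′ , zs′ , E , p′ , q′ , s , b , c =
      ys′ , zs′ , _ , tails (λ _ → refl) E , p′ , q′ , s , b , c , ≤-refl
    eval-upper m (g ∷ gs) xs {ys} {zs} (m≼g ∷ u) p q
      with eval-upper m gs (x₁ g ∷ x₂ g ∷ xs) u p (m≼g ∷ ≼-trans m≼g (x₃≼x₄ g) ∷ ≼-trans m≼g (x₃≼x₅ g) ∷ q)
    ... | ys′ , zs′ , t , E , p′ , q′ , s , b , c , d = ys′ , zs′ , suc t , tails (λ _ → refl) E , p′ , q′
      , ↭-trans s (permute-upper
          (flatten gs) (x₁ g ∷ x₂ g ∷ []) xs ys (x₃ g ∷ x₄ g ∷ x₅ g ∷ []) zs)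
      , b
      , lin 3 (λ g z l → 1 ⊠ g :* 3 :+ (con 3 :+ z) :≤ l ⊢
          goal ((con 1 :+ g) :* 3 :+ z :≤ l)) (length gs ∷ length zs ∷ length zs′ ∷ []) c
      , lin 3 (λ t g x → 1 ⊠ t :≤ con 2 :+ g :* 3 :+ (con 2 :+ x) ⊢
          goal (con 1 :+ t :≤ con 2 :+ (con 1 :+ g) :* 3 :+ x))
          (t ∷ length gs ∷ length xs ∷ []) d

    eval-lower : ∀ m fs gs xs {ys zs} → All (λ g → group-key g ≼ m) fs → All (λ g → m ≼ group-key g) gs →
      All (λ x → k x ≼ m) ys → All (λ x → m ≼ k x) zs →
      Sifted lower m (groups fs ∙ groups gs ∙ items xs ∙ items ys ∙ items zs)
        (flatten fs ++ (flatten gs ++ (xs ++ (ys ++ zs))))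
        (length fs * 3 + length ys) (length gs * 3 + length zs) (3 + length fs * 3 + length gs * 3 + length xs)
    eval-lower m [] gs xs [] u p q with eval-upper m gs xs u p q
    ... | ys′ , zs′ , t , E , p′ , q′ , s , b , c , d =
      ys′ , zs′ , suc t , tails (λ _ → refl) E , p′ , q′ , s , b , c , s≤s d
    eval-lower m (f ∷ fs) gs xs {ys} {zs} (f≼m ∷ v) u p q
      with eval-lower m fs gs (x₄ f ∷ x₅ f ∷ xs) v u
             (≼-trans (x₁≼x₃ f) f≼m ∷ ≼-trans (x₂≼x₃ f) f≼m ∷ f≼m ∷ p) q
    ... | ys′ , zs′ , t , E , p′ , q′ , s , b , c , d = ys′ , zs′ , suc t , tails (λ _ → refl) E , p′ , q′
      , ↭-trans s (permute-lower
          (flatten fs) (flatten gs) (x₄ f ∷ x₅ f ∷ []) xs (x₁ f ∷ x₂ f ∷ x₃ f ∷ []) ys zs)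
      , lin 3 (λ g z l → 1 ⊠ g :* 3 :+ (con 3 :+ z) :≤ l ⊢
          goal ((con 1 :+ g) :* 3 :+ z :≤ l)) (length fs ∷ length ys ∷ length ys′ ∷ []) b
      , c
      , lin 4 (λ t f g x → 1 ⊠ t :≤ con 3 :+ f :* 3 :+ g :* 3 :+ (con 2 :+ x) ⊢
          goal (con 1 :+ t :≤ con 3 :+ (con 1 :+ f) :* 3 :+ g :* 3 :+ x))
          (t ∷ length fs ∷ length gs ∷ length xs ∷ []) d

  module _ {X : Set} (k : X → Key) (payload : X → Val) where
    open Items k payload

    record Split (f : Name) (v : Val) (xs : List X) (l b : ℕ) : Set where
      constructor mk-split
      field
        {lo hi}  : List X
        {pivot}  : Key
        {time}   : ℕ
        run      : Eval o f v time (items lo ∙ items hi ∙ key pivot)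
        perm     : lo ++ hi ↭ xs
        size-lo  : length lo ≡ l
        below    : All (λ x → k x ≼ pivot) lo
        above    : All (λ x → pivot ≼ k x) hi
        cost     : time ≤ b

    sorted-split : ∀ l xs → Sorted xs → l < length xs →
      ∃₂ λ ys x → ∃[ zs ] (xs ≡ ys ++ x ∷ zs × length ys ≡ l × All (λ y → k y ≼ k x) ys × All (λ z →
          k x ≼ k z) (x ∷ zs))
    sorted-split zero    (x ∷ xs) (x≼xs ∷ s) _ = [] , x , xs , refl , refl , [] , ≼-refl ∷ x≼xs
    sorted-split (suc l) (w ∷ xs) (w≼xs ∷ s) (s≤s l<) with sorted-split l xs s l<
    ... | ys , x , zs , refl , e , p , q =
      w ∷ ys , x , zs , refl , cong suc e , All.head (Allₚ.++⁻ʳ ys w≼xs) ∷ p , q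

  private variable
    X : Set

  -- Mutual with `eval-halve`, since the pivot is the median of the group medians. With g groups and
  -- h = ⌊g/2⌋, the second recursive call is on at least 3h items fewer, which frees 1500h steps.
  -- All other work, the first recursive call included, takes at most 584 steps per group up to an
  -- additive constant, and 584(1 + 2h) stays below 1500h by at least 80 as soon as h ≥ 2.
  eval-select : ∀ b (k : X → Key) payload xs l → l < length xs → length xs ≤ b →
    Split k payload select (Items.items k payload xs ∙ nat l) xs l (length xs * 500)

  eval-halve : ∀ b (k : X → Key) payload xs → 2 ≤ length xs → length xs ≤ b →
    Split k payload halve (Items.items k payload xs) xs ⌈ length xs /2⌉ (length xs * 502)
  eval-halve b k payload xs 2≤ xs≤b = halved (Items.eval-half k payload xs 0)
    (eval-select b k payload xs ⌈ length xs /2⌉ (⌈n/2⌉< 2≤) xs≤b)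
    where
    ⌈n/2⌉< : ∀ {n} → 2 ≤ n → ⌈ n /2⌉ < n
    ⌈n/2⌉< {suc zero} (s≤s ())
    ⌈n/2⌉< {suc (suc n)} _ = ⌈n/2⌉<n n
    halved : ∃[ t ] (Eval o half (Items.items k payload xs ∙ nat 0) t
        (nat ⌈ length xs /2⌉) × t ≤ 1 + length xs) →
      Split k payload select (Items.items k payload xs ∙ nat ⌈ length xs /2⌉) xs ⌈ length xs /2⌉
          (length xs * 500) →
      Split k payload halve (Items.items k payload xs) xs ⌈ length xs /2⌉ (length xs * 502)
    halved (t , E , c) (mk-split {time = t′} F p s u v d) = mk-split (calls (λ _ → refl) E F) p s u v
      (lin 3 (λ t t′ n → 1 ⊠ t :≤ con 1 :+ n ⊢ 1 ⊠ t′ :≤ n :* 500 ⊢ 1 ⊠ con 2 :≤ n ⊢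
          goal (con 1 :+ (t :+ t′) :≤ n :* 502))
        (t ∷ t′ ∷ length xs ∷ []) c d 2≤)

  -- Twenty items, less at most four left over, give at least four groups, hence h ≥ 2. Below that,
  -- insertion sort is within the bound.
  eval-select b k payload xs l l< xs≤b with 20 ≤? length xs
  ... | no ¬20≤ with Items.eval-sort k payload 19 xs [] (≤-trans (≤-reflexive (+-identityʳ _)) (≤-pred
      (≰⇒> ¬20≤)))
  ...   | zs , t , E , s , p , c
    with sorted-split k payload l zs s (subst (l <_) (trans (cong length (sym (++-identityʳ xs))) (sym
        (↭-length p))) l<)
  ...   | us , x , vs , refl , refl , q , r = mk-split
    (calls (λ _ → refl) (eval-count o (Items.item k payload) xs 0)
      (calls small E (tails (λ _ → refl) (Items.eval-take k payload l us [] refl))))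
    (↭-trans (++⁺ʳ (x ∷ vs) (↭-trans (ʳ++-↭ us []) (↭-reflexive (++-identityʳ us))))
      (↭-trans p (↭-reflexive (++-identityʳ xs))))
    (trans (length-ʳ++ us) (+-identityʳ _))
    (All-resp-↭ (↭-sym (↭-trans (ʳ++-↭ us []) (↭-reflexive (++-identityʳ us)))) q) r
    (lin 3 (λ n t l → 1 ⊠ t :≤ con 1 :+ n :* 40 ⊢ 50 ⊠ con 1 :+ l :≤ n ⊢
      goal (con 1 :+ (con 1 :+ n :+ (con 1 :+ (t :+ (con 1 :+ (con 1 :+ l))))) :≤ n :* 500))
          (length xs ∷ t ∷ l ∷ []) c l<)
    where
    small : ∀ κ → act (body o select₁) (((Items.items k payload xs ∙ nat l) ∙ nat (length xs)) ∙ κ) ≡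
      just (enter (label o sort) ((Items.items k payload xs ∙ nat 0) ∙ (nat (label o cut) ∙ nat l) ∙ κ))
    small κ with 20 ∸ length xs | m<n⇒0<n∸m (≰⇒> ¬20≤)
    ... | suc _ | _ = refl
  eval-select zero k payload xs l l< xs≤b | yes 20≤ with () ← ≤-trans 20≤ xs≤b
  eval-select {X} (suc b) k payload xs l l< xs≤b | yes 20≤ with Groups.eval-group k payload xs []
  ... | left , gs , t₁ , E₁ , p₁ , left≤4 , n≡ , c₁ = grouped
    where
    open Items k payload
    open Groups k payload
    g = length gs
    g≥4 : 4 ≤ g
    g≥4 with 4 ≤? g
    ... | yes p = p
    ... | no ¬p = ⊥-elim (<⇒≱ (lin 3 (λ g r n → 5 ⊠ con 1 :+ g :≤ con 4 ⊢ 1 ⊠ r :≤ con 4 ⊢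
        1 ⊠ n :≤ g :* 5 :+ r ⊢ goal (con 1 :+ n :≤ con 20))
        (g ∷ length left ∷ length xs ∷ []) (≰⇒> ¬p) left≤4 (≤-reflexive (sym n≡))) 20≤)
    h = ⌊ g /2⌋
    h≥2 : 2 ≤ h
    h≥2 = ⌊n/2⌋-mono g≥4
    halves : h + ⌈ g /2⌉ ≡ g
    halves = ⌊n/2⌋+⌈n/2⌉≡n g
    g≤b : g ≤ b
    g≤b = lin 4 (λ g r n b → 1 ⊠ g :* 5 :+ r :≤ n ⊢ 1 ⊠ n :≤ con 1 :+ b ⊢ 1 ⊠ con 4 :≤ g ⊢ goal (g :≤ b))
      (g ∷ length left ∷ length xs ∷ b ∷ []) (≤-reflexive n≡) xs≤b g≥4
    g≤2h+1 : g ≤ 1 + h * 2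
    g≤2h+1 = lin 3 (λ g h c → 1 ⊠ g :≤ h :+ c ⊢ 1 ⊠ c :≤ con 1 :+ h ⊢ goal (g :≤ con 1 :+ h :* 2))
      (g ∷ h ∷ ⌈ g /2⌉ ∷ []) (≤-reflexive (sym halves)) (⌈n/2⌉≤1+⌊n/2⌋ g)
    grouped : Split k payload select (items xs ∙ nat l) xs l (length xs * 500)
    grouped with eval-halve b group-key group-payload gs (≤-trans (s≤s (s≤s z≤n)) g≥4) g≤b
    ... | mk-split {fs} {hs} {m} {t₂} E₂ p₂ u₂ v₂ w₂ d₂ with eval-lower m fs hs left v₂ w₂ [] []
    ... | as , bs , t₃ , E₃ , as≼m , m≼bs , p₃ , as≥ , bs≥ , d₃ = sifted
      where
      fs+hs : length fs + length hs ≡ g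
      fs+hs = trans (sym (length-++ fs)) (↭-length p₂)
      hs≡h : length hs ≡ h
      hs≡h = +-cancelʳ-≡ ⌈ g /2⌉ (length hs) h (trans (+-comm (length hs) ⌈ g /2⌉)
        (trans (cong (_+ length hs) (sym u₂)) (trans fs+hs (sym halves))))
      as++bs : as ++ bs ↭ xs
      as++bs = ↭-trans p₃ (↭-trans (gather (flatten fs) (flatten hs) left)
        (↭-trans (++⁺ʳ left (↭-trans (↭-reflexive (sym (flatten-++ fs hs))) (flatten-↭ p₂)))
          (↭-trans p₁ (↭-reflexive (++-identityʳ xs)))))
      n≡a+b : length as + length bs ≡ length xs
      n≡a+b = trans (sym (length-++ as)) (↭-length as++bs)
      h≤fs : h ≤ length fs
      h≤fs = subst (h ≤_) (sym u₂) (⌊n/2⌋≤⌈n/2⌉ g)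
      a+3h≤n : length as + h * 3 ≤ length xs
      a+3h≤n = lin 4 (λ a b h n → 1 ⊠ h :* 3 :+ con 0 :≤ b ⊢ 1 ⊠ a :+ b :≤ n ⊢ goal (a :+ h :* 3 :≤ n))
        (length as ∷ length bs ∷ h ∷ length xs ∷ []) (subst (λ h →
            h * 3 + 0 ≤ length bs) hs≡h bs≥) (≤-reflexive n≡a+b)
      b+3h≤n : length bs + h * 3 ≤ length xs
      b+3h≤n = lin 5 (λ a b h n f → 1 ⊠ f :* 3 :+ con 0 :≤ a ⊢ 3 ⊠ h :≤ f ⊢ 1 ⊠ a :+ b :≤ n ⊢
          goal (b :+ h :* 3 :≤ n))
        (length as ∷ length bs ∷ h ∷ length xs ∷ length fs ∷ []) as≥ h≤fs (≤-reflexive n≡a+b)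
      smaller : ∀ {c} → c + h * 3 ≤ length xs → c ≤ b
      smaller {c} p = lin 4 (λ c h n b → 1 ⊠ c :+ h :* 3 :≤ n ⊢ 1 ⊠ n :≤ con 1 :+ b ⊢ 3 ⊠ con 2 :≤ h ⊢
          goal (c :≤ b))
        (c ∷ h ∷ length xs ∷ b ∷ []) p xs≤b h≥2
      -- c is the size of the side on which the selection continues.
      total : ∀ c {ts r s} → c + h * 3 ≤ length xs → ts ≤ c * 500 → r ≤ length xs → s ≤ length xs →
        suc (suc (length xs) + suc (t₁ + suc (t₂ + suc (t₃ + suc (suc s + suc (ts + suc
            (suc r + 1))))))) ≤ length xs * 500
      total c {ts} {r} {s} c+3h≤n ts≤ r≤ s≤ = lin 13
        (λ n g e h f i t₁ t₂ t₃ s c ts r →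
          500 ⊠ c :+ h :* 3 :≤ n ⊢ 1 ⊠ ts :≤ c :* 500 ⊢ 1 ⊠ r :≤ n ⊢ 1 ⊠ s :≤ n ⊢
          1 ⊠ t₁ :+ con 0 :≤ con 1 :+ g :* 64 ⊢ 1 ⊠ t₂ :≤ g :* 502 ⊢ 1 ⊠ t₃ :≤ con 3 :+ f :* 3 :+ i :* 3 :+ e ⊢
          3 ⊠ f :+ i :≤ g ⊢ 3 ⊠ n :≤ g :* 5 :+ e ⊢ 584 ⊠ g :≤ con 1 :+ h :* 2 ⊢ 4 ⊠ e :≤ con 4 ⊢
              332 ⊠ con 2 :≤ h ⊢
          goal (con 1 :+ (con 1 :+ n :+ (con 1 :+ (t₁ :+ (con 1 :+ (t₂ :+ (con 1 :+ (t₃ :+ (con 1 :+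
              (con 1 :+ s :+
            (con 1 :+ (ts :+ (con 1 :+ (con 1 :+ r :+ con 1))))))))))))) :≤ n :* 500))
        (length xs ∷ g ∷ length left ∷ h ∷ length fs ∷ length hs ∷ t₁ ∷ t₂ ∷ t₃ ∷ s ∷ c ∷ ts ∷ r ∷ [])
        c+3h≤n ts≤ r≤ s≤ c₁ d₂ d₃ (≤-reflexive fs+hs) (≤-reflexive (sym n≡)) g≤2h+1 left≤4 h≥2
      a≤n : length as ≤ length xs
      a≤n = ≤-trans (m≤m+n _ _) a+3h≤n
      first-steps : ∀ κ → act (body o select₁) (((items xs ∙ nat l) ∙ nat (length xs)) ∙ κ) ≡
        just (enter (label o group) ((items xs ∙ nat 0) ∙ (nat (label o select₂) ∙ nat l) ∙ κ))
      first-steps κ rewrite m≤n⇒m∸n≡0 20≤ = refl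
      compose : ∀ {t w} → Eval o select₅ ((nat l ∙ key m ∙ items as ∙ items bs) ∙ nat (length as)) t w →
        Eval o select (items xs ∙ nat l)
          (suc (suc (length xs) + suc (t₁ + suc (t₂ + suc (t₃ + suc (suc (length as) + t)))))) w
      compose E = calls (λ _ → refl) (eval-count o item xs 0) (calls first-steps E₁ (calls (λ _ → refl) E₂
        (calls (λ _ → refl) E₃ (calls (λ _ → refl) (eval-count o item as 0) E))))
      sifted : Split k payload select (items xs ∙ nat l) xs l (length xs * 500)
      sifted with <-cmp l (length as)
      ... | tri≈ _ refl _ = mk-split (compose (returns ends)) as++bs refl as≼m m≼bs
        (≤-trans (lin 6 (λ n t₁ t₂ t₃ s z → goal (
            con 1 :+ (con 1 :+ n :+ (con 1 :+ (t₁ :+ (con 1 :+ (t₂ :+ (con 1 :+ (t₃ :+ (con 1 :+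
                (con 1 :+ s :+ con 1)))))))))
            :≤ con 1 :+ (con 1 :+ n :+ (con 1 :+ (t₁ :+ (con 1 :+ (t₂ :+ (con 1 :+ (t₃ :+ (con 1 :+
                (con 1 :+ s :+
            (con 1 :+ (con 0 :+ (con 1 :+ (con 1 :+ con 0 :+ con 1)))))))))))))))
                (length xs ∷ t₁ ∷ t₂ ∷ t₃ ∷ length as ∷ 0 ∷ []))
          (total (length as) a+3h≤n z≤n z≤n a≤n))
        where
        ends : ∀ f s κ → act (body o select₅) (((nat (length as) ∙ key m ∙ items as ∙ items bs) ∙ nat
            (length as)) ∙ (nat f ∙ s) ∙ κ) ≡
          just (enter f ((s ∙ items as ∙ items bs ∙ key m) ∙ κ))
        ends f s κ rewrite n∸n≡0 (length as) = refl
      ... | tri< l<a _ _ with eval-select b k payload as l l<a (smaller a+3h≤n)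
      ...   | mk-split {lo} {hi} {q} {ts} E p u v w d = mk-split
        (compose (calls continue E (calls (λ _ → refl) (eval-rev-append o item hi bs) (returns (λ _ _ _ →
            refl)))))
        (↭-trans (++⁺ˡ lo (ʳ++-↭ hi bs)) (↭-trans (↭-reflexive (sym (++-assoc lo hi bs))) (↭-trans
            (++⁺ʳ bs p) as++bs)))
        u v (All-resp-↭ (↭-sym (ʳ++-↭ hi bs)) (Allₚ.++⁺ w (All.map (≼-trans (q≼m hi hi>0 w (Allₚ.++⁻ʳ lo
            (All-resp-↭ (↭-sym p) as≼m)))) m≼bs)))
        (total (length as) a+3h≤n d (≤-trans (m≤n+m (length hi) (length lo)) (≤-trans
            (≤-reflexive lo+hi) a≤n)) a≤n)
        where
        lo+hi : length lo + length hi ≡ length as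
        lo+hi = trans (sym (length-++ lo)) (↭-length p)
        hi>0 : 1 ≤ length hi
        hi>0 = lin 3 (λ l a h → 1 ⊠ con 1 :+ l :≤ a ⊢ 1 ⊠ a :≤ l :+ h ⊢
            goal (con 1 :≤ h)) (l ∷ length as ∷ length hi ∷ [])
          l<a (≤-reflexive (sym (trans (cong (_+ length hi) (sym u)) lo+hi)))
        q≼m : ∀ zs → 1 ≤ length zs → All (λ x → q ≼ k x) zs → All (λ x → k x ≼ m) zs → q ≼ m
        q≼m (z ∷ _) _ (q≼z ∷ _) (z≼m ∷ _) = ≼-trans q≼z z≼m
        continue : ∀ κ → act (body o select₅) (((nat l ∙ key m ∙ items as ∙ items bs) ∙ nat (length as)) ∙ κ) ≡
          just (enter (label o select) ((items as ∙ nat l) ∙ (nat (label o select₆) ∙ items bs) ∙ κ))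
        continue κ with length as ∸ l | m<n⇒0<n∸m l<a
        ... | suc _ | _ = refl
      sifted | tri> _ _ a<l with eval-select b k payload bs (l ∸ length as) l∸a<b (smaller b+3h≤n)
        where
        l∸a<b : l ∸ length as < length bs
        l∸a<b = +-cancelˡ-< (length as) _ _ (subst₂ _<_ (sym (m+[n∸m]≡n (<⇒≤ a<l))) (sym n≡a+b) l<)
      ...   | mk-split {lo} {hi} {q} {ts} E p u v w d = mk-split
        (compose (calls continue E (calls (λ _ → refl) (eval-rev-append o item as lo) (returns (λ _ _ _ →
            refl)))))
        (↭-trans (++⁺ʳ hi (ʳ++-↭ as lo)) (↭-trans (↭-reflexive (++-assoc as lo hi)) (↭-trans
            (++⁺ˡ as p) as++bs)))
        (trans (length-ʳ++ as) (trans (cong (length as +_) u) (m+[n∸m]≡n (<⇒≤ a<l))))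
        (All-resp-↭ (↭-sym (ʳ++-↭ as lo)) (Allₚ.++⁺ (All.map (λ x≼m →
            ≼-trans x≼m (m≼q lo lo>0 v (Allₚ.++⁻ˡ lo (All-resp-↭ (↭-sym p) m≼bs)))) as≼m) v)) w
        (total (length bs) b+3h≤n d a≤n a≤n)
        where
        lo>0 : 1 ≤ length lo
        lo>0 = subst (1 ≤_) (sym u) (m<n⇒0<n∸m a<l)
        m≼q : ∀ zs → 1 ≤ length zs → All (λ x → k x ≼ q) zs → All (λ x → m ≼ k x) zs → m ≼ q
        m≼q (z ∷ _) _ (z≼q ∷ _) (m≼z ∷ _) = ≼-trans m≼z z≼q
        continue : ∀ κ → act (body o select₅) (((nat l ∙ key m ∙ items as ∙ items bs) ∙ nat (length as)) ∙ κ) ≡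
          just (enter (label o select) ((items bs ∙ nat (l ∸ length as)) ∙ (nat
              (label o select₇) ∙ items as) ∙ κ))
        continue κ rewrite m≤n⇒m∸n≡0 (<⇒≤ a<l) with l ∸ length as | m<n⇒0<n∸m a<l
        ... | suc _ | _ = refl

  -- Draining columns below a threshold

  open DecMembership (_≟ᶠ_ {n}) using (_∈?_)

  Row : Set
  Row = Fin n

  row-list : List Row → Val
  row-list = list index

  no-payload : Key → Val
  no-payload _ = nat 0

  module Columns = Items (λ x → x) no-payload
  open Columns using (item; eval-partition) renaming (items to col-list)

  rows-of cols-of : List Key → List (Fin n)
  rows-of = map proj₁
  cols-of = map proj₂

  cols-length : ∀ {xs ys} → cols-of xs ↭ cols-of ys → length xs ≡ length ys
  cols-length {xs} {ys} p = trans (sym (length-map proj₂ xs)) (trans (↭-length p) (length-map proj₂ ys))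

  -- Weak bounds compose along chains of comparisons, and wherever a chain closes up at the
  -- saddlepoint, uniqueness identifies the position. Ties need no further treatment.
  record Saddle (z : Key) : Set where
    field
      row-max    : ∀ j → (proj₁ z , j) ≼ z
      row-unique : ∀ {j} → z ≼ (proj₁ z , j) → j ≡ proj₂ z
      col-min    : ∀ i → z ≼ (i , proj₂ z)
      col-unique : ∀ {i} → (i , proj₂ z) ≼ z → i ≡ proj₁ z

  open Saddle

  -- The row of a saddlepoint z above the threshold m may be dropped by a
  -- computation that does not hold the column of z.
  Lost : Key → List (Fin n) → Key → Set
  Lost m cs z = m ≼ z × proj₂ z ∉ cs

  Sound : Key → List (Fin n) → List Row → List Row → Set
  Sound m cs rs rs′ = ∀ {z} → Saddle z → proj₁ z ∈ rs → proj₁ z ∈ rs′ ⊎ Lost m cs z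

  -- Since `z` is minimal in its column, a key of that column below `m` would push `z` below `m`.
  lowered : ∀ {m z xs} → All (_≺ m) xs → Saddle z → m ≼ z → proj₂ z ∉ cols-of xs
  lowered p s m≼z j∈ with ∈-map⁻ proj₂ j∈
  ... | (i , j) , x∈ , refl = ≺⋠ (All.lookup p x∈) (≼-trans m≼z (col-min s i))

  -- The key of the column of `z` is at most `m`, hence at most `z`, which is the strict minimum of
  -- that column. So the key lies in the row of `z`.
  matched : ∀ {m z xs} → All (_≼ m) xs → Saddle z → m ≼ z → proj₂ z ∈ cols-of xs → proj₁ z ∈ rows-of xs
  matched p s m≼z j∈ with ∈-map⁻ proj₂ j∈
  ... | (i , j) , x∈ , refl =
    subst (_∈ _) (col-unique s (≼-trans (All.lookup p x∈) m≼z)) (∈-map⁺ proj₁ x∈)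

  -- Draining lowers the keys of the columns cs below m, using up rows of F, unless F is
  -- exhausted first; rs are the rows to be accounted for.  Every row used pays 1520
  -- units of time, of which `credit` units are left over to pay for the halving that
  -- selected the columns to be drained.
  data Result (f : Name) (v : Val) (m : Key) (F : List Row) (cs : List (Fin n)) (rs : List Row)
              (used credit extra limit kept : ℕ) : Set where
    emptied : ∀ {D F′ t} → Eval o f v t (nat 1 ∙ col-list D ∙ row-list F′) → All (_≺ m) D → cols-of D ↭ cs →
      length F′ + used ≤ length F → t + credit + length F′ * 1520 ≤ extra + length F * 1520 →
      Sound m cs rs (F′ ++ rows-of D) → Result f v m F cs rs used credit extra limit kept
    exhausted : ∀ {Q C t} → Eval o f v t (nat 0 ∙ row-list Q ∙ col-list C) → cols-of C ↭ cs →
      t ≤ limit + length F * 1520 → length Q ≤ kept →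
      Sound m cs rs (Q ++ rows-of C) → Result f v m F cs rs used credit extra limit kept

  -- With one column no row has to be set aside: comparing its entry with the threshold and with the
  -- key settles it at once, so nothing but the key is kept on exhaustion. The row that brings the
  -- column below `m` costs one step and leaves the other 1519.
  eval-single : ∀ m F s → m ≼ s →
    Result single (key m ∙ row-list F ∙ item s) m F (proj₂ s ∷ []) (F ++ proj₁ s ∷ []) 1 1519 0 1 0
  eval-single m [] s m≼s = exhausted {Q = []} {C = s ∷ []} (returns (λ _ _ _ →
      refl)) ↭-refl ≤-refl z≤n (λ _ i∈ → inj₁ i∈)
  eval-single m (i ∷ F) s@(g , j) m≼s with ≺-or-≽ (i , j) m
  ... | inj₁ x≺m = emptied {D = (i , j) ∷ []} {F′ = F}
    (returns (λ _ _ _ → when-≺ x≺m refl refl refl)) (x≺m ∷ []) ↭-refl (≤-reflexive (+-comm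
        (length F) 1)) ≤-refl sound
    where
    sound : Sound m (j ∷ []) ((i ∷ F) ++ g ∷ []) (F ++ i ∷ [])
    sound z i∈ with ∈-++⁻ (i ∷ F) i∈
    ... | inj₁ (here refl) = inj₁ (∈-++⁺ʳ F (here refl))
    ... | inj₁ (there i∈F) = inj₁ (∈-++⁺ˡ i∈F)
    ... | inj₂ (here refl) = inj₂ (m≼z , lowered (x≺m ∷ []) z m≼z)
      where m≼z = ≼-trans m≼s (row-max z j)
  ... | inj₂ m≼x with ≺-or-≽ (i , j) s
  ...   | inj₁ x≺s = extend (eval-single m F (i , j) m≼x)
    where
    sound : ∀ {rs} → Sound m (j ∷ []) (F ++ i ∷ []) rs → Sound m (j ∷ []) ((i ∷ F) ++ g ∷ []) rs
    sound f {k , l} z i∈ with ∈-++⁻ (i ∷ F) i∈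
    ... | inj₁ (here refl) = f z (∈-++⁺ʳ F (here refl))
    ... | inj₁ (there i∈F) = f z (∈-++⁺ˡ i∈F)
    -- The row of the old key is given up: a saddlepoint in it is at least `s`, whereas column `j`
    -- now has an entry below `s`.
    ... | inj₂ (here refl) = inj₂ (≼-trans m≼s (row-max z j) , lowered (x≺s ∷ []) z (row-max z j))
    extend : Result single (key m ∙ row-list F ∙ item (i , j)) m F (j ∷ []) (F ++ i ∷ []) 1 1519 0 1 0 →
           Result single (key m ∙ row-list (i ∷ F) ∙ item s) m (i ∷ F) (j ∷ []) ((i ∷ F) ++ g ∷ []) 1 1519 0 1 0
    extend (emptied E p q b c S) = emptied (tails (λ κ →
        when-≽ m≼x refl refl (when-≺ x≺s refl refl refl)) E) p q
      (m≤n⇒m≤1+n b) (s≤s (≤-trans c (m≤n+m _ 1519))) (sound S)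
    extend (exhausted E q c b S) = exhausted (tails (λ κ →
        when-≽ m≼x refl refl (when-≺ x≺s refl refl refl)) E) q
      (s≤s (≤-trans c (lin 1 (λ f → goal (con 1 :+ f :≤ con 1520 :+ f)) (length F * 1520 ∷ [])))) b (sound S)
  ...   | inj₂ s≼x = extend (eval-single m F s m≼s)
    where
    sound : ∀ {rs} → Sound m (j ∷ []) (F ++ g ∷ []) rs → Sound m (j ∷ []) ((i ∷ F) ++ g ∷ []) rs
    sound f {k , l} z i∈ with ∈-++⁻ (i ∷ F) i∈
    ... | inj₁ (there i∈F) = f z (∈-++⁺ˡ i∈F)
    ... | inj₂ i∈g = f z (∈-++⁺ʳ F i∈g)
    ... | inj₁ (here refl) with l ≟ᶠ j
    ...   | yes refl = f z (∈-++⁺ʳ F (matched (s≼x ∷ []) z (row-max z j) (here refl)))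
    ...   | no l≢j = inj₂ (≼-trans m≼x (row-max z j) , λ { (here e) → l≢j e })
    extend : Result single (key m ∙ row-list F ∙ item s) m F (j ∷ []) (F ++ g ∷ []) 1 1519 0 1 0 →
           Result single (key m ∙ row-list (i ∷ F) ∙ item s) m (i ∷ F) (j ∷ []) ((i ∷ F) ++ g ∷ []) 1 1519 0 1 0
    extend (emptied E p q b c S) = emptied (tails (λ κ →
        when-≽ m≼x refl refl (when-≽ s≼x refl refl refl)) E) p q
      (m≤n⇒m≤1+n b) (s≤s (≤-trans c (m≤n+m _ 1519))) (sound S)
    extend (exhausted E q c b S) = exhausted (tails (λ κ →
        when-≽ m≼x refl refl (when-≽ s≼x refl refl refl)) E) q
      (s≤s (≤-trans c (lin 1 (λ f → goal (con 1 :+ f :≤ con 1520 :+ f)) (length F * 1520 ∷ [])))) b (sound S)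

  Tentative : Key → List Row → Set
  Tentative m Q = All (λ i → ∃[ j ] m ≼ (i , j)) Q

  -- The open guard `P` on the remaining rows lets the induction hypothesis be passed to lemmas
  -- outside of the recursion. The limits count all of `cs`, lowered columns included; with
  -- `2 ≤ length cs` even a single column drained in a round is at most half of them.
  RefineSpec : (List Row → Set) → Set
  RefineSpec P = ∀ {m F S D Q cs} → P F → All (m ≼_) S → All (_≺ m) D → Tentative m Q → cols-of (S ++ D) ↭ cs →
    2 ≤ length cs →
    Result refine (key m ∙ row-list F ∙ col-list S ∙ col-list D ∙ row-list Q) m F cs (F ++ (Q ++ rows-of
        (S ++ D)))
      0 0 1 (length Q + length cs * 2800) (length Q + length cs * 2)

  -- The factor 4 solves k = 2 + k/2: a sweep sets aside at most two rows per column, and draining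
  -- at most half of the columns adds k/2 per column. The limit 4000 has the same origin: half of it
  -- and half of the 1508 for choosing the drained columns stay below the 2800 of `RefineSpec`, and
  -- the sweep adds little. The credit 1512 is 1508 for that choice and 4 for the partition that
  -- follows.
  DrainSpec : (List Row → Set) → Set
  DrainSpec P = ∀ {m F S} → P F → All (m ≼_) S → 1 ≤ length S →
    Result drain (key m ∙ row-list F ∙ col-list S) m F (cols-of S) (F ++ rows-of S)
      (length S) (length S * 1512) 0 (length S * 4000) (length S * 4)

  rows-++⁻ : ∀ {i} xs {ys} → i ∈ rows-of (xs ++ ys) → i ∈ rows-of xs ⊎ i ∈ rows-of ys
  rows-++⁻ xs {ys} i∈ = ∈-++⁻ (rows-of xs) (subst (_ ∈_) (map-++ proj₁ xs ys) i∈)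

  cols-++⁻ : ∀ {i} xs {ys} → i ∈ cols-of (xs ++ ys) → i ∈ cols-of xs ⊎ i ∈ cols-of ys
  cols-++⁻ xs {ys} i∈ = ∈-++⁻ (cols-of xs) (subst (_ ∈_) (map-++ proj₂ xs ys) i∈)

  rows-++⁺ˡ : ∀ {i} xs {ys} → i ∈ rows-of xs → i ∈ rows-of (xs ++ ys)
  rows-++⁺ˡ xs {ys} i∈ = subst (_ ∈_) (sym (map-++ proj₁ xs ys)) (∈-++⁺ˡ i∈)

  rows-++⁺ʳ : ∀ {i} xs {ys} → i ∈ rows-of ys → i ∈ rows-of (xs ++ ys)
  rows-++⁺ʳ xs {ys} i∈ = subst (_ ∈_) (sym (map-++ proj₁ xs ys)) (∈-++⁺ʳ (rows-of xs) i∈)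

  widen : ∀ {f v m F cs rs rs′ a b c d e} → (∀ {i} → i ∈ rs′ → i ∈ rs) →
          Result f v m F cs rs a b c d e → Result f v m F cs rs′ a b c d e
  widen g (emptied E p q b c S)   = emptied E p q b c (λ z i∈ → S z (g i∈))
  widen g (exhausted E q c b S) = exhausted E q c b (λ z i∈ → S z (g i∈))

  -- If the saddlepoint lies in a column of lo, the key of that column is the
  -- saddlepoint itself, and so its row is still at hand.
  resolve : ∀ {m m₁ lo hi D cs} → m ≼ m₁ → All (_≼ m₁) lo → All (_≺ m) D → cols-of (hi ++ (lo ++ D)) ↭ cs →
            ∀ {z} → Saddle z → Lost m₁ (cols-of hi) z → proj₁ z ∈ rows-of lo ⊎ Lost m cs z
  resolve {lo = lo} {hi} m≼m₁ lo≼ D≺ p {z} s (m₁≼z , j∉) with proj₂ z ∈? cols-of lo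
  ... | yes j∈ = inj₁ (matched lo≼ s m₁≼z j∈)
  ... | no j∉lo = inj₂ (m≼z , λ j∈ → absurd (cols-++⁻ hi (∈-resp-↭ (↭-sym p) j∈)))
    where
    m≼z = ≼-trans m≼m₁ m₁≼z
    absurd : _ ⊎ _ → ⊥
    absurd (inj₁ j∈) = j∉ j∈
    absurd (inj₂ j∈) with cols-++⁻ lo j∈
    ... | inj₁ j∈lo = j∉lo j∈lo
    ... | inj₂ j∈D  = lowered D≺ s m≼z j∈D

  -- One round of `refine`, shared by the two ways to choose `hi`: the upper half at a median `m₁`,
  -- or the only column left, with `m₁ = m` and `lo` empty. The hypothesis `prefix` charges the
  -- choice with 1508 steps per column of `hi`, to be met from the credit that draining `hi` leaves.
  module Refining {m m₁ : Key} {F : List Row} {lo hi D : List Key} {Q : List Row} {cs : List (Fin n)} {v : Val}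
    (rec : RefineSpec (λ F′ → length F′ < length F))
    (m≼m₁ : m ≼ m₁) (m≼lo : All (m ≼_) lo) (lo≼m₁ : All (_≼ m₁) lo) (D≺m : All (_≺ m) D)
        (tentative : Tentative m Q)
    (columns : cols-of (hi ++ (lo ++ D)) ↭ cs) (2≤cs : 2 ≤ length cs)
    (hi>0 : 1 ≤ length hi) (2hi≤cs : length hi * 2 ≤ length cs)
    (prefix : ∀ {w t w′ t′} → Eval o drain (key m₁ ∙ row-list F ∙ col-list hi) t w →
      Eval o refine₂ ((key m ∙ col-list lo ∙ col-list D ∙ row-list Q) ∙ w) t′ w′ →
      ∃[ u ] (Eval o refine v u w′ × u ≤ length hi * 1508 + (t + t′)))
    where

    before : List Row
    before = F ++ (Q ++ rows-of (hi ++ (lo ++ D)))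

    D≤cs : length D ≤ length cs
    D≤cs = begin
      length D                      ≤⟨ m≤n+m _ _ ⟩
      length lo + length D          ≡⟨ length-++ lo ⟨
      length (lo ++ D)              ≤⟨ m≤n+m _ _ ⟩
      length hi + length (lo ++ D)  ≡⟨ length-++ hi ⟨
      length (hi ++ (lo ++ D))      ≡⟨ length-map proj₂ (hi ++ (lo ++ D)) ⟨
      length (cols-of (hi ++ (lo ++ D))) ≡⟨ ↭-length columns ⟩
      length cs                     ∎
      where open ≤-Reasoning

    sound : ∀ {R R′ : List Row} → Sound m₁ (cols-of hi) (F ++ rows-of hi) R →
            (∀ {z} → Saddle z → proj₁ z ∈ R ⊎ proj₁ z ∈ Q ⊎ proj₁ z ∈ rows-of lo ⊎ proj₁ z ∈ rows-of D →
              proj₁ z ∈ R′ ⊎ Lost m cs z) →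
            Sound m cs before R′
    sound {R} {R′} drained continue {z} s i∈ = locate (∈-++⁻ F i∈)
      where
      from-drain : proj₁ z ∈ R ⊎ Lost m₁ (cols-of hi) z → proj₁ z ∈ R′ ⊎ Lost m cs z
      from-drain (inj₁ i∈R) = continue s (inj₁ i∈R)
      from-drain (inj₂ l) with resolve {hi = hi} m≼m₁ lo≼m₁ D≺m columns s l
      ... | inj₁ i∈lo = continue s (inj₂ (inj₂ (inj₁ i∈lo)))
      ... | inj₂ l′   = inj₂ l′
      locate : proj₁ z ∈ F ⊎ proj₁ z ∈ Q ++ rows-of (hi ++ (lo ++ D)) → proj₁ z ∈ R′ ⊎ Lost m cs z
      locate (inj₁ i∈F) = from-drain (drained s (∈-++⁺ˡ i∈F))
      locate (inj₂ i∈′) with ∈-++⁻ Q i∈′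
      ... | inj₁ i∈Q = continue s (inj₂ (inj₁ i∈Q))
      ... | inj₂ i∈″ with rows-++⁻ hi i∈″
      ...   | inj₁ i∈hi = from-drain (drained s (∈-++⁺ʳ F i∈hi))
      ...   | inj₂ i∈‴ with rows-++⁻ lo i∈‴
      ...     | inj₁ i∈lo = continue s (inj₂ (inj₂ (inj₁ i∈lo)))
      ...     | inj₂ i∈D  = continue s (inj₂ (inj₂ (inj₂ i∈D)))

    Refined : Set
    Refined = Result refine v m F cs before 0 0 1 (length Q + length cs * 2800) (length Q + length cs * 2)

    refined : Result drain (key m₁ ∙ row-list F ∙ col-list hi) m₁ F (cols-of hi) (F ++ rows-of hi)
                (length hi) (length hi * 1512) 0 (length hi * 4000) (length hi * 4) → Refined
    refined (exhausted {Q′} {C} {t} E C↭hi t≤ Q′≤ S) = conclude (prefix E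
        (calls (λ _ → refl) (eval-rev-append o index Q Q′)
          (calls (λ _ → refl) (eval-rev-append o item C lo)
            (calls (λ _ → refl) (eval-rev-append o item D (C ʳ++ lo)) (returns (λ _ _ _ → refl))))))
      where
      C≡hi : length C ≡ length hi
      C≡hi = cols-length C↭hi
      all : D ʳ++ (C ʳ++ lo) ↭ C ++ (lo ++ D)
      all = ↭-trans (ʳ++-↭ D (C ʳ++ lo)) (↭-trans (++-comm D _)
        (↭-trans (++⁺ʳ D (ʳ++-↭ C lo)) (↭-reflexive (++-assoc C lo D))))
      continue : ∀ {z} → Saddle z →
        proj₁ z ∈ Q′ ++ rows-of C ⊎ proj₁ z ∈ Q ⊎ proj₁ z ∈ rows-of lo ⊎ proj₁ z ∈ rows-of D →
        proj₁ z ∈ (Q ʳ++ Q′) ++ rows-of (D ʳ++ (C ʳ++ lo)) ⊎ Lost m cs z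
      continue s (inj₁ i∈) with ∈-++⁻ Q′ i∈
      ... | inj₁ i∈Q′ = inj₁ (∈-++⁺ˡ (∈-resp-↭ (↭-sym (ʳ++-↭ Q Q′)) (∈-++⁺ʳ Q i∈Q′)))
      ... | inj₂ i∈C  = inj₁ (∈-++⁺ʳ (Q ʳ++ Q′) (∈-resp-↭ (↭-sym (map⁺ proj₁ all)) (rows-++⁺ˡ C i∈C)))
      continue s (inj₂ (inj₁ i∈Q)) = inj₁ (∈-++⁺ˡ (∈-resp-↭ (↭-sym (ʳ++-↭ Q Q′)) (∈-++⁺ˡ i∈Q)))
      continue s (inj₂ (inj₂ (inj₁ i∈lo))) =
        inj₁ (∈-++⁺ʳ (Q ʳ++ Q′) (∈-resp-↭ (↭-sym (map⁺ proj₁ all)) (rows-++⁺ʳ C (rows-++⁺ˡ lo i∈lo))))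
      continue s (inj₂ (inj₂ (inj₂ i∈D))) =
        inj₁ (∈-++⁺ʳ (Q ʳ++ Q′) (∈-resp-↭ (↭-sym (map⁺ proj₁ all)) (rows-++⁺ʳ C (rows-++⁺ʳ lo i∈D))))
      conclude : ∃[ u ] (Eval o refine v u (nat 0 ∙ row-list (Q ʳ++ Q′) ∙ col-list (D ʳ++ (C ʳ++ lo))) ×
               u ≤ length hi * 1508 + (t + suc (suc (length Q) + suc (suc (length C) + suc (suc
                   (length D) + 1))))) → Refined
      conclude (u , E′ , u≤) = exhausted E′
        (↭-trans (map⁺ proj₂ all) (↭-trans (↭-reflexive (map-++ proj₂ C (lo ++ D)))
          (↭-trans (++⁺ʳ (cols-of (lo ++ D)) C↭hi) (↭-trans (↭-reflexive (sym (map-++ proj₂ hi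
              (lo ++ D)))) columns))))
        (lin 8 (λ u h t q c d f k →
          1 ⊠ u :≤ h :* 1508 :+ (t :+ (con 1 :+ (con 1 :+ q :+ (con 1 :+ (con 1 :+ c :+ (con 1 :+
              (con 1 :+ d :+ con 1))))))) ⊢
          1 ⊠ t :≤ h :* 4000 :+ f ⊢ 1 ⊠ c :≤ h ⊢ 2755 ⊠ h :* 2 :≤ k ⊢ 1 ⊠ d :≤ k ⊢ 4 ⊠ con 2 :≤ k ⊢
          goal (u :≤ q :+ k :* 2800 :+ f))
          (u ∷ length hi ∷ t ∷ length Q ∷ length C ∷ length D ∷ length F * 1520 ∷ length cs ∷ [])
          u≤ t≤ (≤-reflexive C≡hi) 2hi≤cs D≤cs 2≤cs)
        (subst (_≤ _) (sym (length-ʳ++ Q)) (lin 4 (λ q q′ h k → 1 ⊠ q′ :≤ h :* 4 ⊢ 2 ⊠ h :* 2 :≤ k ⊢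
            goal (q :+ q′ :≤ q :+ k :* 2))
          (length Q ∷ length Q′ ∷ length hi ∷ length cs ∷ []) Q′≤ 2hi≤cs))
        (sound S continue)
    refined (emptied {D′} {F′} {t} E D′≺ D′↭hi F′< t≤ S) =
      loop (eval-partition {P = _≺ m} {Q = m ≼_} m (λ p → p) (λ p → p) D′ D≺m m≼lo)
      where
      D′≡hi : length D′ ≡ length hi
      D′≡hi = cols-length D′↭hi
      loop : ∃₂ (λ D₂ S₂ → Eval o partition (key m ∙ col-list D′ ∙ col-list D ∙ col-list lo) (suc (length D′))
          (col-list D₂ ∙ col-list S₂) ×
               All (_≺ m) D₂ × All (m ≼_) S₂ × D₂ ++ S₂ ↭ D′ ++
                   (D ++ lo) × length D ≤ length D₂ × length lo ≤ length S₂) → Refined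
      loop (D₂ , S₂ , E₂ , D₂≺ , m≼S₂ , p , _) =
        next′ (rec F′<F m≼S₂ D₂≺ tentative cs-perm 2≤cs)
        where
        F′<F : length F′ < length F
        F′<F = lin 3 (λ f g h → 1 ⊠ f :+ h :≤ g ⊢ 1 ⊠ con 1 :≤ h ⊢
            goal (con 1 :+ f :≤ g)) (length F′ ∷ length F ∷ length hi ∷ []) F′< hi>0
        all : S₂ ++ D₂ ↭ D′ ++ (lo ++ D)
        all = ↭-trans (++-comm S₂ D₂) (↭-trans p (++⁺ˡ D′ (++-comm D lo)))
        cs-perm : cols-of (S₂ ++ D₂) ↭ cs
        cs-perm = ↭-trans (map⁺ proj₂ all) (↭-trans (↭-reflexive (map-++ proj₂ D′ (lo ++ D)))
          (↭-trans (++⁺ʳ (cols-of (lo ++ D)) D′↭hi) (↭-trans (↭-reflexive (sym (map-++ proj₂ hi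
              (lo ++ D)))) columns)))
        after′ : List Row
        after′ = F′ ++ (Q ++ rows-of (S₂ ++ D₂))
        present : ∀ {i} → i ∈ F′ ++ rows-of D′ ⊎ i ∈ Q ⊎ i ∈ rows-of lo ⊎ i ∈ rows-of D → i ∈ after′
        present (inj₁ i∈) with ∈-++⁻ F′ i∈
        ... | inj₁ i∈F′ = ∈-++⁺ˡ i∈F′
        ... | inj₂ i∈D′ = ∈-++⁺ʳ F′ (∈-++⁺ʳ Q (∈-resp-↭ (↭-sym (map⁺ proj₁ all)) (rows-++⁺ˡ D′ i∈D′)))
        present (inj₂ (inj₁ i∈Q)) = ∈-++⁺ʳ F′ (∈-++⁺ˡ i∈Q)
        present (inj₂ (inj₂ (inj₁ i∈lo))) =
          ∈-++⁺ʳ F′ (∈-++⁺ʳ Q (∈-resp-↭ (↭-sym (map⁺ proj₁ all)) (rows-++⁺ʳ D′ (rows-++⁺ˡ lo i∈lo))))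
        present (inj₂ (inj₂ (inj₂ i∈D))) =
          ∈-++⁺ʳ F′ (∈-++⁺ʳ Q (∈-resp-↭ (↭-sym (map⁺ proj₁ all)) (rows-++⁺ʳ D′ (rows-++⁺ʳ lo i∈D))))
        next′ : Result refine (key m ∙ row-list F′ ∙ col-list S₂ ∙ col-list D₂ ∙ row-list Q) m F′ cs after′
                  0 0 1 (length Q + length cs * 2800) (length Q + length cs * 2) → Refined
        next′ (emptied {D″} {F″} {t′} E′ D″≺ D″↭ F″≤ t′≤ S′) =
          finish′ (prefix E (calls (λ _ → refl) E₂ (tails (λ _ → refl) E′)))
          where
          finish′ : ∃[ u ] (Eval o refine v u (nat 1 ∙ col-list D″ ∙ row-list F″) ×
                     u ≤ length hi * 1508 + (t + suc (suc (length D′) + suc t′))) → Refined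
          finish′ (u , E″ , u≤) = emptied E″ D″≺ D″↭
            (lin 4 (λ f g h l → 1 ⊠ f :+ con 0 :≤ g ⊢ 1 ⊠ g :+ h :≤ l ⊢ goal (f :+ con 0 :≤ l))
              (length F″ ∷ length F′ ∷ length hi ∷ length F ∷ []) F″≤ F′<)
            (lin 8 (λ u h t d t′ x y w → 1 ⊠ u :≤ h :* 1508 :+ (t :+ (con 1 :+ (con 1 :+ d :+ (con 1 :+ t′)))) ⊢
              1 ⊠ t :+ h :* 1512 :+ y :≤ con 0 :+ w ⊢ 1 ⊠ t′ :+ con 0 :+ x :≤ con 1 :+ y ⊢ 1 ⊠ d :≤ h ⊢
                  3 ⊠ con 1 :≤ h ⊢
              goal (u :+ con 0 :+ x :≤ con 1 :+ w))
              (u ∷ length hi ∷ t ∷ length D′ ∷ t′ ∷ length F″ * 1520 ∷ length F′ * 1520 ∷ length F * 1520 ∷ [])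
              u≤ t≤ t′≤ (≤-reflexive D′≡hi) hi>0)
            (sound S (λ s i∈ → S′ s (present i∈)))
        next′ (exhausted {Q″} {C} {t′} E′ C↭ t′≤ Q″≤ S′) =
          finish′ (prefix E (calls (λ _ → refl) E₂ (tails (λ _ → refl) E′)))
          where
          finish′ : ∃[ u ] (Eval o refine v u (nat 0 ∙ row-list Q″ ∙ col-list C) ×
                     u ≤ length hi * 1508 + (t + suc (suc (length D′) + suc t′))) → Refined
          finish′ (u , E″ , u≤) = exhausted E″ C↭
            (lin 8 (λ u h t d t′ x y w → 1 ⊠ u :≤ h :* 1508 :+ (t :+ (con 1 :+ (con 1 :+ d :+ (con 1 :+ t′)))) ⊢
              1 ⊠ t :+ h :* 1512 :+ y :≤ con 0 :+ w ⊢ 1 ⊠ t′ :≤ x :+ y ⊢ 1 ⊠ d :≤ h ⊢ 3 ⊠ con 1 :≤ h ⊢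
              goal (u :≤ x :+ w))
              (u ∷ length hi ∷ t ∷ length D′ ∷ t′ ∷
                  (length Q + length cs * 2800) ∷ length F′ * 1520 ∷ length F * 1520 ∷ [])
              u≤ t≤ t′≤ (≤-reflexive D′≡hi) hi>0)
            Q″≤ (sound S (λ s i∈ → S′ s (present i∈)))

  -- Here the rows set aside are dropped at last. A saddlepoint in such a row is at least `m`, and
  -- since every column of `cs` has a key below `m`, its column is not among them.
  nothing-left : ∀ {m F D Q cs} → All (_≺ m) D → Tentative m Q → cols-of D ↭ cs →
                 Sound m cs (F ++ (Q ++ rows-of D)) (F ++ rows-of D)
  nothing-left {F = F} {Q = Q} D≺m tentative p {z} s i∈ with ∈-++⁻ F i∈
  ... | inj₁ i∈F = inj₁ (∈-++⁺ˡ i∈F)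
  ... | inj₂ i∈′ with ∈-++⁻ Q i∈′
  ...   | inj₂ i∈D = inj₁ (∈-++⁺ʳ F i∈D)
  ...   | inj₁ i∈Q with All.lookup tentative i∈Q
  ...     | j , m≼x = inj₂ (m≼z , λ j∈ → lowered D≺m s m≼z (∈-resp-↭ (↭-sym p) j∈))
    where m≼z = ≼-trans m≼x (row-max s j)

  -- Each row shortens either the columns `S` or the counter `B`, so unless the rows run out, at
  -- least `p` of them are used. The hypothesis on `length F` ensures that fewer than `b` rows are
  -- left when the counter is empty and `refine` takes over.
  eval-sweep : ∀ b → RefineSpec (λ F → length F < b) → ∀ F p {m B S D Q cs} → length F < b + length B →
    p ≤ length B → p ≤ length S → All (m ≼_) S → All (_≺ m) D → Tentative m Q → cols-of (S ++ D) ↭ cs →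
        2 ≤ length cs →
    Result sweep (key m ∙ col-list B ∙ row-list F ∙ col-list S ∙ col-list D ∙ row-list Q) m F cs
      (F ++ (Q ++ rows-of (S ++ D))) p (p * 1516) 3
      (4 + (length Q + (length B + length S)) + length cs * 2800) (length Q +
          (length B + length S) + length cs * 2)
  eval-sweep b rec F zero {S = []} {D = D} _ _ _ _ D≺m tentative p 2≤ =
    emptied {D = D} {F′ = F} (returns (λ _ _ _ → refl)) D≺m p (≤-reflexive (+-identityʳ _)) (s≤s (m≤n+m _ 2))
      (nothing-left {F = F} D≺m tentative p)
  eval-sweep b rec F zero {B = []} {S = s ∷ S} {Q = Q} {cs} F< _ _ m≼S D≺m tentative p 2≤
    with rec (subst (length F <_) (+-identityʳ b) F<) m≼S D≺m tentative p 2≤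
  ... | emptied E p₁ q c t≤ S′ = emptied (tails (λ _ → refl) E) p₁ q c (s≤s (≤-trans t≤ (n≤1+n _))) S′
  ... | exhausted {t = t} E q t≤ c S′ = exhausted (tails (λ _ → refl) E) q
    (lin 5 (λ t q s k f → 1 ⊠ t :≤ q :+ k :+ f ⊢ goal (con 1 :+ t :≤ con 4 :+ (q :+ s) :+ k :+ f))
      (t ∷ length Q ∷ suc (length S) ∷ length cs * 2800 ∷ length F * 1520 ∷ []) t≤)
    (≤-trans c (+-monoˡ-≤ (length cs * 2) (m≤m+n _ _))) S′
  eval-sweep b rec [] p {B = _ ∷ B} {S = s ∷ S} {D} {Q} {cs} _ _ _ m≼S D≺m tentative q 2≤ =
    exhausted {Q = Q} {C = (s ∷ S) ʳ++ D}
      (calls (λ _ → refl) (eval-rev-append o item (s ∷ S) D) (returns (λ _ _ _ → refl)))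
      (↭-trans (map⁺ proj₂ (ʳ++-↭ (s ∷ S) D)) q)
      (lin 4 (λ s q b k → goal (con 1 :+ (con 1 :+ s :+ con 1) :≤ con 4 :+ (q :+ (b :+ s)) :+ k :+ con 0))
        (suc (length S) ∷ length Q ∷ suc (length B) ∷ length cs * 2800 ∷ []))
      (≤-trans (m≤m+n _ _) (m≤m+n _ _))
      sound
    where
    sound : ∀ {m cs} → Sound m cs (Q ++ rows-of (s ∷ S ++ D)) (Q ++ rows-of ((s ∷ S) ʳ++ D))
    sound _ i∈ with ∈-++⁻ Q i∈
    ... | inj₁ i∈Q = inj₁ (∈-++⁺ˡ i∈Q)
    ... | inj₂ i∈′ = inj₁ (∈-++⁺ʳ Q (∈-resp-↭ (↭-sym (map⁺ proj₁ (ʳ++-↭ (s ∷ S) D))) i∈′))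
  eval-sweep b rec (i ∷ F) p {m} {β ∷ B} {s@(g , j) ∷ S} {D} {Q} {cs} F< p≤B p≤S (m≼s ∷ m≼S) D≺m tentative q 2≤
    with ≺-or-≽ (i , j) m
  -- Lowering a column sets a row aside as well, namely the row `g` of the old key, whose entry
  -- reaches `m`. Hence up to `length B + length S` rows may join `Q`.
  ... | inj₁ x≺m = extend (eval-sweep b rec F (pred p) {B = β ∷ B} (<-trans (n<1+n _) F<)
      (≤-trans pred[n]≤n p≤B)
      (pred-mono-≤ p≤S) m≼S (x≺m ∷ D≺m) ((j , m≼s) ∷ tentative)
      (↭-trans (map⁺ proj₂ (shift (i , j) S D)) (↭-trans (↭-reflexive refl) q)) 2≤)
    where
    before : ∀ {k} → k ∈ (i ∷ F) ++ (Q ++ rows-of (s ∷ S ++ D)) →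
        k ∈ F ++ ((g ∷ Q) ++ rows-of (S ++ (i , j) ∷ D))
    before (here refl) = ∈-++⁺ʳ F (∈-++⁺ʳ (g ∷ Q) (rows-++⁺ʳ S (here refl)))
    before (there k∈) with ∈-++⁻ F k∈
    ... | inj₁ k∈F = ∈-++⁺ˡ k∈F
    ... | inj₂ k∈′ with ∈-++⁻ Q k∈′
    ...   | inj₁ k∈Q = ∈-++⁺ʳ F (∈-++⁺ˡ (there k∈Q))
    ...   | inj₂ (here refl) = ∈-++⁺ʳ F (here refl)
    ...   | inj₂ (there k∈″) with rows-++⁻ S k∈″
    ...     | inj₁ k∈S = ∈-++⁺ʳ F (∈-++⁺ʳ (g ∷ Q) (rows-++⁺ˡ S k∈S))
    ...     | inj₂ k∈D = ∈-++⁺ʳ F (∈-++⁺ʳ (g ∷ Q) (rows-++⁺ʳ S (there k∈D)))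
    extend : Result sweep (key m ∙ col-list (β ∷ B) ∙ row-list F ∙ col-list S ∙ col-list
        ((i , j) ∷ D) ∙ row-list (g ∷ Q)) m F cs
               (F ++ ((g ∷ Q) ++ rows-of (S ++ (i , j) ∷ D))) (pred p) (pred p * 1516) 3
               (4 + (suc (length Q) + (suc (length B) + length S)) + length cs * 2800)
               (suc (length Q) + (suc (length B) + length S) + length cs * 2) →
             Result sweep (key m ∙ col-list (β ∷ B) ∙ row-list (i ∷ F) ∙ col-list
                 (s ∷ S) ∙ col-list D ∙ row-list Q) m (i ∷ F) cs
               ((i ∷ F) ++ (Q ++ rows-of (s ∷ S ++ D))) p (p * 1516) 3
               (4 + (length Q + (suc (length B) + suc (length S))) + length cs * 2800)
               (length Q + (suc (length B) + suc (length S)) + length cs * 2)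
    extend r with widen before r
    ... | emptied {F′ = F′} {t} E u v c t≤ S′ = emptied (tails (λ _ → when-≺ x≺m refl refl refl) E) u v
      (lin 4 (λ p p′ f g → 1 ⊠ p :≤ con 1 :+ p′ ⊢ 1 ⊠ f :+ p′ :≤ g ⊢ goal (f :+ p :≤ con 1 :+ g))
        (p ∷ pred p ∷ length F′ ∷ length F ∷ []) (n≤1+pred[n] p) c)
      (lin 5 (λ p p′ f g t → 1516 ⊠ p :≤ con 1 :+ p′ ⊢ 1 ⊠ t :+ p′ :* 1516 :+ f :≤ con 3 :+ g ⊢
        goal (con 1 :+ t :+ p :* 1516 :+ f :≤ con 3 :+ (con 1520 :+ g)))
        (p ∷ pred p ∷ length F′ * 1520 ∷ length F * 1520 ∷ t ∷ []) (n≤1+pred[n] p) t≤) S′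
    ... | exhausted {t = t} E v t≤ c S′ = exhausted (tails (λ _ → when-≺ x≺m refl refl refl) E) v
      (lin 6 (λ t q b s k f → 1 ⊠ t :≤ con 4 :+ (con 1 :+ q :+ (con 1 :+ b :+ s)) :+ k :+ f ⊢
        goal (con 1 :+ t :≤ con 4 :+ (q :+ (con 1 :+ b :+ (con 1 :+ s))) :+ k :+ (con 1520 :+ f)))
        (t ∷ length Q ∷ length B ∷ length S ∷ length cs * 2800 ∷ length F * 1520 ∷ []) t≤)
      (lin 5 (λ r q b s k → 1 ⊠ r :≤ con 1 :+ q :+ (con 1 :+ b :+ s) :+ k ⊢
          goal (r :≤ q :+ (con 1 :+ b :+ (con 1 :+ s)) :+ k))
        (_ ∷ length Q ∷ length B ∷ length S ∷ length cs * 2 ∷ []) c)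
      S′
  ... | inj₂ m≼x = extend (eval-sweep b rec F (pred p) {B = B} {S = s ∷ S}
      (≤-pred (subst (suc (length F) <_) (+-suc b (length B)) F<)) (pred-mono-≤ p≤B) (≤-trans pred[n]≤n p≤S)
      (m≼s ∷ m≼S) D≺m ((j , m≼x) ∷ tentative) q 2≤)
    where
    before : ∀ {k} → k ∈ (i ∷ F) ++ (Q ++ rows-of (s ∷ S ++ D)) → k ∈ F ++ ((i ∷ Q) ++ rows-of (s ∷ S ++ D))
    before (here refl) = ∈-++⁺ʳ F (here refl)
    before (there k∈) with ∈-++⁻ F k∈
    ... | inj₁ k∈F = ∈-++⁺ˡ k∈F
    ... | inj₂ k∈′ = ∈-++⁺ʳ F (there k∈′)
    extend : Result sweep (key m ∙ col-list B ∙ row-list F ∙ col-list (s ∷ S) ∙ col-list D ∙ row-list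
        (i ∷ Q)) m F cs
               (F ++ ((i ∷ Q) ++ rows-of (s ∷ S ++ D))) (pred p) (pred p * 1516) 3
               (4 + (suc (length Q) + (length B + suc (length S))) + length cs * 2800)
               (suc (length Q) + (length B + suc (length S)) + length cs * 2) →
             Result sweep (key m ∙ col-list (β ∷ B) ∙ row-list (i ∷ F) ∙ col-list
                 (s ∷ S) ∙ col-list D ∙ row-list Q) m (i ∷ F) cs
               ((i ∷ F) ++ (Q ++ rows-of (s ∷ S ++ D))) p (p * 1516) 3
               (4 + (length Q + (suc (length B) + suc (length S))) + length cs * 2800)
               (length Q + (suc (length B) + suc (length S)) + length cs * 2)
    extend r with widen before r
    ... | emptied {F′ = F′} {t} E u v c t≤ S′ = emptied (tails (λ _ → when-≽ m≼x refl refl refl) E) u v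
      (lin 4 (λ p p′ f g → 1 ⊠ p :≤ con 1 :+ p′ ⊢ 1 ⊠ f :+ p′ :≤ g ⊢ goal (f :+ p :≤ con 1 :+ g))
        (p ∷ pred p ∷ length F′ ∷ length F ∷ []) (n≤1+pred[n] p) c)
      (lin 5 (λ p p′ f g t → 1516 ⊠ p :≤ con 1 :+ p′ ⊢ 1 ⊠ t :+ p′ :* 1516 :+ f :≤ con 3 :+ g ⊢
        goal (con 1 :+ t :+ p :* 1516 :+ f :≤ con 3 :+ (con 1520 :+ g)))
        (p ∷ pred p ∷ length F′ * 1520 ∷ length F * 1520 ∷ t ∷ []) (n≤1+pred[n] p) t≤) S′
    ... | exhausted {t = t} E v t≤ c S′ = exhausted (tails (λ _ → when-≽ m≼x refl refl refl) E) v
      (lin 6 (λ t q b s k f → 1 ⊠ t :≤ con 4 :+ (con 1 :+ q :+ (b :+ s)) :+ k :+ f ⊢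
        goal (con 1 :+ t :≤ con 4 :+ (q :+ (con 1 :+ b :+ s)) :+ k :+ (con 1520 :+ f)))
        (t ∷ length Q ∷ length B ∷ suc (length S) ∷ length cs * 2800 ∷ length F * 1520 ∷ []) t≤)
      (lin 5 (λ r q b s k → 1 ⊠ r :≤ con 1 :+ q :+ (b :+ s) :+ k ⊢ goal (r :≤ q :+ (con 1 :+ b :+ s) :+ k))
        (_ ∷ length Q ∷ length B ∷ suc (length S) ∷ length cs * 2 ∷ []) c)
      S′

  record Halved (S : List Key) : Set where
    constructor halves
    field
      {lo hi}   : List Key
      {pivot}   : Key
      {time}    : ℕ
      run       : Eval o halve (col-list S) time (col-list lo ∙ col-list hi ∙ key pivot)
      perm      : lo ++ hi ↭ S
      hi>0      : 1 ≤ length hi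
      lo>0      : 1 ≤ length lo
      lo≤hi+1   : length lo ≤ 1 + length hi
      hi≤lo     : length hi ≤ length lo
      below     : All (_≼ pivot) lo
      above     : All (pivot ≼_) hi
      cost      : time ≤ length S * 502
      sizes      : length lo + length hi ≡ length S

  eval-halved : ∀ S → 2 ≤ length S → Halved S
  eval-halved S 2≤ with eval-halve (length S) (λ x → x) no-payload S 2≤ ≤-refl
  ... | mk-split {lo} {hi} E p u v w c = halves E p
      (subst (1 ≤_) (sym hi≡) (⌊n/2⌋-mono 2≤)) (subst (1 ≤_) (sym u) (⌈n/2⌉-mono (≤-trans (n≤1+n 1) 2≤)))
      (subst₂ (λ x y → x ≤ suc y) (sym u) (sym hi≡) (⌈n/2⌉≤1+⌊n/2⌋ (length S)))
      (subst₂ _≤_ (sym hi≡) (sym u) (⌊n/2⌋≤⌈n/2⌉ (length S))) v w c sizes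
    where
    sizes : length lo + length hi ≡ length S
    sizes = trans (sym (length-++ lo)) (↭-length p)
    hi≡ : length hi ≡ ⌊ length S /2⌋
    hi≡ = +-cancelˡ-≡ (length lo) _ _ (trans sizes (trans (sym (⌊n/2⌋+⌈n/2⌉≡n (length S)))
      (trans (+-comm ⌊ length S /2⌋ _) (cong (_+ ⌊ length S /2⌋) (sym u)))))

  sweep-drain : ∀ b → RefineSpec (λ F → length F < b) → ∀ {m F} S → length F < suc b → All (m ≼_) S →
      2 ≤ length S →
    Result drain (key m ∙ row-list F ∙ col-list S) m F (cols-of S) (F ++ rows-of S)
      (length S) (length S * 1512) 0 (length S * 4000) (length S * 4)
  sweep-drain b rec {m} {F} S F< m≼S 2≤ = extend
    (eval-sweep b rec F (length S) {m} {S} {S} {[]} {[]} {cols-of S}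
       (lin 3 (λ f b s → 1 ⊠ con 1 :+ f :≤ con 1 :+ b ⊢ 1 ⊠ con 2 :≤ s ⊢
           goal (con 1 :+ f :≤ b :+ s)) (length F ∷ b ∷ length S ∷ []) F< 2≤)
       ≤-refl ≤-refl m≼S [] [] (↭-reflexive (cong cols-of (++-identityʳ S)))
       (subst (2 ≤_) (sym (length-map proj₂ S)) 2≤))
    where
    enter-sweep : ∀ xs → 2 ≤ length xs → ∀ κ →
      act (body o drain) ((key m ∙ row-list F ∙ col-list xs) ∙ κ) ≡
      just (enter (label o sweep) ((key m ∙ col-list xs ∙ row-list F ∙ col-list xs ∙ nat 0 ∙ nat 0) ∙ κ))
    enter-sweep (_ ∷ []) (s≤s ()) κ
    enter-sweep (_ ∷ _ ∷ _) _ κ = refl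
    k≤ : length (cols-of S) ≤ length S
    k≤ = ≤-reflexive (length-map proj₂ S)
    extend : Result sweep (key m ∙ col-list S ∙ row-list F ∙ col-list S ∙ nat 0 ∙ nat 0) m F (cols-of S)
               (F ++ ([] ++ rows-of (S ++ []))) (length S) (length S * 1516) 3
               (4 + (0 + (length S + length S)) + length (cols-of S) * 2800)
               (0 + (length S + length S) + length (cols-of S) * 2) →
             Result drain (key m ∙ row-list F ∙ col-list S) m F (cols-of S) (F ++ rows-of S)
               (length S) (length S * 1512) 0 (length S * 4000) (length S * 4)
    extend r with widen (λ {i} → subst (λ xs → i ∈ F ++ rows-of S → i ∈ F ++ rows-of xs) (sym (++-identityʳ S)) (λ e → e)) r
    ... | emptied {t = t} E p q c t≤ S′ = emptied (tails (enter-sweep S 2≤) E) p q c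
      (lin 4 (λ t n f g → 1 ⊠ t :+ n :* 1516 :+ f :≤ con 3 :+ g ⊢ 2 ⊠ con 2 :≤ n ⊢
          goal (con 1 :+ t :+ n :* 1512 :+ f :≤ con 0 :+ g))
        (t ∷ length S ∷ _ ∷ length F * 1520 ∷ []) t≤ 2≤) S′
    ... | exhausted {t = t} E q t≤ c S′ = exhausted (tails (enter-sweep S 2≤) E) q
      (lin 4 (λ t n k f → 1 ⊠ t :≤ con 4 :+ (con 0 :+ (n :+ n)) :+ k :* 2800 :+ f ⊢ 2800 ⊠ k :≤ n ⊢
          3 ⊠ con 2 :≤ n ⊢
        goal (con 1 :+ t :≤ n :* 4000 :+ f)) (t ∷ length S ∷ length
            (cols-of S) ∷ length F * 1520 ∷ []) t≤ k≤ 2≤)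
      (≤-trans c (lin 2 (λ n k → 2 ⊠ k :≤ n ⊢
          goal (con 0 :+ (n :+ n) :+ k :* 2 :≤ n :* 4)) (length S ∷ length (cols-of S) ∷ []) k≤)) S′

  halve-refine : ∀ b → DrainSpec (λ F → length F < suc b) → RefineSpec (λ F → length F < b) →
    ∀ {m F} S {D Q cs} → length F < suc b → All (m ≼_) S → All (_≺ m) D → Tentative m Q →
        cols-of (S ++ D) ↭ cs →
    2 ≤ length cs → 2 ≤ length S →
    Result refine (key m ∙ row-list F ∙ col-list S ∙ col-list D ∙ row-list Q) m F cs (F ++ (Q ++ rows-of
        (S ++ D)))
      0 0 1 (length Q + length cs * 2800) (length Q + length cs * 2)
  halve-refine b rec-drain rec {m} {F} S {D} {Q} {cs} F< m≼S D≺m tentative p 2≤ 2≤S = refined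
      (eval-halved S 2≤S)
    where
    enter-halve : ∀ xs → 2 ≤ length xs → ∀ κ →
      act (body o refine) ((key m ∙ row-list F ∙ col-list xs ∙ col-list D ∙ row-list Q) ∙ κ) ≡
      just (enter (label o halve) (col-list xs ∙ (nat
          (label o refine₁) ∙ key m ∙ row-list F ∙ col-list D ∙ row-list Q) ∙ κ))
    enter-halve (_ ∷ []) (s≤s ()) κ
    enter-halve (_ ∷ _ ∷ _) _ κ = refl
    refined : Halved S → Result refine (key m ∙ row-list F ∙ col-list S ∙ col-list D ∙ row-list Q) m F cs
      (F ++ (Q ++ rows-of (S ++ D))) 0 0 1 (length Q + length cs * 2800) (length Q + length cs * 2)
    refined (halves {lo} {hi} {m₁} {t₁} E₁ q hi>0 lo>0 lo≤ hi≤ v w c sizes) = widen present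
      (Refining.refined {lo = lo} {hi = hi} (λ F′< → rec (≤-trans F′< (≤-pred F<)))
        (m≼m₁ lo lo>0 m≼lo v) m≼lo v D≺m tentative columns 2≤ hi>0 2hi≤
        (λ {_} {t} {_} {t′} E E′ → suc (t₁ + suc (t + t′)) , calls (enter-halve S 2≤S) E₁ (calls (λ _ → refl) E E′) ,
          -- With h columns in the upper half, `S` has at most 2h + 1 ≤ 3h columns. So the halving
          -- costs at most 502 times 3h, and two calls complete the 1508h.
          lin 6 (λ t₁ t t′ n l h → 1 ⊠ t₁ :≤ n :* 502 ⊢ 502 ⊠ n :≤ l :+ h ⊢ 502 ⊠ l :≤ con 1 :+ h ⊢
              504 ⊠ con 1 :≤ h ⊢
            goal (con 1 :+ (t₁ :+ (con 1 :+ (t :+ t′))) :≤ h :* 1508 :+ (t :+ t′)))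
            (t₁ ∷ t ∷ t′ ∷ length S ∷ length lo ∷ length hi ∷ []) c (≤-reflexive (sym sizes)) lo≤ hi>0)
        (rec-drain F< w hi>0))
      where
      m≼lo : All (m ≼_) lo
      m≼lo = Allₚ.++⁻ˡ lo (All-resp-↭ (↭-sym q) m≼S)
      m≼m₁ : ∀ xs → 1 ≤ length xs → All (m ≼_) xs → All (_≼ m₁) xs → m ≼ m₁
      m≼m₁ (x ∷ _) _ (m≼x ∷ _) (x≼m₁ ∷ _) = ≼-trans m≼x x≼m₁
      all : hi ++ (lo ++ D) ↭ S ++ D
      all = ↭-trans (↭-reflexive (sym (++-assoc hi lo D))) (++⁺ʳ D (↭-trans (++-comm hi lo) q))
      columns : cols-of (hi ++ (lo ++ D)) ↭ cs
      columns = ↭-trans (map⁺ proj₂ all) p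
      present : ∀ {i} → i ∈ F ++ (Q ++ rows-of (S ++ D)) → i ∈ F ++ (Q ++ rows-of (hi ++ (lo ++ D)))
      present i∈ = ∈-resp-↭ (++⁺ˡ F (++⁺ˡ Q (map⁺ proj₁ (↭-sym all)))) i∈
      2hi≤ : length hi * 2 ≤ length cs
      2hi≤ = lin 4 (λ l h d k → 1 ⊠ h :≤ l ⊢ 1 ⊠ l :+ h :+ d :≤ k ⊢ goal (h :* 2 :≤ k))
        (length lo ∷ length hi ∷ length D ∷ length cs ∷ []) hi≤
        (≤-reflexive (trans (cong (_+ length D) sizes) (trans (sym (length-++ S)) (trans (sym
            (length-map proj₂ (S ++ D))) (↭-length p)))))

  single-drain : ∀ {m F} s → m ≼ s →
    Result drain (key m ∙ row-list F ∙ col-list (s ∷ [])) m F (proj₂ s ∷ []) (F ++ proj₁ s ∷ []) 1 1512 0 4000 4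
  single-drain {m} {F} s m≼s = extend (eval-single m F s m≼s)
    where
    extend : Result single (key m ∙ row-list F ∙ item s) m F (proj₂ s ∷ []) (F ++ proj₁ s ∷ []) 1 1519 0 1 0 →
      Result drain (key m ∙ row-list F ∙ col-list (s ∷ [])) m F (proj₂ s ∷ [])
          (F ++ proj₁ s ∷ []) 1 1512 0 4000 4
    extend (emptied {t = t} E p q c t≤ S) = emptied (tails (λ _ → refl) E) p q c
      (lin 3 (λ t f g → 1 ⊠ t :+ con 1519 :+ f :≤ con 0 :+ g ⊢ goal (con 1 :+ t :+ con 1512 :+ f :≤ con 0 :+ g))
        (t ∷ _ ∷ length F * 1520 ∷ []) t≤) S
    extend (exhausted {t = t} E q t≤ c S) = exhausted (tails (λ _ → refl) E) q
      (lin 2 (λ t f → 1 ⊠ t :≤ con 1 :+ f ⊢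
          goal (con 1 :+ t :≤ con 4000 :+ f)) (t ∷ length F * 1520 ∷ []) t≤) (≤-trans c z≤n) S

  -- The induction is on a bound for the rows, not for the columns. A sweep uses at least two rows
  -- before it turns to `refine`, and a round of `refine` that continues has used a row for every
  -- column it drained.
  eval-drain  : ∀ b → DrainSpec (λ F → length F < b)
  eval-refine : ∀ b → RefineSpec (λ F → length F < b)

  eval-drain (suc b) {S = s ∷ []}        F< (m≼s ∷ []) _ = single-drain s m≼s
  eval-drain (suc b) {S = S@(_ ∷ _ ∷ _)} F< m≼S _ = sweep-drain b (eval-refine b) S F< m≼S (s≤s (s≤s z≤n))

  eval-refine (suc b) {m} {F} {[]} {D} F< m≼S D≺m tentative p 2≤ =
    emptied {D = D} {F′ = F} (returns (λ _ _ _ → refl)) D≺m p (≤-reflexive (+-identityʳ _)) ≤-refl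
      (nothing-left {F = F} D≺m tentative p)
  eval-refine (suc b) {m} {F} {s ∷ []} {D} {Q} F< (m≼s ∷ []) D≺m tentative p 2≤ =
    Refining.refined {lo = []} {hi = s ∷ []} (λ F′< →
        eval-refine b (≤-trans F′< (≤-pred F<))) ≼-refl [] [] D≺m tentative p 2≤
      ≤-refl 2≤ (λ {_} {t} {_} {t′} E E′ → suc (t + t′) , calls (λ _ → refl) E E′ , s≤s (m≤n+m _ 1507))
      (single-drain s m≼s)
  eval-refine (suc b) {S = S@(_ ∷ _ ∷ _)} F< m≼S D≺m tentative p 2≤ =
    halve-refine b (eval-drain (suc b)) (eval-refine b) S F< m≼S D≺m tentative p 2≤ (s≤s (s≤s z≤n))

  -- Pairing rows with columns, and thinning the rows

  eval-rows : ∀ S R → Eval o rows (col-list S ∙ row-list R) (suc (length S)) (row-list (rows-of S ʳ++ R))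
  eval-rows []      R = returns (λ _ _ _ → refl)
  eval-rows (s ∷ S) R = tails (λ _ → refl) (eval-rows S (proj₁ s ∷ R))

  eval-cols : ∀ S R → Eval o cols (col-list S ∙ row-list R) (suc (length S)) (row-list (cols-of S ʳ++ R))
  eval-cols []      R = returns (λ _ _ _ → refl)
  eval-cols (s ∷ S) R = tails (λ _ → refl) (eval-cols S (proj₂ s ∷ R))

  -- Every column gets a first key without a comparison. Each pairing uses up one row of `R`, so the
  -- rows belonging to the keys of a set of columns are as many as these columns when `test` drops
  -- them.
  record Zipped (R C : List (Fin n)) (S₀ : List Key) : Set where
    field
      {F}  : List (Fin n)
      {S}  : List Key
      run  : Eval o zip (row-list C ∙ row-list R ∙ col-list S₀) (suc (length C)) (row-list F ∙ col-list S)
      columns : cols-of S ↭ C ++ cols-of S₀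
      present : F ++ rows-of S ↭ R ++ rows-of S₀

  eval-zip : ∀ R C S₀ → length C ≤ length R → Zipped R C S₀
  eval-zip R       []      S₀ _ = record { F = R ; S = S₀ ; run = returns (λ _ _ _ →
      refl) ; columns = ↭-refl ; present = ↭-refl }
  eval-zip (i ∷ R) (j ∷ C) S₀ (s≤s c≤r) = record
    { run = tails (λ _ → refl) run
    ; columns = ↭-trans columns (shift j C (cols-of S₀))
    ; present = ↭-trans present (shift i R (rows-of S₀)) }
    where open Zipped (eval-zip R C ((i , j) ∷ S₀) c≤r)

  Preserves-rows : List Row → List Key → List Row → Set
  Preserves-rows F S R = ∀ {z} → Saddle z → proj₂ z ∈ cols-of S → proj₁ z ∈ F ++ rows-of S → proj₁ z ∈ R

  record Thinned (F : List Row) (S : List Key) : Set where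
    constructor thinned
    field
      {R}   : List Row
      {t}   : ℕ
      run   : Eval o thin (row-list F ∙ col-list S) t (row-list R)
      R≤    : length R ≤ length S * 3
      R≥    : length S ≤ length R
      cost  : t ≤ length F * 1520 + length S * 2600
      sound : Preserves-rows F S R

  -- A lost saddlepoint has its column outside of `hi`, hence in `lo`, and `matched` finds its row
  -- among those of `lo`. A round that empties `hi` uses rows of `F`, so the rounds end. When the
  -- rows run out, one row per column and at most 4 · |hi| ≤ 2 · |S| others remain, whence the
  -- factor 3.
  eval-thin : ∀ b F S → length F < b → 2 ≤ length S → Thinned F S
  eval-thin (suc b) F S F< 2≤ = halved (eval-halved S 2≤)
    where
    halved : Halved S → Thinned F S
    halved (halves {lo} {hi} {m} {t₁} E₁ p hi>0 lo>0 lo≤ hi≤ v w c sizes) = drained (eval-drain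
        (suc b) F< w hi>0)
      where
      n≤ : length S ≤ 1 + length hi * 2
      n≤ = lin 3 (λ n l h → 1 ⊠ n :≤ l :+ h ⊢ 1 ⊠ l :≤ con 1 :+ h ⊢ goal (n :≤ con 1 :+ h :* 2))
        (length S ∷ length lo ∷ length hi ∷ []) (≤-reflexive (sym sizes)) lo≤
      2hi≤n : length hi * 2 ≤ length S
      2hi≤n = lin 3 (λ n l h → 1 ⊠ l :+ h :≤ n ⊢ 1 ⊠ h :≤ l ⊢ goal (h :* 2 :≤ n))
        (length S ∷ length lo ∷ length hi ∷ []) (≤-reflexive sizes) hi≤
      columns : cols-of S ↭ cols-of hi ++ cols-of lo
      columns = ↭-trans (map⁺ proj₂ (↭-trans (↭-sym p) (++-comm lo hi))) (↭-reflexive (map-++ proj₂ hi lo))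
      sound : ∀ {R R′ : List Row} → Sound m (cols-of hi) (F ++ rows-of hi) R →
              (∀ {z} → Saddle z → proj₂ z ∈ cols-of S → proj₁ z ∈ R ⊎ proj₁ z ∈ rows-of lo → proj₁ z ∈ R′) →
              Preserves-rows F S R′
      sound {R} {R′} dr continue {z} s j∈ i∈ = locate (∈-++⁻ F i∈)
        where
        from-drain : proj₁ z ∈ R ⊎ Lost m (cols-of hi) z → proj₁ z ∈ R′
        from-drain (inj₁ i∈R) = continue s j∈ (inj₁ i∈R)
        from-drain (inj₂ (m≼z , j∉hi)) with ∈-++⁻ (cols-of hi) (∈-resp-↭ columns j∈)
        ... | inj₁ j∈hi = ⊥-elim (j∉hi j∈hi)
        ... | inj₂ j∈lo = continue s j∈ (inj₂ (matched v s m≼z j∈lo))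
        locate : proj₁ z ∈ F ⊎ proj₁ z ∈ rows-of S → proj₁ z ∈ R′
        locate (inj₁ i∈F) = from-drain (dr s (∈-++⁺ˡ i∈F))
        locate (inj₂ i∈S) with rows-++⁻ lo (∈-resp-↭ (map⁺ proj₁ (↭-sym p)) i∈S)
        ... | inj₁ i∈lo = continue s j∈ (inj₂ i∈lo)
        ... | inj₂ i∈hi = from-drain (dr s (∈-++⁺ʳ F i∈hi))
      drained : Result drain (key m ∙ row-list F ∙ col-list hi) m F (cols-of hi) (F ++ rows-of hi)
                  (length hi) (length hi * 1512) 0 (length hi * 4000) (length hi * 4) → Thinned F S
      drained (exhausted {Q} {C} {t} E C↭hi t≤ Q≤ dr) = thinned
        (calls (λ _ → refl) E₁ (calls (λ _ → refl) E (calls (λ _ → refl) (eval-rev-append o item C lo)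
          (tails (λ _ → refl) (eval-rows (C ʳ++ lo) Q)))))
        (lin 6 (λ r c l q h n → 1 ⊠ r :≤ c :+ l :+ q ⊢ 1 ⊠ c :≤ h ⊢ 1 ⊠ q :≤ h :* 4 ⊢ 1 ⊠ l :+ h :≤ n ⊢
            2 ⊠ h :* 2 :≤ n ⊢ goal (r :≤ n :* 3))
          (_ ∷ length C ∷ length lo ∷ length Q ∷ length hi ∷ length S ∷ []) (≤-reflexive R≡)
              (≤-reflexive C≡hi) Q≤ (≤-reflexive sizes) 2hi≤n)
        (lin 6 (λ r c l q h n → 1 ⊠ c :+ l :+ q :≤ r ⊢ 1 ⊠ h :≤ c ⊢ 1 ⊠ n :≤ l :+ h ⊢ goal (n :≤ r))
          (_ ∷ length C ∷ length lo ∷ length Q ∷ length hi ∷ length S ∷ []) (≤-reflexive (sym R≡))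
              (≤-reflexive (sym C≡hi)) (≤-reflexive (sym sizes)))
        (lin 8 (λ t₁ t c x n h l f → 1 ⊠ t₁ :≤ n :* 502 ⊢ 1 ⊠ t :≤ h :* 4000 :+ f ⊢ 2 ⊠ c :≤ h ⊢
            1 ⊠ x :≤ c :+ l ⊢
          2001 ⊠ h :* 2 :≤ n ⊢ 1 ⊠ l :+ h :≤ n ⊢ 4 ⊠ con 2 :≤ n ⊢
          goal (con 1 :+ (t₁ :+ (con 1 :+ (t :+ (con 1 :+ (con 1 :+ c :+ (con 1 :+
              (con 1 :+ x))))))) :≤ f :+ n :* 2600))
          (t₁ ∷ t ∷ length C ∷ length (C ʳ++ lo) ∷ length S ∷ length hi ∷ length lo ∷ length F * 1520 ∷ [])
          c t≤ (≤-reflexive C≡hi) (≤-reflexive (length-ʳ++ C)) 2hi≤n (≤-reflexive sizes) 2≤)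
        (sound dr continue)
        where
        C≡hi = cols-length C↭hi
        R≡ : length (rows-of (C ʳ++ lo) ʳ++ Q) ≡ length C + length lo + length Q
        R≡ = trans (length-ʳ++ (rows-of (C ʳ++ lo))) (cong (_+ length Q) (trans (length-map proj₁ (C ʳ++ lo))
            (length-ʳ++ C)))
        into : ∀ {i} → i ∈ rows-of (C ++ lo) ++ Q → i ∈ rows-of (C ʳ++ lo) ʳ++ Q
        into i∈ = ∈-resp-↭ (↭-sym (↭-trans (ʳ++-↭ (rows-of (C ʳ++ lo)) Q) (++⁺ʳ Q (map⁺ proj₁
            (ʳ++-↭ C lo))))) i∈
        continue : ∀ {z} → Saddle z → proj₂ z ∈ cols-of S → proj₁ z ∈ Q ++ rows-of C ⊎ proj₁ z ∈ rows-of lo →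
                   proj₁ z ∈ rows-of (C ʳ++ lo) ʳ++ Q
        continue _ _ (inj₂ i∈lo) = into (∈-++⁺ˡ (rows-++⁺ʳ C i∈lo))
        continue _ _ (inj₁ i∈) with ∈-++⁻ Q i∈
        ... | inj₁ i∈Q = into (∈-++⁺ʳ (rows-of (C ++ lo)) i∈Q)
        ... | inj₂ i∈C = into (∈-++⁺ˡ (rows-++⁺ˡ C i∈C))
      drained (emptied {D} {F′} {t} E D≺ D↭hi F′< t≤ dr) = again (eval-thin b F′ (D ʳ++ lo)
          (lin 4 (λ f′ h f b → 1 ⊠ f′ :+ h :≤ f ⊢ 1 ⊠ con 1 :≤ h ⊢ 1 ⊠ con 1 :+ f :≤ con 1 :+ b ⊢
              goal (con 1 :+ f′ :≤ b))
            (length F′ ∷ length hi ∷ length F ∷ b ∷ []) F′< hi>0 F<)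
          (subst (2 ≤_) (sym S′≡) 2≤))
        where
        D≡hi = cols-length D↭hi
        S′≡ : length (D ʳ++ lo) ≡ length S
        S′≡ = trans (length-ʳ++ D) (trans (cong (_+ length lo) D≡hi) (trans (+-comm (length hi)
            (length lo)) sizes))
        again : Thinned F′ (D ʳ++ lo) → Thinned F S
        again (thinned {R} {t′} E′ R≤ R≥ t′≤ so) = thinned
          (calls (λ _ → refl) E₁ (calls (λ _ → refl) E (calls (λ _ → refl) (eval-rev-append o item D lo) E′)))
          (subst (λ l → length R ≤ l * 3) S′≡ R≤) (subst (_≤ length R) S′≡ R≥)
          (lin 9 (λ t₁ t d t′ n h f′ f k → 1 ⊠ t₁ :≤ n :* 502 ⊢ 1 ⊠ t :+ h :* 1512 :+ f′ :≤ con 0 :+ f ⊢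
              1 ⊠ d :≤ h ⊢
            1 ⊠ t′ :≤ f′ :+ k ⊢ 1 ⊠ k :≤ n :* 2600 ⊢ 502 ⊠ n :≤ con 1 :+ h :* 2 ⊢ 507 ⊠ con 1 :≤ h ⊢
            goal (con 1 :+ (t₁ :+ (con 1 :+ (t :+ (con 1 :+ (con 1 :+ d :+ t′))))) :≤ f :+ n :* 2600))
            (t₁ ∷ t ∷ length D ∷ t′ ∷ length S ∷ length hi ∷ length F′ * 1520 ∷ length F * 1520 ∷ length
                (D ʳ++ lo) * 2600 ∷ [])
            c t≤ (≤-reflexive D≡hi) t′≤ (≤-reflexive (cong (_* 2600) S′≡)) n≤ hi>0)
          (sound dr continue)
          where
          swap-cols : cols-of S ↭ cols-of (D ʳ++ lo)
          swap-cols = ↭-trans columns (↭-trans (++⁺ʳ (cols-of lo) (↭-sym D↭hi))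
            (↭-trans (↭-reflexive (sym (map-++ proj₂ D lo))) (map⁺ proj₂ (↭-sym (ʳ++-↭ D lo)))))
          into : ∀ {i} → i ∈ rows-of (D ++ lo) → i ∈ F′ ++ rows-of (D ʳ++ lo)
          into i∈ = ∈-++⁺ʳ F′ (∈-resp-↭ (map⁺ proj₁ (↭-sym (ʳ++-↭ D lo))) i∈)
          continue : ∀ {z} → Saddle z → proj₂ z ∈ cols-of S →
              proj₁ z ∈ F′ ++ rows-of D ⊎ proj₁ z ∈ rows-of lo → proj₁ z ∈ R
          continue s j∈ (inj₂ i∈lo) = so s (∈-resp-↭ swap-cols j∈) (into (rows-++⁺ʳ D i∈lo))
          continue s j∈ (inj₁ i∈) with ∈-++⁻ F′ i∈
          ... | inj₁ i∈F′ = so s (∈-resp-↭ swap-cols j∈) (∈-++⁺ˡ i∈F′)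
          ... | inj₂ i∈D = so s (∈-resp-↭ swap-cols j∈) (into (rows-++⁺ˡ D i∈D))

  -- The staircase test at the median

  Reaches : Key → List Key → Row → Set
  Reaches m S i = ∃[ j ] (j ∈ cols-of S × m ≼ (i , j))

  Falls : Key → Fin n → Set
  Falls m j = ∃[ i ] (i , j) ≺ m

  data Stairs (m : Key) (S : List Key) (R : List Row) : Set where
    all-fall : ∀ {t R′} → Eval o stair ((key m ∙ col-list S) ∙ row-list R) t (nat 1 ∙ row-list R′) →
      t ≤ 1 + length S + length R → 1 ≤ length R′ → length R′ ≤ length R →
      (∀ {i} → i ∈ R → i ∈ R′ ⊎ Reaches m S i) → (∀ {j} → j ∈ cols-of S → Falls m j) → Stairs m S R
    all-reach : ∀ {t C} → Eval o stair ((key m ∙ col-list S) ∙ row-list R) t (nat 0 ∙ row-list C) →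
      t ≤ 3 + length S * 2 + length R → 1 ≤ length C → length C ≤ length S →
      (∀ {i} → i ∈ R → Reaches m S i) → (∀ {j} → j ∈ cols-of S → j ∈ C ⊎ Falls m j) → Stairs m S R

  -- Every comparison with `m` removes its row or its column, as in a walk along a staircase; this
  -- gives linear time. Whichever list remains when the other runs out is nonempty, which keeps the
  -- outer recursion away from empty sets of rows or columns.
  eval-stair : ∀ b m S R → length S + length R < b → 1 ≤ length S → Stairs m S R
  eval-stair (suc b) m S@(s ∷ S′) [] _ _ = all-reach {C = cols-of S ʳ++ []}
    (calls (λ _ → refl) (eval-cols S []) (returns (λ _ _ _ → refl)))
    (lin 1 (λ s → goal (con 1 :+ (con 1 :+ s :+ con 1) :≤ con 3 :+ s :* 2 :+ con 0)) (length S ∷ []))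
    (subst (1 ≤_) (sym C≡) (s≤s z≤n)) (≤-reflexive C≡) (λ ())
    (λ j∈ → inj₁ (∈-resp-↭ (↭-sym (ʳ++-↭ (cols-of S) [])) (∈-++⁺ˡ j∈)))
    where
    C≡ : length (cols-of S ʳ++ []) ≡ length S
    C≡ = trans (length-ʳ++ (cols-of S)) (trans (+-identityʳ _) (length-map proj₂ S))
  eval-stair (suc b) m (s@(g , j) ∷ S) (i ∷ R) l _ with ≺-or-≽ (i , j) m
  eval-stair (suc b) m (s@(g , j) ∷ S) (i ∷ R) l _ | inj₂ m≼x
    with eval-stair b m (s ∷ S) R (≤-pred (subst (_< suc b) (cong suc (+-suc (length S) (length R))) l))
        (s≤s z≤n)
  ... | all-fall E t≤ R′> R′≤ p q = all-fall (tails (λ _ → when-≽ m≼x refl refl refl) E)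
    (≤-trans (s≤s t≤) (≤-reflexive (sym (+-suc (1 + suc (length S)) (length R))))) R′> (m≤n⇒m≤1+n R′≤) reach q
    where
    reach : ∀ {k} → k ∈ i ∷ R → k ∈ _ ⊎ Reaches m (s ∷ S) k
    reach (here refl) = inj₂ (j , here refl , m≼x)
    reach (there k∈)  = p k∈
  ... | all-reach E t≤ C> C≤ p q = all-reach (tails (λ _ → when-≽ m≼x refl refl refl) E)
    (≤-trans (s≤s t≤) (≤-reflexive (sym (+-suc (3 + suc (length S) * 2) (length R))))) C> C≤ reach q
    where
    reach : ∀ {k} → k ∈ i ∷ R → Reaches m (s ∷ S) k
    reach (here refl) = j , here refl , m≼x
    reach (there k∈)  = p k∈
  eval-stair (suc b) m (s@(g , j) ∷ []) (i ∷ R) _ _ | inj₁ x≺m = all-fall {R′ = i ∷ R}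
    (tails {p = o} {g = stair} (λ _ → when-≺ x≺m refl refl refl) (returns (λ _ _ _ → refl)))
    (s≤s (s≤s z≤n)) (s≤s z≤n) ≤-refl inj₁ (λ { (here refl) → i , x≺m })
  eval-stair (suc b) m (s@(g , j) ∷ S@(_ ∷ _)) (i ∷ R) l _ | inj₁ x≺m with eval-stair b m S (i ∷ R) (≤-pred l)
      (s≤s z≤n)
  ... | all-fall E t≤ R′> R′≤ p q = all-fall (tails (λ _ →
      when-≺ x≺m refl refl refl) E) (s≤s t≤) R′> R′≤ reach fall
    where
    reach : ∀ {k} → k ∈ i ∷ R → k ∈ _ ⊎ Reaches m (s ∷ S) k
    reach k∈ with p k∈
    ... | inj₁ k∈′ = inj₁ k∈′
    ... | inj₂ (l , l∈ , m≼) = inj₂ (l , there l∈ , m≼)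
    fall : ∀ {k} → k ∈ cols-of (s ∷ S) → Falls m k
    fall (here refl) = i , x≺m
    fall (there k∈)  = q k∈
  ... | all-reach E t≤ C> C≤ p q = all-reach (tails (λ _ →
      when-≺ x≺m refl refl refl) E) (≤-trans (s≤s t≤) (n≤1+n _)) C> (m≤n⇒m≤1+n C≤) reach fall
    where
    reach : ∀ {k} → k ∈ i ∷ R → Reaches m (s ∷ S) k
    reach k∈ with p k∈
    ... | l , l∈ , m≼ = l , there l∈ , m≼
    fall : ∀ {k} → k ∈ cols-of (s ∷ S) → k ∈ _ ⊎ Falls m k
    fall (here refl) = inj₂ (i , x≺m)
    fall (there k∈)  = q k∈

  data Tested (F : List Row) (S : List Key) : Set where
    fewer-rows : ∀ {t R} → Eval o test (row-list F ∙ col-list S) t (nat 1 ∙ row-list R) →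
      t ≤ length S * 508 + length F → 1 ≤ length R → length R * 3 + length S ≤ (length F + length S) * 3 →
      Preserves-rows F S R → Tested F S
    fewer-cols : ∀ {t C} → Eval o test (row-list F ∙ col-list S) t (nat 0 ∙ row-list C) →
      t ≤ length S * 508 + length F → 1 ≤ length C → length C * 3 + length S ≤ length S * 3 →
      (∀ {z} → Saddle z → proj₂ z ∈ cols-of S → proj₁ z ∈ F ++ rows-of S → proj₂ z ∈ C) → Tested F S

  eval-test : ∀ F S → 2 ≤ length S → Tested F S
  eval-test F S 2≤ = halved (eval-halved S 2≤)
    where
    halved : Halved S → Tested F S
    halved (halves {lo} {hi} {m} {t₁} E₁ p hi>0 lo>0 lo≤ hi≤ v w c sizes) = stairs (eval-stair (suc
        (length hi + length W)) m hi W ≤-refl hi>0)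
      where
      W : List Row
      W = rows-of lo ʳ++ F
      W≡ : length W ≡ length lo + length F
      W≡ = trans (length-ʳ++ (rows-of lo)) (cong (_+ length F) (length-map proj₁ lo))
      columns : ∀ {j} → j ∈ cols-of S → j ∈ cols-of hi ⊎ j ∈ cols-of lo
      columns j∈ = cols-++⁻ hi (∈-resp-↭ (map⁺ proj₂ (↭-trans (↭-sym p) (++-comm lo hi))) j∈)
      present : ∀ {i} → i ∈ F ++ rows-of S → i ∈ W ⊎ i ∈ rows-of hi
      present i∈ with ∈-++⁻ F i∈
      ... | inj₁ i∈F = inj₁ (∈-resp-↭ (↭-sym (ʳ++-↭ (rows-of lo) F)) (∈-++⁺ʳ (rows-of lo) i∈F))
      ... | inj₂ i∈S with rows-++⁻ lo (∈-resp-↭ (map⁺ proj₁ (↭-sym p)) i∈S)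
      ...   | inj₁ i∈lo = inj₁ (∈-resp-↭ (↭-sym (ʳ++-↭ (rows-of lo) F)) (∈-++⁺ˡ i∈lo))
      ...   | inj₂ i∈hi = inj₂ i∈hi
      high : ∀ {i} → i ∈ rows-of hi → Reaches m hi i
      high i∈ with ∈-map⁻ proj₁ i∈
      ... | (i , j) , x∈ , refl = j , ∈-map⁺ proj₂ x∈ , All.lookup w x∈
      -- If the column of `z` were in the lower half, `z` would be at most its key, hence at most
      -- `m` and at most the entry of its own row that reaches `m` in `hi`. By strictness that entry
      -- is `z` itself. So rows that reach `m` in `hi` may be dropped even if they hold keys of
      -- lower columns.
      in-high : ∀ {z} → Saddle z → proj₂ z ∈ cols-of S → Reaches m hi (proj₁ z) → proj₂ z ∈ cols-of hi
      in-high s j∈ (j , j∈hi , m≼) with columns j∈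
      ... | inj₁ j∈′ = j∈′
      ... | inj₂ j∈lo with ∈-map⁻ proj₂ j∈lo
      ...   | (g , _) , x∈ , refl =
        subst (_∈ cols-of hi) (row-unique s (≼-trans (col-min s g) (≼-trans (All.lookup v x∈) m≼))) j∈hi
      no-fall : ∀ {z} → Saddle z → Reaches m hi (proj₁ z) → Falls m (proj₂ z) → ⊥
      no-fall s (j , _ , m≼) (i , x≺m) = ≺⋠ x≺m (≼-trans m≼ (≼-trans (row-max s j) (col-min s i)))
      stairs : Stairs m hi W → Tested F S
      stairs (all-fall {t} {R} E t≤ R> R≤ q r) = fewer-rows
        (calls (λ _ → refl) E₁ (calls (λ _ → refl) (eval-rows lo F) E))
        (lin 7 (λ t₁ t x l h n f → 1 ⊠ t₁ :≤ n :* 502 ⊢ 1 ⊠ t :≤ con 1 :+ h :+ x ⊢ 1 ⊠ x :≤ l :+ f ⊢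
            2 ⊠ l :+ h :≤ n ⊢
          2 ⊠ con 2 :≤ n ⊢
          goal (con 1 :+ (t₁ :+ (con 1 :+ (con 1 :+ l :+ t))) :≤ n :* 508 :+ f))
          (t₁ ∷ t ∷ length W ∷ length lo ∷ length hi ∷ length S ∷ length F ∷ [])
          c t≤ (≤-reflexive W≡) (≤-reflexive sizes) 2≤)
        R>
        -- At least the rows of the keys in `hi` disappear, and three times their number is at least
        -- the number of columns, as the halves differ by at most one.
        (lin 6 (λ r x l f h n → 3 ⊠ r :≤ x ⊢ 3 ⊠ x :≤ l :+ f ⊢ 1 ⊠ l :≤ con 1 :+ h ⊢ 1 ⊠ con 1 :≤ h ⊢
            2 ⊠ l :+ h :≤ n ⊢
          goal (r :* 3 :+ n :≤ (f :+ n) :* 3))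
          (length R ∷ length W ∷ length lo ∷ length F ∷ length hi ∷ length S ∷ [])
          R≤ (≤-reflexive W≡) lo≤ hi>0 (≤-reflexive sizes))
        sound
        where
        sound : Preserves-rows F S R
        sound {z} s j∈ i∈ = from (present i∈)
          where
          reach : Reaches m hi (proj₁ z) → proj₁ z ∈ R
          reach ρ′ = ⊥-elim (no-fall s ρ′ (r (in-high s j∈ ρ′)))
          from : proj₁ z ∈ W ⊎ proj₁ z ∈ rows-of hi → proj₁ z ∈ R
          from (inj₂ i∈hi) = reach (high i∈hi)
          from (inj₁ i∈W) with q i∈W
          ... | inj₁ i∈R = i∈R
          ... | inj₂ ρ′ = reach ρ′
      stairs (all-reach {t} {C} E t≤ C> C≤ q r) = fewer-cols
        (calls (λ _ → refl) E₁ (calls (λ _ → refl) (eval-rows lo F) E))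
        (lin 7 (λ t₁ t x l h n f → 1 ⊠ t₁ :≤ n :* 502 ⊢ 1 ⊠ t :≤ con 3 :+ h :* 2 :+ x ⊢ 1 ⊠ x :≤ l :+ f ⊢
            2 ⊠ l :+ h :≤ n ⊢
          3 ⊠ con 2 :≤ n ⊢
          goal (con 1 :+ (t₁ :+ (con 1 :+ (con 1 :+ l :+ t))) :≤ n :* 508 :+ f))
          (t₁ ∷ t ∷ length W ∷ length lo ∷ length hi ∷ length S ∷ length F ∷ [])
          c t≤ (≤-reflexive W≡) (≤-reflexive sizes) 2≤)
        C>
        (lin 4 (λ c h l n → 3 ⊠ c :≤ h ⊢ 2 ⊠ l :+ h :≤ n ⊢ 1 ⊠ h :≤ l ⊢ goal (c :* 3 :+ n :≤ n :* 3))
          (length C ∷ length hi ∷ length lo ∷ length S ∷ []) C≤ (≤-reflexive sizes) hi≤)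
        sound
        where
        sound : ∀ {z} → Saddle z → proj₂ z ∈ cols-of S → proj₁ z ∈ F ++ rows-of S → proj₂ z ∈ C
        sound {z} s j∈ i∈ = from (r (in-high s j∈ ρ′))
          where
          ρ′ : Reaches m hi (proj₁ z)
          ρ′ with present i∈
          ... | inj₁ i∈W  = q i∈W
          ... | inj₂ i∈hi = high i∈hi
          from : proj₂ z ∈ C ⊎ Falls m (proj₂ z) → proj₂ z ∈ C
          from (inj₁ j∈C) = j∈C
          from (inj₂ f)   = ⊥-elim (no-fall s ρ′ f)

-- The search

module Search (O : StrictTotalOrder a ℓ₁ ℓ₂) (A : Matrix O n) where
  open Act O A
  open Evaluation O A
  private module O = StrictTotalOrder O

  point : Bool → Key → Key
  point true  z       = z
  point false (i , j) = j , i

  report-value : Report → Val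
  report-value (just (p , q)) = nat 1 ∙ nat p ∙ nat q
  report-value nothing        = nat 0 ∙ nat 0

  record Solved (o : Bool) (f : Name) (v : Val) (b : ℕ) : Set (a ⊔ ℓ₂) where
    constructor solved
    field
      {verdict} : Report
      {time}    : ℕ
      run       : Eval o f v time (report-value verdict)
      correct   : Correct O A verdict
      cost      : time ≤ b

  open Solved

  Covers : Bool → List (Fin n) → List (Fin n) → Set ℓ₂
  Covers o R C = ∀ {i j} → StrictSaddlepoint O A i j → proj₁ (point o (i , j)) ∈ R × proj₂ (point o (i , j)) ∈ C

  -- Strict saddlepoints and verification of the last candidate

  module Verification (o : Bool) where
    open Oriented O A o
    open Saddle

    unique-≺ : ∀ {i} {x : Fin n → Key} → (∀ k → k ≢ i → x k ≺ x i) → (∀ k → x k ≼ x i) × (∀ {k} → x i ≼ x k →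
        k ≡ i)
    unique-≺ {i} {x} f = max , unique
      where
      max : ∀ k → x k ≼ x i
      max k with k ≟ᶠ i
      ... | yes refl = ≼-refl
      ... | no k≢i   = ≺⇒≼ (f k k≢i)
      unique : ∀ {k} → x i ≼ x k → k ≡ i
      unique {k} p with k ≟ᶠ i
      ... | yes e  = e
      ... | no k≢i = ⊥-elim (≺⋠ (f k k≢i) p)

    unique-≻ : ∀ {i} {x : Fin n → Key} → (∀ k → k ≢ i → x i ≺ x k) → (∀ k → x i ≼ x k) × (∀ {k} → x k ≼ x i →
        k ≡ i)
    unique-≻ {i} {x} f = min , unique
      where
      min : ∀ k → x i ≼ x k
      min k with k ≟ᶠ i
      ... | yes refl = ≼-refl
      ... | no k≢i   = ≺⇒≼ (f k k≢i)
      unique : ∀ {k} → x k ≼ x i → k ≡ i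
      unique {k} p with k ≟ᶠ i
      ... | yes e  = e
      ... | no k≢i = ⊥-elim (≺⋠ (f k k≢i) p)

    RowStrict ColStrict : Key → Set
    RowStrict z = ∀ k → k ≢ proj₂ z → (proj₁ z , k) ≺ z
    ColStrict z = ∀ k → k ≢ proj₁ z → z ≺ (k , proj₂ z)

    to-saddle : ∀ {z} → RowStrict z → ColStrict z → Saddle z
    to-saddle {i , j} r c = record
      { row-max    = proj₁ (unique-≺ {x = λ k → i , k} r)
      ; row-unique = proj₂ (unique-≺ {x = λ k → i , k} r)
      ; col-min    = proj₁ (unique-≻ {x = λ k → k , j} c)
      ; col-unique = proj₂ (unique-≻ {x = λ k → k , j} c) }

  module V = Verification

  strict⇒ : ∀ o {i j} → StrictSaddlepoint O A i j →
      V.RowStrict o (point o (i , j)) × V.ColStrict o (point o (i , j))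
  strict⇒ true {i} {j} (r , c) =
    (λ k ne → Oriented.≺-intro (dec-true (A i k O.<? A i j) (r k ne))) ,
    (λ k ne → Oriented.≺-intro (dec-true (A i j O.<? A k j) (c k ne)))
  strict⇒ false {i} {j} (r , c) =
    (λ k ne → Oriented.≺-intro (dec-true (A i j O.<? A k j) (c k ne))) ,
    (λ k ne → Oriented.≺-intro (dec-true (A i k O.<? A i j) (r k ne)))

  strict⇐ : ∀ o z → V.RowStrict o z → V.ColStrict o z →
      StrictSaddlepoint O A (proj₁ (point o z)) (proj₂ (point o z))
  strict⇐ true (i , j) r c =
    (λ k ne → does-yes (A i k O.<? A i j) (Oriented._≺_.is-less (r k ne))) ,
    (λ k ne → does-yes (A i j O.<? A k j) (Oriented._≺_.is-less (c k ne)))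
  strict⇐ false (j , i) r c =
    (λ k ne → does-yes (A i k O.<? A i j) (Oriented._≺_.is-less (c k ne))) ,
    (λ k ne → does-yes (A i j O.<? A k j) (Oriented._≺_.is-less (r k ne)))

  module Verifying (o : Bool) where
    open Oriented O A o
    open Saddle
    open Verification o

    saddle : ∀ {i j} → StrictSaddlepoint O A i j → Saddle (point o (i , j))
    saddle s = to-saddle (proj₁ (strict⇒ o s)) (proj₂ (strict⇒ o s))

    Only : Key → Set ℓ₂
    Only z = ∀ {i j} → StrictSaddlepoint O A i j → point o (i , j) ≡ z

    when-equal : ∀ m {p q : Maybe Action} → choose (just (positive (nat ((m ∸ m) + (m ∸ m))))) p q ≡ q
    when-equal m rewrite n∸n≡0 m = refl

    when-different : ∀ {k l : Fin n} {p q : Maybe Action} → k ≢ l →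
      choose (just (positive (nat ((toℕ k ∸ toℕ l) + (toℕ l ∸ toℕ k))))) p q ≡ p
    when-different {k} {l} ne with (toℕ k ∸ toℕ l) + (toℕ l ∸ toℕ k) in e
    ... | suc _ = refl
    ... | zero  = ⊥-elim (ne (toℕ-injective (≤-antisym
      (m∸n≡0⇒m≤n (m+n≡0⇒m≡0 (toℕ k ∸ toℕ l) e)) (m∸n≡0⇒m≤n (m+n≡0⇒n≡0 (toℕ k ∸ toℕ l) e)))))

    accept : ∀ p z g s κ → act (body p verify-col) ((nat 0 ∙ key z) ∙ (nat g ∙ s) ∙ κ) ≡
             just (enter g ((s ∙ nat 1 ∙ key (point p z)) ∙ κ))
    accept true  z g s κ = refl
    accept false z g s κ = refl

    -- The search shows that no position other than `z` can be a strict saddlepoint, but not that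
    -- `z` is one. It is therefore compared with its full row and column, dropped indices included,
    -- and if it fails there is none.
    verify-cols : ∀ L z → Only z → RowStrict z → (∀ k → k ∈ L ⊎ (k ≢ proj₁ z → z ≺ (k , proj₂ z))) →
      Solved o verify-col (row-list L ∙ key z) (1 + length L)
    verify-cols [] z only r c = solved {verdict = just (toℕ (proj₁ (point o z)) , toℕ (proj₂ (point o z)))}
        (returns (accept o z))
      (proj₁ (point o z) , proj₂ (point o z) , refl , refl , strict⇐ o z r c′) ≤-refl
      where
      c′ : ColStrict z
      c′ k ne with c k
      ... | inj₂ p = p ne
    verify-cols (k ∷ L) z@(i , j) only r c with k ≟ᶠ i
    ... | yes refl = extend (verify-cols L z only r c′)
      where
      c′ : ∀ l → l ∈ L ⊎ (l ≢ k → z ≺ (l , j))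
      c′ l with c l
      ... | inj₁ (here refl) = inj₂ (λ ne → ⊥-elim (ne refl))
      ... | inj₁ (there l∈)  = inj₁ l∈
      ... | inj₂ p           = inj₂ p
      extend : Solved o verify-col (row-list L ∙ key z) (1 + length L) →
          Solved o verify-col (row-list (k ∷ L) ∙ key z) (2 + length L)
      extend (solved E p b) = solved (tails (λ _ → when-equal (toℕ k)) E) p (s≤s b)
    ... | no k≢i with ≺-or-≽ z (k , j)
    ...   | inj₁ z≺ = extend (verify-cols L z only r c′)
      where
      c′ : ∀ l → l ∈ L ⊎ (l ≢ i → z ≺ (l , j))
      c′ l with c l
      ... | inj₁ (here refl) = inj₂ (λ _ → z≺)
      ... | inj₁ (there l∈)  = inj₁ l∈
      ... | inj₂ p           = inj₂ p
      extend : Solved o verify-col (row-list L ∙ key z) (1 + length L) →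
          Solved o verify-col (row-list (k ∷ L) ∙ key z) (2 + length L)
      extend (solved E p b) = solved (tails (λ _ →
          trans (when-different k≢i) (when-≺ z≺ refl refl refl)) E) p (s≤s b)
    ...   | inj₂ ≼z = solved {verdict = nothing} (returns (λ _ _ _ →
        trans (when-different k≢i) (when-≽ ≼z refl refl refl))) none′ (s≤s z≤n)
      where
      none′ : ∀ p q → ¬ StrictSaddlepoint O A p q
      none′ p q s = k≢i (col-unique (subst Saddle (only s) (saddle s)) ≼z)

    verify-rows : ∀ L M z → Only z → (∀ k → k ∈ M) → (∀ k → k ∈ L ⊎ (k ≢ proj₂ z → (proj₁ z , k) ≺ z)) →
      Solved o verify-row (row-list L ∙ row-list M ∙ key z) (2 + length M + length L)
    verify-rows [] M z only full r = extend (verify-cols M z only r′ (λ k → inj₁ (full k)))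
      where
      r′ : RowStrict z
      r′ k ne with r k
      ... | inj₂ p = p ne
      extend : Solved o verify-col (row-list M ∙ key z) (1 + length M) →
          Solved o verify-row (row-list [] ∙ row-list M ∙ key z) (2 + length M + 0)
      extend (solved E p b) = solved (tails (λ _ →
          refl) E) p (s≤s (≤-trans b (≤-reflexive (sym (+-identityʳ _)))))
    verify-rows (k ∷ L) M z@(i , j) only full r with k ≟ᶠ j
    ... | yes refl = extend (verify-rows L M z only full r′)
      where
      r′ : ∀ l → l ∈ L ⊎ (l ≢ k → (i , l) ≺ z)
      r′ l with r l
      ... | inj₁ (here refl) = inj₂ (λ ne → ⊥-elim (ne refl))
      ... | inj₁ (there l∈)  = inj₁ l∈
      ... | inj₂ p           = inj₂ p
      extend : Solved o verify-row (row-list L ∙ row-list M ∙ key z) (2 + length M + length L) →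
               Solved o verify-row (row-list (k ∷ L) ∙ row-list M ∙ key z) (2 + length M + suc (length L))
      extend (solved E p b) = solved (tails (λ _ →
          when-equal (toℕ k)) E) p (≤-trans (s≤s b) (≤-reflexive (sym (+-suc (2 + length M) (length L)))))
    ... | no k≢j with ≺-or-≽ (i , k) z
    ...   | inj₁ ≺z = extend (verify-rows L M z only full r′)
      where
      r′ : ∀ l → l ∈ L ⊎ (l ≢ j → (i , l) ≺ z)
      r′ l with r l
      ... | inj₁ (here refl) = inj₂ (λ _ → ≺z)
      ... | inj₁ (there l∈)  = inj₁ l∈
      ... | inj₂ p           = inj₂ p
      extend : Solved o verify-row (row-list L ∙ row-list M ∙ key z) (2 + length M + length L) →
               Solved o verify-row (row-list (k ∷ L) ∙ row-list M ∙ key z) (2 + length M + suc (length L))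
      extend (solved E p b) = solved (tails (λ _ → trans (when-different k≢j) (when-≺ ≺z refl refl refl)) E) p
        (≤-trans (s≤s b) (≤-reflexive (sym (+-suc (2 + length M) (length L)))))
    ...   | inj₂ z≼ = solved {verdict = nothing} (returns (λ _ _ _ →
        trans (when-different k≢j) (when-≽ z≼ refl refl refl))) none′ (s≤s z≤n)
      where
      none′ : ∀ p q → ¬ StrictSaddlepoint O A p q
      none′ p q s = k≢j (row-unique (subst Saddle (only s) (saddle s)) z≼)

    -- Among equal minima the first is kept. Nothing is lost: a saddlepoint that is not below the
    -- kept entry of its column coincides with it.
    eval-argmin : ∀ L R z → (∀ k → k ∈ L) →
      (∀ {i j} → StrictSaddlepoint O A i j →
          proj₂ (point o (i , j)) ≡ proj₂ z × (proj₁ (point o (i , j)) ∈ R ⊎ z ≼ point o (i , j))) →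
      Solved o argmin (row-list L ∙ key z ∙ row-list R) (3 + length L * 2 + length R)
    eval-argmin L [] z full c = extend (verify-rows L L z only full (λ k → inj₁ (full k)))
      where
      only : Only z
      only s with c s
      ... | refl , inj₂ z≼ = cong (_, _) (sym (col-unique (saddle s) z≼))
      extend : Solved o verify-row (row-list L ∙ row-list L ∙ key z) (2 + length L + length L) →
               Solved o argmin (row-list L ∙ key z ∙ nat 0) (3 + length L * 2 + 0)
      extend (solved {time = t} E p b) = solved (tails (λ _ → refl) E) p
        (lin 2 (λ t l → 1 ⊠ t :≤ con 2 :+ l :+ l ⊢
            goal (con 1 :+ t :≤ con 3 :+ l :* 2 :+ con 0)) (t ∷ length L ∷ []) b)
    eval-argmin L (i ∷ R) z@(g , j) full c with ≺-or-≽ (i , j) z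
    ... | inj₁ x≺z = extend (eval-argmin L R (i , j) full c′)
      where
      c′ : ∀ {p q} → StrictSaddlepoint O A p q →
          proj₂ (point o (p , q)) ≡ j × (proj₁ (point o (p , q)) ∈ R ⊎ (i , j) ≼ point o (p , q))
      c′ s with c s
      ... | e , inj₁ (there i∈) = e , inj₁ i∈
      ... | refl , inj₁ (here refl) = refl , inj₂ ≼-refl
      ... | e , inj₂ z≼ = e , inj₂ (≼-trans (≺⇒≼ x≺z) z≼)
      extend : Solved o argmin (row-list L ∙ key (i , j) ∙ row-list R) (3 + length L * 2 + length R) →
               Solved o argmin (row-list L ∙ key z ∙ row-list (i ∷ R)) (3 + length L * 2 + suc (length R))
      extend (solved E p b) = solved (tails (λ _ → when-≺ x≺z refl refl refl) E) p
        (≤-trans (s≤s b) (≤-reflexive (sym (+-suc (3 + length L * 2) (length R)))))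
    ... | inj₂ z≼x = extend (eval-argmin L R z full c′)
      where
      c′ : ∀ {p q} → StrictSaddlepoint O A p q →
          proj₂ (point o (p , q)) ≡ j × (proj₁ (point o (p , q)) ∈ R ⊎ z ≼ point o (p , q))
      c′ s with c s
      ... | e , inj₁ (there i∈) = e , inj₁ i∈
      ... | refl , inj₁ (here refl) = refl , inj₂ z≼x
      ... | e , inj₂ z≼ = e , inj₂ z≼
      extend : Solved o argmin (row-list L ∙ key z ∙ row-list R) (3 + length L * 2 + length R) →
               Solved o argmin (row-list L ∙ key z ∙ row-list (i ∷ R)) (3 + length L * 2 + suc (length R))
      extend (solved E p b) = solved (tails (λ _ → when-≽ z≼x refl refl refl) E) p
        (≤-trans (s≤s b) (≤-reflexive (sym (+-suc (3 + length L * 2) (length R)))))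

  -- The recursion on the surviving rows and columns

  module _ (L : List (Fin n)) (full : ∀ k → k ∈ L) where

    -- The closing scans over all indices happen once, so they stay outside of the rate per
    -- surviving row and column.
    tail-cost : ℕ
    tail-cost = length L * 2 + 8

    Outer : Bool → List (Fin n) → List (Fin n) → ℕ → Set _
    Outer o R C b = Solved o outer (list index L ∙ list index R ∙ list index C) (b + tail-cost)

    module Tall (o : Bool) where
      open Oriented O A o
      open Verifying o
      open Columns using () renaming (items to col-list)

      start-outer : ∀ R C {t w} → Eval o outer₂ ((nat (length R) ∙ row-list L ∙ row-list R ∙ row-list C) ∙ nat
          (length C)) t w →
        Eval o outer (row-list L ∙ row-list R ∙ row-list C) (suc (suc (length R) + suc (suc (length C) + t))) w
      start-outer R C E = calls (λ _ → refl) (eval-count o index R 0) (calls (λ _ →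
          refl) (eval-count o index C 0) E)

      Smaller : List (Fin n) → List (Fin n) → Set _
      Smaller R C = ∀ {R′ C′} → length R′ + length C′ < length R + length C → 1 ≤ length R′ → 1 ≤ length C′ →
          Covers o R′ C′ →
        Outer o R′ C′ ((length R′ + length C′) * 9010)

      search-column : ∀ R C → 1 ≤ length R → length C ≡ 1 → Covers o R C →
        Solved o outer (row-list L ∙ row-list R ∙ row-list C) (8 + length L * 2 + (length R * 2 + length C))
      search-column (i ∷ R) (j ∷ []) _ refl cover = extend (eval-argmin L R (i , j) full start′)
        where
        start′ : ∀ {p q} → StrictSaddlepoint O A p q →
          proj₂ (point o (p , q)) ≡ j × (proj₁ (point o (p , q)) ∈ R ⊎ (i , j) ≼ point o (p , q))
        start′ s with cover s
        ... | here refl , here refl = refl , inj₂ ≼-refl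
        ... | there i∈ , here refl = refl , inj₁ i∈
        enter-argmin : ∀ κ → act (body o outer₂) (((nat (suc (length R)) ∙ row-list L ∙ row-list
            (i ∷ R) ∙ row-list (j ∷ [])) ∙ nat 1) ∙ κ) ≡
          just (enter (label o argmin) ((row-list L ∙ key (i , j) ∙ row-list R) ∙ κ))
        enter-argmin κ rewrite 0∸n≡0 (length R) = refl
        extend : Solved o argmin (row-list L ∙ key (i , j) ∙ row-list R) (3 + length L * 2 + length R) →
                 Solved o outer (row-list L ∙ row-list (i ∷ R) ∙ row-list (j ∷ [])) (8 + length L * 2 + (suc
                     (length R) * 2 + 1))
        extend (solved {time = t} E p b) = solved (start-outer (i ∷ R) (j ∷ []) (tails enter-argmin E)) p
          (lin 3 (λ t r l → 1 ⊠ t :≤ con 3 :+ l :+ r ⊢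
            goal (con 1 :+ (con 2 :+ r :+ (con 1 :+ (con 2 :+ (con 1 :+ t)))) :≤ con 8 :+ l :+
                ((con 1 :+ r) :* 2 :+ con 1)))
            (t ∷ length R ∷ length L * 2 ∷ []) b)

      one-column : ∀ R C → 1 ≤ length R → length C ≡ 1 → Covers o R C →
          Outer o R C ((length R + length C) * 9000)
      one-column R C r> c≡1 cover = extend (search-column R C r> c≡1 cover)
        where
        extend : Solved o outer (row-list L ∙ row-list R ∙ row-list C) (8 + length L * 2 +
            (length R * 2 + length C)) →
                 Outer o R C ((length R + length C) * 9000)
        extend (solved {time = t} E p b) = solved E p
          (lin 4 (λ t r c l → 1 ⊠ t :≤ con 8 :+ l :+ (r :* 2 :+ c) ⊢
              goal (t :≤ (r :+ c) :* 9000 :+ (l :+ con 8)))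
            (t ∷ length R ∷ length C ∷ length L * 2 ∷ []) b)

      -- The cost of a round is linear and is paid by what it removes. Thinning leaves at most 3c of
      -- more than 4c rows, so more than a quarter of them goes. The test removes at least c/3 rows
      -- or columns, a constant fraction of all as it is applied only for at most 4c rows.
      many-columns : ∀ R C → Smaller R C → length C ≤ length R → 2 ≤ length C → Covers o R C →
        Outer o R C ((length R + length C) * 9000)
      many-columns R C rec c≤r 2≤c cover = zipped (eval-zip R C [] c≤r)
        where
        r = length R
        c = length C
        flag = r ∸ (c + (c + (c + c)))
        enter-zip : ∀ κ → act (body o outer₂) (((nat r ∙ row-list L ∙ row-list R ∙ row-list C) ∙ nat c) ∙ κ) ≡
          just (enter (label o zip) ((row-list C ∙ row-list R ∙ nat 0) ∙
            (nat (label o outer₃) ∙ nat flag ∙ row-list L ∙ row-list R ∙ row-list C) ∙ κ))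
        enter-zip κ rewrite m≤n⇒m∸n≡0 c≤r with c ∸ 1 | m<n⇒0<n∸m 2≤c
        ... | suc _ | _ = refl
        zipped : Zipped R C [] → Outer o R C ((r + c) * 9000)
        zipped record { F = F ; S = S ; run = run-zip ; columns = columns ; present = present } = branch′ flag
            refl
          where
          S≡c : length S ≡ c
          S≡c = trans (sym (length-map proj₂ S)) (trans (↭-length columns) (trans (length-++ C)
              (+-identityʳ c)))
          2≤S = subst (2 ≤_) (sym S≡c) 2≤c
          F+S≡r : length F + length S ≡ r
          F+S≡r = trans (cong (length F +_) (sym (length-map proj₁ S)))
            (trans (sym (length-++ F)) (trans (↭-length present) (trans (length-++ R) (+-identityʳ r))))
          F+c≤r : length F + c ≤ r
          F+c≤r = ≤-reflexive (trans (cong (length F +_) (sym S≡c)) F+S≡r)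
          in-columns : ∀ {j} → j ∈ C → j ∈ cols-of S
          in-columns j∈ = ∈-resp-↭ (↭-sym columns) (∈-++⁺ˡ j∈)
          in-rows : ∀ {i} → i ∈ R → i ∈ F ++ rows-of S
          in-rows i∈ = ∈-resp-↭ (↭-sym present) (∈-++⁺ˡ i∈)
          begin-zip : ∀ {t w} → Eval o outer₃
              ((nat flag ∙ row-list L ∙ row-list R ∙ row-list C) ∙ row-list F ∙ col-list S) t w →
            Eval o outer (row-list L ∙ row-list R ∙ row-list C) (suc (suc r + suc (suc c + suc (suc c + t)))) w
          begin-zip E = start-outer R C (calls enter-zip run-zip E)
          thin-case : ∀ f → flag ≡ suc f → Thinned F S → Outer o R C ((r + c) * 9000)
          thin-case f e (thinned {R′} {t} E R′≤ R′≥ t≤ sound) =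
            extend (rec smaller (≤-trans (s≤s z≤n) (≤-trans 2≤S R′≥)) (≤-trans (s≤s z≤n) 2≤c) cover′)
            where
            4c<r : suc (c + (c + (c + c))) ≤ r
            4c<r = m<n⇒m<n′ (subst (0 <_) (sym e) (s≤s z≤n))
              where
              m<n⇒m<n′ : 0 < flag → c + (c + (c + c)) < r
              m<n⇒m<n′ 0< = ≰⇒> (λ r≤ → <⇒≢ 0< (sym (m≤n⇒m∸n≡0 r≤)))
            R′≤3c : length R′ ≤ c * 3
            R′≤3c = subst (λ s → length R′ ≤ s * 3) S≡c R′≤
            smaller : length R′ + c < r + c
            smaller = lin 3 (λ p c r → 1 ⊠ p :≤ c :* 3 ⊢ 1 ⊠ con 1 :+ (c :+ (c :+ (c :+ c))) :≤ r ⊢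
                goal (con 1 :+ (p :+ c) :≤ r :+ c))
              (length R′ ∷ c ∷ r ∷ []) R′≤3c 4c<r
            cover′ : Covers o R′ C
            cover′ s = sound (saddle s) (in-columns (proj₂ (cover s))) (in-rows (proj₁ (cover s))) , proj₂
                (cover s)
            enter-thin : ∀ κ → act (body o outer₃)
                (((nat flag ∙ row-list L ∙ row-list R ∙ row-list C) ∙ row-list F ∙ col-list S) ∙ κ) ≡
              just (enter (label o thin) ((row-list F ∙ col-list S) ∙ (nat
                  (label o outer₄) ∙ row-list L ∙ row-list C) ∙ κ))
            enter-thin κ rewrite e = refl
            extend : Outer o R′ C ((length R′ + c) * 9010) → Outer o R C ((r + c) * 9000)
            extend (solved {time = u} E′ p b) = solved (begin-zip (calls enter-thin E (tails (λ _ →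
                refl) E′))) p
              (lin 8 (λ r c f s p t u l → 1 ⊠ t :≤ f :* 1520 :+ s :* 2600 ⊢ 1520 ⊠ f :+ c :≤ r ⊢
                  2600 ⊠ s :≤ c ⊢ 9010 ⊠ p :≤ c :* 3 ⊢
                7479 ⊠ con 1 :+ (c :+ (c :+ (c :+ c))) :≤ r ⊢ 1 ⊠ u :≤ (p :+ c) :* 9010 :+ (l :* 2 :+ con 8) ⊢
                goal (con 1 :+ (con 1 :+ r :+ (con 1 :+ (con 1 :+ c :+ (con 1 :+ (con 1 :+ c :+ (con 1 :+
                    (t :+ (con 1 :+ u)))))))) :≤
                  (r :+ c) :* 9000 :+ (l :* 2 :+ con 8)))
                (r ∷ c ∷ length F ∷ length S ∷ length R′ ∷ t ∷ u ∷ length L ∷ [])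
                t≤ F+c≤r (≤-reflexive S≡c) R′≤3c 4c<r b)
          test-case : flag ≡ 0 → Tested F S → Outer o R C ((r + c) * 9000)
          test-case e (fewer-rows {t} {R′} E t≤ R′> R′≤ sound) = extend (rec smaller R′> (≤-trans
              (s≤s z≤n) 2≤c) cover′)
            where
            3R′ : length R′ * 3 + c ≤ r * 3
            3R′ = subst₂ (λ s q → length R′ * 3 + s ≤ q * 3) S≡c F+S≡r R′≤
            smaller : length R′ + c < r + c
            smaller = +-monoˡ-< c (≰⇒> (λ r≤R′ → <⇒≱ (≤-trans (s≤s z≤n) 2≤c)
              (lin 3 (λ p r c → 3 ⊠ r :≤ p ⊢ 1 ⊠ p :* 3 :+ c :≤ r :* 3 ⊢
                  goal (c :≤ con 0)) (length R′ ∷ r ∷ c ∷ []) r≤R′ 3R′)))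
            cover′ : Covers o R′ C
            cover′ s = sound (saddle s) (in-columns (proj₂ (cover s))) (in-rows (proj₁ (cover s))) , proj₂
                (cover s)
            enter-test : ∀ κ → act (body o outer₃)
                (((nat flag ∙ row-list L ∙ row-list R ∙ row-list C) ∙ row-list F ∙ col-list S) ∙ κ) ≡
              just (enter (label o test) ((row-list F ∙ col-list S) ∙ (nat
                  (label o outer₅) ∙ row-list L ∙ row-list R ∙ row-list C) ∙ κ))
            enter-test κ rewrite e = refl
            extend : Outer o R′ C ((length R′ + c) * 9010) → Outer o R C ((r + c) * 9000)
            extend (solved {time = u} E′ p b) = solved (begin-zip (calls enter-test E (tails (λ _ →
                refl) E′))) p
              (lin 8 (λ r c f s p t u l → 1 ⊠ t :≤ s :* 508 :+ f ⊢ 1 ⊠ f :+ c :≤ r ⊢ 508 ⊠ s :≤ c ⊢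
                  3004 ⊠ p :* 3 :+ c :≤ r :* 3 ⊢
                14 ⊠ r :≤ c :+ (c :+ (c :+ c)) ⊢ 4 ⊠ con 2 :≤ c ⊢
                    1 ⊠ u :≤ (p :+ c) :* 9010 :+ (l :* 2 :+ con 8) ⊢
                goal (con 1 :+ (con 1 :+ r :+ (con 1 :+ (con 1 :+ c :+ (con 1 :+ (con 1 :+ c :+ (con 1 :+
                    (t :+ (con 1 :+ u)))))))) :≤
                  (r :+ c) :* 9000 :+ (l :* 2 :+ con 8)))
                (r ∷ c ∷ length F ∷ length S ∷ length R′ ∷ t ∷ u ∷ length L ∷ [])
                t≤ F+c≤r (≤-reflexive S≡c) 3R′ (m∸n≡0⇒m≤n e) 2≤c b)
          test-case e (fewer-cols {t} {C′} E t≤ C′> C′≤ sound) = extend (rec smaller (≤-trans (s≤s z≤n)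
              (≤-trans 2≤c c≤r)) C′> cover′)
            where
            3C′ : length C′ * 3 + c ≤ c * 3
            3C′ = subst (λ s → length C′ * 3 + s ≤ s * 3) S≡c C′≤
            smaller : r + length C′ < r + c
            smaller = +-monoʳ-< r (≰⇒> (λ c≤C′ → <⇒≱ (≤-trans (s≤s z≤n) 2≤c)
              (lin 2 (λ p c → 3 ⊠ c :≤ p ⊢ 1 ⊠ p :* 3 :+ c :≤ c :* 3 ⊢
                  goal (c :≤ con 0)) (length C′ ∷ c ∷ []) c≤C′ 3C′)))
            cover′ : Covers o R C′
            cover′ s = proj₁ (cover s) , sound (saddle s) (in-columns (proj₂ (cover s))) (in-rows (proj₁
                (cover s)))
            enter-test : ∀ κ → act (body o outer₃)
                (((nat flag ∙ row-list L ∙ row-list R ∙ row-list C) ∙ row-list F ∙ col-list S) ∙ κ) ≡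
              just (enter (label o test) ((row-list F ∙ col-list S) ∙ (nat
                  (label o outer₅) ∙ row-list L ∙ row-list R ∙ row-list C) ∙ κ))
            enter-test κ rewrite e = refl
            extend : Outer o R C′ ((r + length C′) * 9010) → Outer o R C ((r + c) * 9000)
            extend (solved {time = u} E′ p b) = solved (begin-zip (calls enter-test E (tails (λ _ →
                refl) E′))) p
              (lin 8 (λ r c f s p t u l → 1 ⊠ t :≤ s :* 508 :+ f ⊢ 1 ⊠ f :+ c :≤ r ⊢ 508 ⊠ s :≤ c ⊢
                  3004 ⊠ p :* 3 :+ c :≤ c :* 3 ⊢
                14 ⊠ r :≤ c :+ (c :+ (c :+ c)) ⊢ 4 ⊠ con 2 :≤ c ⊢
                    1 ⊠ u :≤ (r :+ p) :* 9010 :+ (l :* 2 :+ con 8) ⊢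
                goal (con 1 :+ (con 1 :+ r :+ (con 1 :+ (con 1 :+ c :+ (con 1 :+ (con 1 :+ c :+ (con 1 :+
                    (t :+ (con 1 :+ u)))))))) :≤
                  (r :+ c) :* 9000 :+ (l :* 2 :+ con 8)))
                (r ∷ c ∷ length F ∷ length S ∷ length C′ ∷ t ∷ u ∷ length L ∷ [])
                t≤ F+c≤r (≤-reflexive S≡c) 3C′ (m∸n≡0⇒m≤n e) 2≤c b)
          branch′ : ∀ f → flag ≡ f → Outer o R C ((r + c) * 9000)
          branch′ (suc f) e = thin-case f e (eval-thin (suc (length F)) F S ≤-refl 2≤S)
          branch′ zero    e = test-case e (eval-test F S 2≤S)

      tall : ∀ R C → Smaller R C → length C ≤ length R → 1 ≤ length C → Covers o R C →
          Outer o R C ((length R + length C) * 9000)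
      tall R C rec c≤r c> cover with 2 ≤? length C
      ... | yes 2≤c = many-columns R C rec c≤r 2≤c cover
      ... | no 2≰c  = one-column R C (≤-trans c> c≤r) (≤-antisym (≤-pred (≰⇒> 2≰c)) c>) cover

    covers-flip : ∀ o {R C} → Covers o R C → Covers (not o) C R
    covers-flip true  cover s = proj₂ (cover s) , proj₁ (cover s)
    covers-flip false cover s = proj₂ (cover s) , proj₁ (cover s)

    -- Changing the orientation removes nothing, so the induction cannot pay for it. Hence the two
    -- rates: a round with enough rows is proved at 9000, and the difference to 9010 covers the r +
    -- c + 5 steps of a change. After it there are at least as many rows as columns.
    eval-outer : ∀ b o R C → length R + length C < b → 1 ≤ length R → 1 ≤ length C → Covers o R C →
      Outer o R C ((length R + length C) * 9010)
    eval-outer (suc b) o R C l r> c> cover with length C ≤? length R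
    ... | yes c≤r = extend (Tall.tall o R C (λ {R′} {C′} l′ → eval-outer b o R′ C′ (≤-trans l′ (≤-pred l))) c≤r c> cover)
      where
      extend : Outer o R C ((length R + length C) * 9000) → Outer o R C ((length R + length C) * 9010)
      extend (solved E p b) = solved E p (≤-trans b (+-monoˡ-≤ tail-cost (*-monoʳ-≤ (length R + length C)
          (m≤m+n 9000 10))))
    ... | no c≰r = extend (Tall.tall (not o) C R
        (λ {R′} {C′} l′ → eval-outer b (not o) R′ C′ (≤-trans l′ (≤-pred (subst (_< suc b) (+-comm (length R) (length C)) l))))
        (<⇒≤ (≰⇒> c≰r)) r> (covers-flip o cover))
      where
      enter-flip : ∀ κ → act (body o outer₂) (((nat
          (length R) ∙ list index L ∙ list index R ∙ list index C) ∙ nat (length C)) ∙ κ) ≡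
        just (enter (label (not o) outer) ((list index L ∙ list index C ∙ list index R) ∙ κ))
      enter-flip κ with length C ∸ length R | m<n⇒0<n∸m (≰⇒> c≰r)
      ... | suc _ | _ = refl
      extend : Outer (not o) C R ((length C + length R) * 9000) → Outer o R C ((length R + length C) * 9010)
      extend (solved {time = t} E p b) = solved (Tall.start-outer o R C (tails enter-flip E)) p
        (lin 4 (λ r c t l → 1 ⊠ t :≤ (c :+ r) :* 9000 :+ (l :* 2 :+ con 8) ⊢ 5 ⊠ con 1 :≤ r ⊢
          goal (con 1 :+ (con 1 :+ r :+ (con 1 :+ (con 1 :+ c :+ (con 1 :+ t)))) :≤ (r :+ c) :* 9010 :+
              (l :* 2 :+ con 8)))
          (length R ∷ length C ∷ t ∷ length L ∷ []) b r>)

  -- The run as a whole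

  eval-range : 1 ≤ n → ∀ k L → k + length L ≡ n → (∀ i → k ≤ toℕ i → i ∈ L) →
    Solved true range (nat k ∙ list index L) (1 + k + (n * 18022 + 8))
  eval-range 1≤n zero L e full = extend
    (eval-outer L (λ i → full i z≤n) (suc (length L + length L)) true L L ≤-refl 1≤L 1≤L (λ {i} {j} _ → full i z≤n , full j z≤n))
    where
    1≤L : 1 ≤ length L
    1≤L = subst (1 ≤_) (sym e) 1≤n
    extend : Outer L (λ i → full i z≤n) true L L ((length L + length L) * 9010) →
             Solved true range (nat 0 ∙ list index L) (1 + 0 + (n * 18022 + 8))
    extend (solved {time = t} E p b) = solved (tails (λ _ → refl) E) p
      -- The constant 18022 is 9010 for each of n rows and n columns, plus the 2n of the closing
      -- scans.
      (lin 3 (λ t l n → 1 ⊠ t :≤ (l :+ l) :* 9010 :+ (l :* 2 :+ con 8) ⊢ 18022 ⊠ l :≤ n ⊢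
          goal (con 1 :+ t :≤ con 1 :+ con 0 :+ (n :* 18022 :+ con 8)))
        (t ∷ length L ∷ n ∷ []) b (≤-reflexive e))
  eval-range 1≤n (suc k) L e full = extend (eval-range 1≤n k (i ∷ L) (trans (+-suc k (length L)) e) full′)
    where
    k<n : k < n
    k<n = subst (suc k ≤_) e (m≤m+n (suc k) (length L))
    i : Fin n
    i = fromℕ< k<n
    full′ : ∀ j → k ≤ toℕ j → j ∈ i ∷ L
    full′ j k≤j with k ≟ toℕ j
    ... | yes refl = here (toℕ-injective (sym (toℕ-fromℕ< k<n)))
    ... | no k≢j   = there (full j (≤∧≢⇒< k≤j k≢j))
    extend : Solved true range (nat k ∙ list index (i ∷ L)) (1 + k + (n * 18022 + 8)) →
             Solved true range (nat (suc k) ∙ list index L) (2 + k + (n * 18022 + 8))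
    extend (solved {r} {t} E p b) = solved
      (tails (λ _ → refl) (subst (λ v →
          Eval true range (nat k ∙ nat v ∙ list index L) t (report-value r)) (toℕ-fromℕ< k<n) E)) p (s≤s b)

  finish-act : ∀ r κ → act (body true finish) ((nat 0 ∙ report-value r) ∙ κ) ≡ just (halt r)
  finish-act (just _) κ = refl
  finish-act nothing  κ = refl

  runs : 1 ≤ n → ∃[ r ] ∃[ t ] (Runs table (label true start) (nat n) t r × Correct O A r × t ≤ n * 18040)
  runs 1≤n = extend (eval-range 1≤n n [] (+-identityʳ n) (λ i n≤i → ⊥-elim (<⇒≱ (toℕ<n i) n≤i)))
    where
    extend : Solved true range (nat n ∙ nat 0) (1 + n + (n * 18022 + 8)) →
             ∃[ r ] ∃[ t ] (Runs table (label true start) (nat n) t r × Correct O A r × t ≤ n * 18040)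
    extend (solved {r} {t} E p b) = r , suc (t + 1)
      , move (nth-table true start) refl (Eval.run E (stop (nth-table true finish) (finish-act r (nat 0))))
      , p
      , lin 2 (λ t n → 1 ⊠ t :≤ con 1 :+ n :+ (n :* 18022 :+ con 8) ⊢ 11 ⊠ con 1 :≤ n ⊢
          goal (con 1 :+ (t :+ con 1) :≤ n :* 18040))
          (t ∷ n ∷ []) b 1≤n

rescale : ∀ {s t m} → 1 ≤ n → t ≤ n * 18040 → s ≤ 4 + t * m → s ≤ (4 + 18040 * m) * n
rescale {n = n} {s} {t} {m} 1≤n b s≤ = begin
  s                        ≤⟨ s≤ ⟩
  4 + t * m                ≤⟨ +-mono-≤ (*-monoʳ-≤ 4 1≤n) (*-monoˡ-≤ m b) ⟩
  4 * n + n * 18040 * m    ≡⟨ cong (4 * n +_) (trans (cong (_* m) (*-comm n 18040)) (trans (*-assoc 18040 n m)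
                                (trans (cong (18040 *_) (*-comm n m)) (sym (*-assoc 18040 m n))))) ⟩
  4 * n + 18040 * m * n    ≡⟨ *-distribʳ-+ n 4 (18040 * m) ⟨
  (4 + 18040 * m) * n      ∎
  where open ≤-Reasoning

within-time : ∀ (O : StrictTotalOrder a ℓ₁ ℓ₂) (A : Matrix O n) {f cs} → 1 ≤ n →
  ∃[ r ] ∃[ t ] (Act.Runs O A cs f (nat n) t r × Correct O A r × t ≤ n * 18040) →
  ∃[ t ] ∃[ r ] (Halts O A (program f cs) t r × t ≤ (4 + 18040 * step-time cs) * n × Correct O A r)
within-time {n = n} O A {f} {cs} 1≤n (r , t , R , p , b) = extend (halts O A cs f R)
  where
  extend : ∃[ s ] (Halts O A (program f cs) s r × s ≤ 4 + t * step-time cs) →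
    ∃[ t ] ∃[ r ] (Halts O A (program f cs) t r × t ≤ (4 + 18040 * step-time cs) * n × Correct O A r)
  extend (s , H , s≤) = s , r , H , rescale {t = t} {m = step-time cs} 1≤n b s≤ , p

theorem1p1 : ∀ {a ℓ₁ ℓ₂} →
    ∃[ P ] ∃[ c ]
    ((O : StrictTotalOrder a ℓ₁ ℓ₂) (n : ℕ) .{{_ : NonZero n}} (A : Matrix O n) →
    ∃[ t ] ∃[ r ] (Halts O A P t r × t ≤ c * n × Correct O A r))
theorem1p1 = program (label true start) table , 4 + 18040 * step-time table ,
  λ O n A → within-time O A (>-nonZero⁻¹ n) (Search.runs O A (>-nonZero⁻¹ n))
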